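{- Elements of $D^{\mathsf{BC}}_{[\bar n,n]}$ correspond bijectively to elements of $B_n$ avoiding the signed patterns $1\bar2$, $\bar21$, $\bar2\bar1$, $312$, $3\bar12$. Specifically, $$D^{\mathsf{BC}}_{[\bar n,n]}=\{F_w\in Z^{\mathsf A}_{[\bar n,n]} : w\in B_n \text{ avoids } 1\bar2,\ \bar21,\ \bar2\bar1,\ 312,\ 3\bar12\}.$$
   Context: $[\bar n,n]=\{ -n,\dots,-1,1,\dots,n\}$, $\bar a=-a$, $[h,l]=\{h,\dots,l\}\setminus\{0\}$. $B_n$ is the group of permutations $w$ of $[\bar n,n]$ with $w(\bar i)=\overline{w(i)}$; $w_i=w(i)$. Signed patterns: for a word $v_1\cdots v_k$ in $[\bar k,k]$ with $|v_1|\cdots|v_k|$ a permutation of $[k]$, a word $y_1\cdots y_k$ in $[\bar n,n]$ with distinct absolute values matches $v$ if $v_i,y_i$ have equal signs and $|v_i|<|v_j|\iff|y_i|<|y_j|$; $w$ avoids $v$ if no subsequence of $w_1\cdots w_n$ matches $v$. (Ordinary avoidance of $3412,4231$ refers to the word $w_{\bar n}\cdots w_{\bar1}w_1\cdots w_n$.) Type-A planar network on $[h,l]$: directed planar acyclic multigraph in a disc with boundary vertices labelled clockwise source $h,\dots,$ source $l$, sink $l,\dots,$ sink $h$; edges may carry positive integer multiplicities; sources indegree 0, outdegree 1; sinks indegree 1, outdegree 0; networks identified up to label-preserving isomorphism. For $[a,b]\subseteq[h,l]$, $F_{[a,b]}$ has an edge source $i\to$ sink $i$ for $i\notin[a,b]$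 and one interior vertex $z$ with edges source $i\to z\to$ sink $i$ for $i\in[a,b]$ (no interior vertex if $a=b$). $E\bullet F$: merge, for each $i$, the edge into sink $i$ of $E$ with the edge out of source $i$ of $F$, then replace each set of $m>1$ parallel edges by one edge of multiplicity $m$. Intervals $[c_1,d_1],\dots,[c_t,d_t]$ (distinct, pairwise non-nesting) satisfy the zig-zag conditions if for all $i<j<k$ with $[c_i,d_i]\cap[c_j,d_j]\ne\emptyset\ne[c_j,d_j]\cap[c_k,d_k]$ one has $c_i<c_j<c_k$ or $c_i>c_j>c_k$, and the descending conditions if for all $i<j$ with $[c_i,d_i]\cap[c_j,d_j]\ne\emptyset$ one has $c_i>c_j$. $Z^{\mathsf A}_{[h,l]}$ is the set of trivial and $F_{[c_1,d_1]}\bullet\cdots\bullet F_{[c_t,d_t]}$ networks with intervals satisfying the zig-zag conditions. A path family of type $u$ is $(\pi_h,\dots,\pi_l)$ with $\pi_i$ from source $i$ to sink $u(i)$, covering $F$ if every edge lies on some path; for $F\in Z^{\mathsf A}_{[h,l]}$ the covering types have a unique element $w(F)$ of maximal length, and $F\mapsto w(F)$ is a bijection onto permutations avoiding $3412,4231$, with inverse $w\mapsto F_w$. Type-$\mathsf{BC}$ simple stars: $F'_{[a,b]}=F_{[a,b]}\bullet F_{[\bar b,\bar a]}$ ($1\le a\le b\le n$), $F'_{[\bar a,a]}=F_{[\bar a,a]}$; $D^{\mathsf{BC}}_{[\bar n,n]}$ is the set of networks $F'_{[c_1,d_1]}\bullet\cdots\bullet F'_{[c_t,d_t]}$ (including the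 trivial one) with intervals satisfying the descending conditions. -}

module Defs where

open import Data.Nat as ℕ using (ℕ; zero; suc; _+_; _*_; _∸_)
open import Data.Fin as Fin using (Fin; toℕ; opposite; splitAt; _↑ʳ_)
open import Data.Fin.Properties using (_≟_; _≤?_; _<?_)
open import Data.Integer as ℤ using (ℤ; +_; -[1+_]; ∣_∣; sign)
open import Data.Bool using (Bool; true; false; if_then_else_; _∧_)
open import Data.Sum using (_⊎_; inj₁; inj₂)
open import Data.Product using (Σ; ∃; _×_; _,_; proj₁; proj₂)
open import Data.List using (List; []; _∷_; length; lookup)
open import Data.List.Relation.Unary.All using (All)
open import Data.Vec as Vc using (Vec)
open import Relation.Nullary using (¬_; does; yes; no)
open import Relation.Binary.PropositionalEquality using (_≡_; _≢_)
open import Function.Bundles using (_↔_; Inverse; _⇔_)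
open import Function.Definitions using (Injective)

-- Label conventions.
-- A label set [h,l] with m elements is encoded by Fin m, order-preserving.
-- For type BC, [n̄,n] is encoded by Fin (n + n): index p < n stands for
-- the label -(n-p), index p ≥ n for the label p-n+1.  Hence bar (ā = -a)
-- is Fin.opposite.

label : (n : ℕ) → Fin (n + n) → ℤ
label n p with toℕ p ℕ.<? n
... | yes _ = -[1+ (n ∸ suc (toℕ p)) ]
... | no _  = + suc (toℕ p ∸ n)

bar : ∀ n → Fin (n + n) → Fin (n + n)
bar n = opposite

sumFin : ∀ {m} → (Fin m → ℕ) → ℕ
sumFin {zero}  f = 0
sumFin {suc m} f = f Fin.zero + sumFin (λ i → f (Fin.suc i))

-- Networks.  Vertices: boundary sources, boundary sinks, interior vertices.
-- A network is given by its number of interior vertices and the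
-- multiplicity of the edge x → y for every ordered pair (0 = no edge).

data V (m k : ℕ) : Set where
  src : Fin m → V m k
  snk : Fin m → V m k
  int : Fin k → V m k

record Network (m : ℕ) : Set where
  constructor net
  field
    size : ℕ
    mult : V m size → V m size → ℕ
open Network public

mapV : ∀ {m k k'} → (Fin k → Fin k') → V m k → V m k'
mapV σ (src i) = src i
mapV σ (snk i) = snk i
mapV σ (int j) = int (σ j)

_≅_ : ∀ {m} → Network m → Network m → Set
N ≅ M = Σ (Fin (size N) ↔ Fin (size M)) λ σ →
          ∀ x y → mult M (mapV (Inverse.to σ) x) (mapV (Inverse.to σ) y) ≡ mult N x y

indicator : Bool → ℕ
indicator b = if b then 1 else 0

trivial : ∀ {m} → Network m
trivial {m} = net 0 e
  where
  e : V m 0 → V m 0 → ℕ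
  e (src i) (snk j) = indicator (does (i ≟ j))
  e _ _ = 0

inI : ∀ {m} → Fin m → Fin m → Fin m → Bool
inI a b i = does (a ≤? i) ∧ does (i ≤? b)

star : ∀ {m} → Fin m → Fin m → Network m
star {m} a b with a ≟ b
... | yes _ = trivial
... | no _  = net 1 e
  where
  e : V m 1 → V m 1 → ℕ
  e (src i) (snk j) = indicator (does (i ≟ j) ∧ (if inI a b i then false else true))
  e (src i) (int _) = indicator (inI a b i)
  e (int _) (snk j) = indicator (inI a b j)
  e _ _ = 0

data Side (m kE kF : ℕ) : Set where
  onE : V m kE → Side m kE kF
  onF : V m kF → Side m kE kF

classify : ∀ {m kE kF} → V m (kE + kF) → Side m kE kF
classify (src i) = onE (src i)
classify (snk i) = onF (snk i)
classify {kE = kE} (int j) with splitAt kE j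
... | inj₁ a = onE (int a)
... | inj₂ b = onF (int b)

_•_ : ∀ {m} → Network m → Network m → Network m
_•_ {m} E F = net (size E + size F) e
  where
  e' : Side m (size E) (size F) → Side m (size E) (size F) → ℕ
  e' (onE x) (onE y) = mult E x y
  e' (onF x) (onF y) = mult F x y
  e' (onE x) (onF y) = sumFin (λ i → mult E x (snk i) * mult F (src i) y)
  e' (onF x) (onE y) = 0
  e : V m (size E + size F) → V m (size E + size F) → ℕ
  e x y = e' (classify x) (classify y)

Interval : ℕ → Set
Interval m = Fin m × Fin m

ValidI : ∀ {m} → Interval m → Set
ValidI (c , d) = c Fin.≤ d

Meets : ∀ {m} → Interval m → Interval m → Set
Meets {m} (c , d) (c' , d') = ∃ λ (x : Fin m) → c Fin.≤ x × x Fin.≤ d × c' Fin.≤ x × x Fin.≤ d'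

NestedIn : ∀ {m} → Interval m → Interval m → Set
NestedIn (c , d) (c' , d') = c' Fin.≤ c × d Fin.≤ d'

DistinctNonNesting : ∀ {m} → List (Interval m) → Set
DistinctNonNesting L = ∀ i j → i ≢ j →
  (lookup L i ≢ lookup L j) × ¬ NestedIn (lookup L i) (lookup L j)

ZigZag : ∀ {m} → List (Interval m) → Set
ZigZag L = ∀ i j k → i Fin.< j → j Fin.< k →
  Meets (lookup L i) (lookup L j) → Meets (lookup L j) (lookup L k) →
  let ci = proj₁ (lookup L i) ; cj = proj₁ (lookup L j) ; ck = proj₁ (lookup L k) in
  (ci Fin.< cj × cj Fin.< ck) ⊎ (cj Fin.< ci × ck Fin.< cj)

Descending : ∀ {m} → List (Interval m) → Set
Descending L = ∀ i j → i Fin.< j → Meets (lookup L i) (lookup L j) →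
  proj₁ (lookup L j) Fin.< proj₁ (lookup L i)

prodA : ∀ {m} → List (Interval m) → Network m
prodA [] = trivial
prodA ((c , d) ∷ L) = star c d • prodA L

InZA : ∀ {m} → Network m → Set
InZA N = (N ≅ trivial) ⊎
  (∃ λ L → All ValidI L × DistinctNonNesting L × ZigZag L × (N ≅ prodA L))

-- admissible intervals: [a,b] with 1 ≤ a ≤ b ≤ n, or [ā,a] with 1 ≤ a ≤ n
BCInterval : ∀ n → Interval (n + n) → Set
BCInterval n (c , d) = (n ℕ.≤ toℕ c × c Fin.≤ d) ⊎ (n ℕ.≤ toℕ d × c ≡ bar n d)

starBC : ∀ n → Fin (n + n) → Fin (n + n) → Network (n + n)
starBC n c d with c ≟ bar n d
... | yes _ = star c d
... | no _  = star c d • star (bar n d) (bar n c)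

prodBC : ∀ n → List (Interval (n + n)) → Network (n + n)
prodBC n [] = trivial
prodBC n ((c , d) ∷ L) = starBC n c d • prodBC n L

InDBC : ∀ n → Network (n + n) → Set
InDBC n N = ∃ λ L → All (BCInterval n) L × DistinctNonNesting L × Descending L × (N ≅ prodBC n L)

data Path {m} (N : Network m) : V m (size N) → V m (size N) → Set where
  edge : ∀ {x y} → 0 ℕ.< mult N x y → Path N x y
  _∷_  : ∀ {x y z} → 0 ℕ.< mult N x y → Path N y z → Path N x z

data EdgeOn {m} {N : Network m} (x y : V m (size N)) : ∀ {a b} → Path N a b → Set where
  here-edge : ∀ (p : 0 ℕ.< mult N x y) → EdgeOn x y (edge {x = x} {y = y} p)
  here      : ∀ {z} (p : 0 ℕ.< mult N x y) (π : Path N y z) → EdgeOn x y (p ∷ π)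
  there     : ∀ {a b z} (p : 0 ℕ.< mult N a b) {π : Path N b z} → EdgeOn x y π → EdgeOn x y (p ∷ π)

IsPerm : ∀ {m} → (Fin m → Fin m) → Set
IsPerm u = Injective _≡_ _≡_ u

Covers : ∀ {m} → Network m → (Fin m → Fin m) → Set
Covers N u = Σ (∀ i → Path N (src i) (snk (u i))) λ π →
  ∀ x y → 0 ℕ.< mult N x y → ∃ λ i → EdgeOn x y (π i)

len : ∀ {m} → (Fin m → Fin m) → ℕ
len u = sumFin (λ i → sumFin (λ j → indicator (does (i <? j) ∧ does (u j <? u i))))

IsWOf : ∀ {m} → Network m → (Fin m → Fin m) → Set
IsWOf N w = IsPerm w × Covers N w ×
  (∀ u → IsPerm u → Covers N u → (∀ i → u i ≡ w i) ⊎ len u ℕ.< len w)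

IsBn : ∀ n → (Fin (n + n) → Fin (n + n)) → Set
IsBn n w = IsPerm w × (∀ i → w (bar n i) ≡ bar n (w i))

word : ∀ n → (Fin (n + n) → Fin (n + n)) → Fin n → ℤ
word n w i = label n (w (n ↑ʳ i))

MatchesAt : ∀ n {k} → (Fin (n + n) → Fin (n + n)) → Vec ℤ k → (Fin k → Fin n) → Set
MatchesAt n w v ι =
  (∀ a b → a Fin.< b → ι a Fin.< ι b) ×
  (∀ a → sign (Vc.lookup v a) ≡ sign (word n w (ι a))) ×
  (∀ a b → (∣ Vc.lookup v a ∣ ℕ.< ∣ Vc.lookup v b ∣) ⇔ (∣ word n w (ι a) ∣ ℕ.< ∣ word n w (ι b) ∣))

Avoids : ∀ n {k} → (Fin (n + n) → Fin (n + n)) → Vec ℤ k → Set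
Avoids n w v = ¬ ∃ (MatchesAt n w v)

p1 p2 p3 : Vec ℤ 2
p1 = + 1 Vc.∷ ℤ.- (+ 2) Vc.∷ Vc.[]
p2 = ℤ.- (+ 2) Vc.∷ + 1 Vc.∷ Vc.[]
p3 = ℤ.- (+ 2) Vc.∷ ℤ.- (+ 1) Vc.∷ Vc.[]
p4 p5 : Vec ℤ 3
p4 = + 3 Vc.∷ + 1 Vc.∷ + 2 Vc.∷ Vc.[]
p5 = + 3 Vc.∷ ℤ.- (+ 1) Vc.∷ + 2 Vc.∷ Vc.[]

AvoidsAll5 : ∀ n → (Fin (n + n) → Fin (n + n)) → Set
AvoidsAll5 n w = Avoids n w p1 × Avoids n w p2 × Avoids n w p3 × Avoids n w p4 × Avoids n w p5

{-# OPTIONS --safe #-}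
module Submission where

open import Defs
open import Data.Nat as ℕ using (ℕ; zero; suc; _+_; _*_; _≤_; _<_; z≤n; s≤s)
import Data.Nat.Properties as ℕ
open import Data.Fin as Fin using (Fin; zero; suc; toℕ; fromℕ<; _↑ʳ_)
import Data.Fin.Properties as Fin
open import Data.Fin.Permutation as Perm using (Permutation′; _⟨$⟩ʳ_; flip; _∘ₚ_; transpose; permutation)
open import Data.Integer as ℤ using (ℤ; -[1+_]; ∣_∣; sign)
import Data.Sign as Sign
open import Data.Vec as Vc using ()
open import Data.List using (List; []; _∷_; _++_; _∷ʳ_; reverse; filter)
import Data.List as List
import Data.List.Properties as List
open import Data.List.Relation.Unary.All as All using (All; []; _∷_)
import Data.List.Relation.Unary.All.Properties as All
open import Data.List.Relation.Unary.Any using (here; there; any?)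
open import Data.List.Membership.Propositional using (_∈_; find)
open import Data.List.Relation.Binary.Sublist.Propositional using (_⊆_; []; _∷_; ⊆-trans; ⊆-refl; from∈; minimum) renaming (_∷ʳ_ to skip)
open import Data.List.Relation.Binary.Sublist.Propositional.Properties using (++⁺; reverse⁺; filter-⊆; All-resp-⊆)
open import Data.Bool using (Bool; true; false; if_then_else_; _∧_)
open import Data.Product using (Σ; ∃; _×_; _,_; proj₁; proj₂)
open import Data.Sum using (_⊎_; inj₁; inj₂; [_,_]′)
open import Data.Empty using (⊥; ⊥-elim)
open import Function using (_∘_)
open import Function.Bundles using (_⇔_; mk⇔; Equivalence; Inverse)
open import Function.Definitions using (Injective)
open import Relation.Nullary using (¬_; Dec; yes; no; does; contradiction)
open import Relation.Nullary.Decidable using (_×-dec_; ¬?; dec-true; dec-false)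
open import Relation.Unary using (Decidable)
open import Relation.Binary.Definitions using (tri<; tri≈; tri>)
open import Relation.Binary.PropositionalEquality hiding (J)
import Algebra.Properties.CommutativeMonoid.Sum ℕ.+-0-commutativeMonoid as Sum


-- A zig-zag network is a product of stars, and a permutation u is the type of a
-- covering family only if every source i reaches the sink u(i).  Multiplying by a
-- star on an interval I lets one rearrange the values on I freely, which changes only
-- inversions between positions of I; so the longest permutation is obtained from
-- that of the shorter product by making it decreasing on I, and every other
-- permutation compatible with reachability is strictly shorter.
--
-- Up to commuting disjoint stars, a zig-zag product is built by adding its leftmost
-- interval [c,d] at the front or at the back.  Its longest permutation w determines
-- it: c is the least point moved by w, d is the smaller of w(c) and w⁻¹(c), the side
-- is the one on which the minimum is attained, and the rest is recovered recursively.
--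
-- Let w avoid the five signed patterns and let e be the largest label it moves.  If
-- the value e sits at a positive position c, then w is decreasing on [c,e], and
-- removing [c,e] and its mirror image leaves such a permutation on smaller labels;
-- otherwise w is the longest permutation of the centre [-e,e].
-- The descending products are exactly those built by reversing this process.

-- Sums

-- Going from avoidance to descending networks requires that a zig-zag network be determined by its
-- `w`: an avoiding `w` is realised by a descending product built by hand, and a given zig-zag
-- network with the same `w` must turn out isomorphic to it. Codes serve this purpose; they are a
-- normal form of zig-zag lists that can be read off the permutation.
--
-- The types of covering families are enclosed between two conditions that are easier to handle. A
-- factorisation of `u` along the stars (`Fact`) yields a covering family of type `u`, and a
-- covering family puts every `u(i)` in reach of `i` (`InReach`). A factored permutation that is
-- longest among all those in reach is therefore the longest type.
--
-- Reversing the list of stars inverts the types and preserves length, so whatever is shown for a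
-- star added at the front holds for one added at the back, with `w` replaced by its inverse.

sumFin-cong : ∀ {m} {f g : Fin m → ℕ} → (∀ i → f i ≡ g i) → sumFin f ≡ sumFin g
sumFin-cong {zero}  e = refl
sumFin-cong {suc m} e = cong₂ _+_ (e zero) (sumFin-cong (e ∘ suc))

sumFin≡sum : ∀ {m} (f : Fin m → ℕ) → sumFin f ≡ Sum.sum f
sumFin≡sum {zero}  f = refl
sumFin≡sum {suc m} f = cong (f zero +_) (sumFin≡sum (f ∘ suc))

sumFin-+ : ∀ {m} (f g : Fin m → ℕ) → sumFin (λ i → f i + g i) ≡ sumFin f + sumFin g
sumFin-+ f g = begin
  sumFin (λ i → f i + g i)  ≡⟨ sumFin≡sum (λ i → f i + g i) ⟩
  Sum.sum (λ i → f i + g i) ≡⟨ Sum.∑-distrib-+ f g ⟩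
  Sum.sum f + Sum.sum g     ≡⟨ cong₂ _+_ (sumFin≡sum f) (sumFin≡sum g) ⟨
  sumFin f + sumFin g       ∎
  where open ≡-Reasoning

sumFin-permute : ∀ {m} (f : Fin m → ℕ) (π : Permutation′ m) → sumFin f ≡ sumFin (λ i → f (π ⟨$⟩ʳ i))
sumFin-permute f π = trans (sumFin≡sum f) (trans (Sum.sum-permute f π) (sym (sumFin≡sum (λ i → f (π ⟨$⟩ʳ i)))))

sumFin-mono : ∀ {m} {f g : Fin m → ℕ} → (∀ i → f i ≤ g i) → sumFin f ≤ sumFin g
sumFin-mono {zero}  e = z≤n
sumFin-mono {suc m} e = ℕ.+-mono-≤ (e zero) (sumFin-mono (e ∘ suc))

sumFin-mono-< : ∀ {m} {f g : Fin m → ℕ} → (∀ i → f i ≤ g i) → ∀ k → f k < g k → sumFin f < sumFin g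
sumFin-mono-< e zero    l = ℕ.+-mono-<-≤ l (sumFin-mono (e ∘ suc))
sumFin-mono-< e (suc k) l = ℕ.+-mono-≤-< (e zero) (sumFin-mono-< (e ∘ suc) k l)

pairSum : ∀ {m} → (Fin m → Fin m → ℕ) → ℕ
pairSum f = sumFin (λ i → sumFin (f i))

pairSum-cong : ∀ {m} {f g : Fin m → Fin m → ℕ} → (∀ i j → f i j ≡ g i j) → pairSum f ≡ pairSum g
pairSum-cong e = sumFin-cong (λ i → sumFin-cong (e i))

pairSum-+ : ∀ {m} (f g : Fin m → Fin m → ℕ) → pairSum (λ i j → f i j + g i j) ≡ pairSum f + pairSum g
pairSum-+ f g = trans (sumFin-cong (λ i → sumFin-+ (f i) (g i))) (sumFin-+ (λ i → sumFin (f i)) (λ i → sumFin (g i)))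

pairSum-mono : ∀ {m} {f g : Fin m → Fin m → ℕ} → (∀ i j → f i j ≤ g i j) → pairSum f ≤ pairSum g
pairSum-mono e = sumFin-mono (λ i → sumFin-mono (e i))

pairSum-mono-< : ∀ {m} {f g : Fin m → Fin m → ℕ} → (∀ i j → f i j ≤ g i j) →
  ∀ i j → f i j < g i j → pairSum f < pairSum g
pairSum-mono-< e i j l = sumFin-mono-< (λ k → sumFin-mono (e k)) i (sumFin-mono-< (e i) j l)

pairSum-permute : ∀ {m} (f : Fin m → Fin m → ℕ) (π : Permutation′ m) →
  pairSum f ≡ pairSum (λ i j → f (π ⟨$⟩ʳ i) (π ⟨$⟩ʳ j))
pairSum-permute f π = trans (sumFin-permute (λ i → sumFin (f i)) π) (sumFin-cong (λ i → sumFin-permute (f (π ⟨$⟩ʳ i)) π))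

pairSum-comm : ∀ {m} (f : Fin m → Fin m → ℕ) → pairSum f ≡ pairSum (λ i j → f j i)
pairSum-comm {m} f = trans (toSum f) (trans (Sum.∑-comm f) (sym (toSum (λ i j → f j i))))
  where
  toSum : (g : Fin m → Fin m → ℕ) → pairSum g ≡ Sum.sum (λ i → Sum.sum (g i))
  toSum g = trans (sumFin-cong (λ i → sumFin≡sum (g i))) (sumFin≡sum (λ i → Sum.sum (g i)))

-- Permutations

Pm : ℕ → Set
Pm = Permutation′

infixl 9 _·_
_·_ : ∀ {m} → Pm m → Fin m → Fin m
u · x = u ⟨$⟩ʳ x

infix 4 _≗ₚ_
_≗ₚ_ : ∀ {m} → Pm m → Pm m → Set
u ≗ₚ w = ∀ i → u · i ≡ w · i

·-injective : ∀ {m} (u : Pm m) {x y} → u · x ≡ u · y → x ≡ y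
·-injective u {x} {y} e = trans (sym (Perm.inverseˡ u)) (trans (cong (flip u ·_) e) (Perm.inverseˡ u))

flip-unique : ∀ {m} (u : Pm m) {x y} → u · x ≡ y → flip u · y ≡ x
flip-unique u refl = Perm.inverseˡ u

flip-cong : ∀ {m} (u w : Pm m) → u ≗ₚ w → flip u ≗ₚ flip w
flip-cong u w e i = flip-unique u (trans (e _) (Perm.inverseʳ w))

transpose-l : ∀ {m} (x y : Fin m) → transpose x y · x ≡ y
transpose-l x y rewrite dec-true (x Fin.≟ x) refl = refl

transpose-off : ∀ {m} (x y z : Fin m) → z ≢ x → z ≢ y → transpose x y · z ≡ z
transpose-off x y z a b rewrite dec-false (z Fin.≟ x) a | dec-false (z Fin.≟ y) b = refl

injective⇒surjective : ∀ {m} (f : Fin m → Fin m) → Injective _≡_ _≡_ f → ∀ y → ∃ λ x → f x ≡ y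
injective⇒surjective {suc m} f inj y with Fin.any? (λ x → f x Fin.≟ y)
... | yes p = p
... | no ¬p = contradiction (Fin.injective⇒≤ g-inj) ℕ.1+n≰n
  where
  miss : ∀ x → y ≢ f x
  miss x e = ¬p (x , sym e)
  g : Fin (suc m) → Fin m
  g x = Fin.punchOut (miss x)
  g-inj : Injective _≡_ _≡_ g
  g-inj {a} {b} e = inj (Fin.punchOut-injective (miss a) (miss b) e)

toPerm : ∀ {m} (f : Fin m → Fin m) → IsPerm f → Pm m
toPerm f inj = permutation f (λ y → proj₁ (sur y)) (λ y → proj₂ (sur y)) (λ x → inj (proj₂ (sur (f x))))
  where sur = injective⇒surjective f inj

-- Regions and permutations supported on them

-- Bounds are natural numbers rather than labels, so that the part [s,d] of an interval can be
-- written even when `s` is `m`, the value attached to an empty list.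
Region : Set
Region = ℕ × ℕ

-- half-open: [a , b)
infix 4 _∈ʳ_ _∈?_
_∈ʳ_ : ∀ {m} → Fin m → Region → Set
x ∈ʳ (a , b) = a ≤ toℕ x × toℕ x < b

_∈?_ : ∀ {m} (x : Fin m) r → Dec (x ∈ʳ r)
x ∈? (a , b) = (a ℕ.≤? toℕ x) ×-dec (toℕ x ℕ.<? b)

∈-convex : ∀ {m} {x y z : Fin m} r → x ∈ʳ r → z ∈ʳ r → x Fin.≤ y → y Fin.≤ z → y ∈ʳ r
∈-convex r (a , _) (_ , b) p q = ℕ.≤-trans a p , ℕ.≤-<-trans q b

Supp : ∀ {m} → Region → Pm m → Set
Supp r v = ∀ x → ¬ x ∈ʳ r → v · x ≡ x

Supp-∘ : ∀ {m} {r} (v v' : Pm m) → Supp r v → Supp r v' → Supp r (v ∘ₚ v')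
Supp-∘ v v' s s' x n = trans (cong (v' ·_) (s x n)) (s' x n)

Supp-flip : ∀ {m} {r} (v : Pm m) → Supp r v → Supp r (flip v)
Supp-flip v s x n = flip-unique v (s x n)

Supp-∈ : ∀ {m} r (v : Pm m) → Supp r v → ∀ {x} → x ∈ʳ r → v · x ∈ʳ r
Supp-∈ r v s {x} p with (v · x) ∈? r
... | yes q = q
... | no ¬q = contradiction (subst (_∈ʳ r) (sym (·-injective v (s _ ¬q))) p) ¬q

Supp-⊆ : ∀ {m} {r r'} (v : Pm m) → (∀ {x : Fin m} → x ∈ʳ r → x ∈ʳ r') → Supp r v → Supp r' v
Supp-⊆ v sub s x n = s x (n ∘ sub)

-- A point outside `r` lies on the same side of all points of `r`, because `r` has no gaps. Moving
-- points within `r` thus cannot reorder a pair that is not wholly in `r`.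
Supp-< : ∀ {m} r (v : Pm m) → Supp r v → ∀ {i j} → ¬ (i ∈ʳ r × j ∈ʳ r) → i Fin.< j → v · i Fin.< v · j
Supp-< r v s {i} {j} n l with i ∈? r | j ∈? r
... | yes p | yes q = contradiction (p , q) n
... | no p  | no q  rewrite s i p | s j q = l
... | yes p | no q  rewrite s j q with ℕ.<-cmp (toℕ (v · i)) (toℕ j)
...   | tri< a _ _ = a
...   | tri≈ _ b _ = contradiction (subst (_∈ʳ r) (Fin.toℕ-injective b) (Supp-∈ r v s p)) q
...   | tri> _ _ c = contradiction (∈-convex r p (Supp-∈ r v s p) (ℕ.<⇒≤ l) (ℕ.<⇒≤ c)) q
Supp-< r v s {i} {j} n l | no p | yes q rewrite s i p with ℕ.<-cmp (toℕ i) (toℕ (v · j))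
...   | tri< a _ _ = a
...   | tri≈ _ b _ = contradiction (subst (_∈ʳ r) (sym (Fin.toℕ-injective b)) (Supp-∈ r v s q)) p
...   | tri> _ _ c = contradiction (∈-convex r (Supp-∈ r v s q) q (ℕ.<⇒≤ c) (ℕ.<⇒≤ l)) p

Supp-<⁻ : ∀ {m} r (v : Pm m) → Supp r v → ∀ {i j} → ¬ (i ∈ʳ r × j ∈ʳ r) → v · i Fin.< v · j → i Fin.< j
Supp-<⁻ r v s {i} {j} n l with ℕ.<-cmp (toℕ i) (toℕ j)
... | tri< a _ _ = a
... | tri≈ _ b _ = contradiction (cong toℕ (cong (v ·_) (Fin.toℕ-injective b))) (ℕ.<⇒≢ l)
... | tri> _ _ c = contradiction (Supp-< r v s (λ (p , q) → n (q , p)) c) (ℕ.<-asym l)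

-- Lengths

inv? : ∀ {m} (u : Pm m) (i j : Fin m) → Dec (i Fin.< j × u · j Fin.< u · i)
inv? u i j = (i Fin.<? j) ×-dec ((u · j) Fin.<? (u · i))

-- The Boolean of `×-dec` computes to a conjunction, so `length u` unfolds to `pairSum (inv u)`.
inv : ∀ {m} → Pm m → Fin m → Fin m → ℕ
inv u i j = indicator (does (inv? u i j))

length : ∀ {m} → Pm m → ℕ
length u = len (u ·_)

indicator-mono : ∀ {P Q : Set} (p : Dec P) (q : Dec Q) → (P → Q) → indicator (does p) ≤ indicator (does q)
indicator-mono (yes p) (yes q) f = ℕ.≤-refl
indicator-mono (yes p) (no q)  f = contradiction (f p) q
indicator-mono (no p)  q       f = z≤n

indicator-cong : ∀ {P Q : Set} (p : Dec P) (q : Dec Q) → (P → Q) → (Q → P) → indicator (does p) ≡ indicator (does q)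
indicator-cong p q f g = ℕ.≤-antisym (indicator-mono p q f) (indicator-mono q p g)

if-else-cong : ∀ {P Q : Set} (p : Dec P) (q : Dec Q) {a b : ℕ} → (P → Q) → (Q → P) → (¬ Q → a ≡ b) →
  (if does p then 0 else a) ≡ (if does q then 0 else b)
if-else-cong (yes p) (yes q) f g e = refl
if-else-cong (yes p) (no q)  f g e = contradiction (f p) q
if-else-cong (no p)  (yes q) f g e = contradiction (g q) p
if-else-cong (no p)  (no q)  f g e = e q

if-then-mono : ∀ {P : Set} (p : Dec P) {a b : ℕ} → (P → a ≤ b) → (if does p then a else 0) ≤ (if does p then b else 0)
if-then-mono (yes p) f = f p
if-then-mono (no p)  f = z≤n

if-then-yes : ∀ {P : Set} (p : Dec P) {a : ℕ} → P → (if does p then a else 0) ≡ a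
if-then-yes (yes _) _ = refl
if-then-yes (no ¬p) p = contradiction p ¬p

indicator-yes : ∀ {P : Set} (p : Dec P) → P → indicator (does p) ≡ 1
indicator-yes p x = cong indicator (dec-true p x)

indicator-no : ∀ {P : Set} (p : Dec P) → ¬ P → indicator (does p) ≡ 0
indicator-no p x = cong indicator (dec-false p x)

both? : ∀ {m} r (i j : Fin m) → Dec (i ∈ʳ r × j ∈ʳ r)
both? r i j = (i ∈? r) ×-dec (j ∈? r)

inside outside : ∀ {m} → Region → Pm m → ℕ
inside  r u = pairSum (λ i j → if does (both? r i j) then inv u i j else 0)
outside r u = pairSum (λ i j → if does (both? r i j) then 0 else inv u i j)

length-split : ∀ {m} r (u : Pm m) → length u ≡ inside r u + outside r u
length-split r u = trans (pairSum-cong split) (pairSum-+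
  (λ i j → if does (both? r i j) then inv u i j else 0) (λ i j → if does (both? r i j) then 0 else inv u i j))
  where
  split : ∀ i j → inv u i j ≡ (if does (both? r i j) then inv u i j else 0) + (if does (both? r i j) then 0 else inv u i j)
  split i j with does (both? r i j)
  ... | true  = sym (ℕ.+-identityʳ (inv u i j))
  ... | false = refl

length-cong : ∀ {m} (u w : Pm m) → u ≗ₚ w → length u ≡ length w
length-cong u w e = pairSum-cong (λ i j → indicator-cong (inv? u i j) (inv? w i j)
  (λ (a , b) → a , subst₂ Fin._<_ (e j) (e i) b) (λ (a , b) → a , subst₂ Fin._<_ (sym (e j)) (sym (e i)) b))

-- Replacing `i , j` by `v · i , v · j` permutes the pairs that are not both in `r` and, by
-- `Supp-<`, keeps their order, so the inversions counted are only reindexed.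
outside-supp : ∀ {m} r (u v : Pm m) → Supp r v → outside r (v ∘ₚ u) ≡ outside r u
outside-supp r u v s = sym (trans (pairSum-permute _ v) (pairSum-cong eq))
  where
  eq : ∀ i j → (if does (both? r (v · i) (v · j)) then 0 else inv u (v · i) (v · j))
             ≡ (if does (both? r i j) then 0 else inv (v ∘ₚ u) i j)
  eq i j = if-else-cong (both? r (v · i) (v · j)) (both? r i j)
    (λ (a , b) → back a , back b) (λ (a , b) → Supp-∈ r v s a , Supp-∈ r v s b)
    λ n → indicator-cong (inv? u (v · i) (v · j)) (inv? (v ∘ₚ u) i j)
      (λ (a , b) → Supp-<⁻ r v s n a , b) (λ (a , b) → Supp-< r v s n a , b)
    where
    back : ∀ {x} → v · x ∈ʳ r → x ∈ʳ r
    back p = subst (_∈ʳ r) (Perm.inverseˡ v) (Supp-∈ r (flip v) (Supp-flip v s) p)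

-- Both sides are moved so that no subtraction occurs.
length-rearrange : ∀ {m} r (u v : Pm m) → Supp r v → length (v ∘ₚ u) + inside r u ≡ length u + inside r (v ∘ₚ u)
length-rearrange r u v s = begin
  length (v ∘ₚ u) + inside r u                             ≡⟨ cong (_+ inside r u) (length-split r (v ∘ₚ u)) ⟩
  (inside r (v ∘ₚ u) + outside r (v ∘ₚ u)) + inside r u    ≡⟨ cong (λ o → (inside r (v ∘ₚ u) + o) + inside r u) (outside-supp r u v s) ⟩
  (inside r (v ∘ₚ u) + outside r u) + inside r u           ≡⟨ ℕ.+-assoc (inside r (v ∘ₚ u)) _ _ ⟩
  inside r (v ∘ₚ u) + (outside r u + inside r u)           ≡⟨ ℕ.+-comm (inside r (v ∘ₚ u)) _ ⟩
  (outside r u + inside r u) + inside r (v ∘ₚ u)           ≡⟨ cong (_+ inside r (v ∘ₚ u)) (trans (ℕ.+-comm (outside r u) _) (sym (length-split r u))) ⟩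
  length u + inside r (v ∘ₚ u)                             ∎
  where open ≡-Reasoning

DecOn : ∀ {m} → Region → Pm m → Set
DecOn r u = ∀ {i j} → i ∈ʳ r → j ∈ʳ r → i Fin.< j → u · j Fin.< u · i

DecOn-cong : ∀ {m} {r} (u w : Pm m) → u ≗ₚ w → DecOn r u → DecOn r w
DecOn-cong u w e d {i} {j} p q l = subst₂ Fin._<_ (e j) (e i) (d p q l)

DecOn-⁻ : ∀ {m} {r} (u : Pm m) → DecOn r u → ∀ {i j} → i ∈ʳ r → j ∈ʳ r → u · j Fin.< u · i → i Fin.< j
DecOn-⁻ u d {i} {j} p q l with ℕ.<-cmp (toℕ i) (toℕ j)
... | tri< a _ _ = a
... | tri≈ _ b _ = contradiction (cong (λ z → toℕ (u · z)) (sym (Fin.toℕ-injective b))) (ℕ.<⇒≢ l)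
... | tri> _ _ c = contradiction (d q p c) (ℕ.<-asym l)

inside-mono : ∀ {m} r (u w : Pm m) →
  (∀ {i j} → i ∈ʳ r → j ∈ʳ r → i Fin.< j → u · j Fin.< u · i → w · j Fin.< w · i) → inside r u ≤ inside r w
inside-mono r u w f = pairSum-mono λ i j → if-then-mono (both? r i j)
  λ (a , b) → indicator-mono (inv? u i j) (inv? w i j) (λ (l , q) → l , f a b l q)

inside-dec-≤ : ∀ {m} r (u w : Pm m) → DecOn r w → inside r u ≤ inside r w
inside-dec-≤ r u w d = inside-mono r u w (λ a b l _ → d a b l)

inside-dec-< : ∀ {m} r (u w : Pm m) → DecOn r w → ∀ {i j} → i ∈ʳ r → j ∈ʳ r → i Fin.< j →
  ¬ (u · j Fin.< u · i) → inside r u < inside r w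
inside-dec-< r u w d {i} {j} p q l n = pairSum-mono-<
  (λ i j → if-then-mono (both? r i j) λ (a , b) → indicator-mono (inv? u i j) (inv? w i j) (λ (l , _) → l , d a b l))
  i j (subst₂ _<_
    (sym (trans (if-then-yes (both? r i j) (p , q)) (indicator-no (inv? u i j) (n ∘ proj₂))))
    (sym (trans (if-then-yes (both? r i j) (p , q)) (indicator-yes (inv? w i j) (l , d p q l))))
    (s≤s z≤n))

DecOn? : ∀ {m} r (u : Pm m) →
  DecOn r u ⊎ (∃ λ i → ∃ λ j → i ∈ʳ r × j ∈ʳ r × i Fin.< j × ¬ (u · j Fin.< u · i))
DecOn? r u with Fin.any? (λ i → Fin.any? (λ j → (i ∈? r) ×-dec ((j ∈? r) ×-dec ((i Fin.<? j) ×-dec ¬? ((u · j) Fin.<? (u · i))))))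
... | yes p = inj₂ p
... | no ¬p = inj₁ λ {i} {j} a b l → [ (λ x → x) , (λ n → contradiction (i , j , a , b , l , n) ¬p) ]′ (dec⊎ ((u · j) Fin.<? (u · i)))
  where
  dec⊎ : ∀ {P : Set} → Dec P → P ⊎ ¬ P
  dec⊎ (yes x) = inj₁ x
  dec⊎ (no x)  = inj₂ x

length-flip : ∀ {m} (u : Pm m) → length (flip u) ≡ length u
length-flip u = begin
  pairSum (inv (flip u))                              ≡⟨ pairSum-permute (inv (flip u)) u ⟩
  pairSum (λ i j → inv (flip u) (u · i) (u · j))      ≡⟨ pairSum-comm (λ i j → inv (flip u) (u · i) (u · j)) ⟩
  pairSum (λ i j → inv (flip u) (u · j) (u · i))      ≡⟨ pairSum-cong eq ⟩
  pairSum (inv u)                                     ∎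
  where
  open ≡-Reasoning
  eq : ∀ i j → inv (flip u) (u · j) (u · i) ≡ inv u i j
  eq i j = indicator-cong (inv? (flip u) (u · j) (u · i)) (inv? u i j)
    (λ (a , b) → subst₂ Fin._<_ (Perm.inverseˡ u) (Perm.inverseˡ u) b , a)
    (λ (a , b) → b , subst₂ Fin._<_ (sym (Perm.inverseˡ u)) (sym (Perm.inverseˡ u)) a)

-- Sorting and fixing by rearrangement

increasing⇒≥ : ∀ {m} (f : Fin m → Fin m) → (∀ {i j} → i Fin.< j → f i Fin.< f j) → ∀ k i → toℕ i ≡ k → k ≤ toℕ (f i)
increasing⇒≥ f mono zero    i e = z≤n
increasing⇒≥ {m} f mono (suc k) i e = ℕ.≤-<-trans (increasing⇒≥ f mono k p (Fin.toℕ-fromℕ< _)) (mono (subst₂ _<_ (sym (Fin.toℕ-fromℕ< _)) (sym e) ℕ.≤-refl))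
  where
  p : Fin m
  p = fromℕ< {k} (ℕ.<-trans (subst (k <_) (sym e) ℕ.≤-refl) (Fin.toℕ<n i))

increasing⇒id : ∀ {m} (p : Pm m) → (∀ {i j} → i Fin.< j → p · i Fin.< p · j) → ∀ i → p · i ≡ i
increasing⇒id p mono i = Fin.toℕ-injective (ℕ.≤-antisym
  (subst (toℕ (p · i) ≤_) (cong toℕ (Perm.inverseˡ p)) (increasing⇒≥ (flip p ·_) mono⁻ _ (p · i) refl))
  (increasing⇒≥ (p ·_) mono _ i refl))
  where
  mono⁻ : ∀ {i j} → i Fin.< j → flip p · i Fin.< flip p · j
  mono⁻ {i} {j} l with ℕ.<-cmp (toℕ (flip p · i)) (toℕ (flip p · j))
  ... | tri< a _ _ = a
  ... | tri≈ _ b _ = contradiction (cong toℕ (·-injective (flip p) (Fin.toℕ-injective b))) (ℕ.<⇒≢ l)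
  ... | tri> _ _ c = contradiction (subst₂ Fin._<_ (Perm.inverseʳ p) (Perm.inverseʳ p) (mono c)) (ℕ.<-asym l)

-- Inside `r` two decreasing arrangements can differ only by an order-preserving `p`; on all other
-- pairs `Supp-<` applies. So `p` is increasing everywhere, hence the identity.
DecOn-unique : ∀ {m} r (u p : Pm m) → Supp r p → DecOn r u → DecOn r (p ∘ₚ u) → ∀ i → p · i ≡ i
DecOn-unique r u p s d d' = increasing⇒id p mono
  where
  mono : ∀ {i j} → i Fin.< j → p · i Fin.< p · j
  mono {i} {j} l with both? r i j
  ... | yes (a , b) = DecOn-⁻ u d (Supp-∈ r p s a) (Supp-∈ r p s b) (d' a b l)
  ... | no n = Supp-< r p s n l

argmax : ∀ {m} (u : Pm m) k a → a + suc k ≤ m →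
  ∃ λ x → x ∈ʳ (a , a + suc k) × (∀ y → y ∈ʳ (a , a + suc k) → u · y Fin.≤ u · x)
argmax {m} u zero a le = x , (ℕ.≤-reflexive (sym ex) , subst (_< a + 1) (sym ex) a<) , λ y (p , q) →
  ℕ.≤-reflexive (cong (λ z → toℕ (u · z)) (Fin.toℕ-injective (trans (ℕ.≤-antisym (ℕ.≤-pred (subst (toℕ y <_) (ℕ.+-comm a 1) q)) p) (sym ex))))
  where
  a< : a < a + 1
  a< = subst (a <_) (ℕ.+-comm 1 a) ℕ.≤-refl
  x : Fin m
  x = fromℕ< (ℕ.<-≤-trans a< le)
  ex : toℕ x ≡ a
  ex = Fin.toℕ-fromℕ< _
argmax {m} u (suc k) a le with argmax u k a (ℕ.≤-trans (ℕ.+-monoʳ-≤ a (ℕ.n≤1+n (suc k))) le)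
... | x , (p , q) , mx = pick (ℕ.≤-total (toℕ (u · x)) (toℕ (u · z)))
  where
  b = a + suc k
  b+1 : a + suc (suc k) ≡ suc b
  b+1 = ℕ.+-suc a (suc k)
  z : Fin m
  z = fromℕ< {b} (subst (_≤ m) b+1 le)
  ez : toℕ z ≡ b
  ez = Fin.toℕ-fromℕ< _
  old : ∀ y → y ∈ʳ (a , a + suc (suc k)) → y ≡ z ⊎ y ∈ʳ (a , b)
  old y (s , t) with ℕ.m≤n⇒m<n∨m≡n (ℕ.≤-pred (subst (toℕ y <_) b+1 t))
  ... | inj₁ l = inj₂ (s , l)
  ... | inj₂ e = inj₁ (Fin.toℕ-injective (trans e (sym ez)))
  pick : u · x Fin.≤ u · z ⊎ u · z Fin.≤ u · x →
    ∃ λ x → x ∈ʳ (a , a + suc (suc k)) × (∀ y → y ∈ʳ (a , a + suc (suc k)) → u · y Fin.≤ u · x)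
  pick (inj₁ l) = z , (subst (a ≤_) (sym ez) (ℕ.m≤m+n a (suc k)) , subst₂ _<_ (sym ez) (sym b+1) ℕ.≤-refl) , λ y t →
    [ (λ e → ℕ.≤-reflexive (cong (λ t → toℕ (u · t)) e)) , (λ o → ℕ.≤-trans (mx y o) l) ]′ (old y t)
  pick (inj₂ l) = x , (p , ℕ.<-trans q (subst (b <_) (sym b+1) ℕ.≤-refl)) , λ y t →
    [ (λ e → subst (λ t → u · t Fin.≤ u · x) (sym e) l) , mx y ]′ (old y t)

private
  -- Selection sort: the transposition `t` brings the largest value of the block to its first
  -- position, and the remaining positions are sorted recursively.
  sort′ : ∀ {m} (u : Pm m) k a → a + k ≤ m → ∃ λ v → Supp (a , a + k) v × DecOn (a , a + k) (v ∘ₚ u)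
  sort′ u zero a le = Perm.id , (λ x _ → refl) , λ (p , q) → contradiction (ℕ.<-≤-trans q (subst (_≤ _) (sym (ℕ.+-identityʳ a)) p)) (ℕ.n≮n _)
  sort′ {m} u (suc k) a le with argmax u k a le
  ... | x , x∈ , mx with sort′ (transpose z x ∘ₚ u) k (suc a) le'
    where
    a<m : a < m
    a<m = ℕ.<-≤-trans (subst (a <_) (sym (ℕ.+-suc a k)) (s≤s (ℕ.m≤m+n a k))) le
    z : Fin m
    z = fromℕ< a<m
    le' : suc a + k ≤ m
    le' = subst (_≤ m) (ℕ.+-suc a k) le
  ... | v , s , d = v ∘ₚ t , supp , dec
    where
    e+ : a + suc k ≡ suc a + k
    e+ = ℕ.+-suc a k
    a< : a < a + suc k
    a< = subst (a <_) (sym e+) (s≤s (ℕ.m≤m+n a k))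
    z : Fin m
    z = fromℕ< (ℕ.<-≤-trans a< le)
    ez : toℕ z ≡ a
    ez = Fin.toℕ-fromℕ< _
    z∈ : z ∈ʳ (a , a + suc k)
    z∈ = ℕ.≤-reflexive (sym ez) , subst (_< a + suc k) (sym ez) a<
    t = transpose z x
    r = (a , a + suc k)
    r' = (suc a , suc a + k)
    sub : ∀ {y : Fin m} → y ∈ʳ r' → y ∈ʳ r
    sub {y} (p , q) = ℕ.<⇒≤ p , subst (toℕ y <_) (sym e+) q
    s-t : Supp r t
    s-t y n = transpose-off z x y (λ e → n (subst (_∈ʳ r) (sym e) z∈)) (λ e → n (subst (_∈ʳ r) (sym e) x∈))
    supp : Supp r (v ∘ₚ t)
    supp = Supp-∘ v t (Supp-⊆ v sub s) s-t
    z∉ : ¬ z ∈ʳ r'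
    z∉ (p , _) = ℕ.n≮n a (subst (a <_) ez p)
    top : (v ∘ₚ t ∘ₚ u) · z ≡ u · x
    top = trans (cong (λ y → u · (t · y)) (s z z∉)) (cong (u ·_) (transpose-l z x))
    dec : DecOn r (v ∘ₚ (t ∘ₚ u))
    dec {i} {j} i∈ j∈ l with ℕ.m≤n⇒m<n∨m≡n (proj₁ i∈)
    ... | inj₁ a<i = d (a<i , subst (toℕ i <_) e+ (proj₂ i∈)) (ℕ.<-trans a<i l , subst (toℕ j <_) e+ (proj₂ j∈)) l
    ... | inj₂ a≡i = ℕ.≤∧≢⇒< (subst ((v ∘ₚ t ∘ₚ u) · j Fin.≤_) (sym top') (mx _ (Supp-∈ r (v ∘ₚ t) supp j∈)))
                       (λ e → ℕ.<⇒≢ l (cong toℕ (sym (·-injective (v ∘ₚ t ∘ₚ u) (Fin.toℕ-injective e)))))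
      where
      top' : (v ∘ₚ t ∘ₚ u) · i ≡ u · x
      top' = trans (cong ((v ∘ₚ t ∘ₚ u) ·_) (Fin.toℕ-injective (trans (sym a≡i) (sym ez)))) top

sort : ∀ {m} (u : Pm m) (r : Region) → proj₂ r ≤ m → ∃ λ v → Supp r v × DecOn r (v ∘ₚ u)
sort u (a , b) le with a ℕ.≤? b
... | yes a≤b with v , s , d ← sort′ u (b ℕ.∸ a) a (subst (_≤ _) (sym (ℕ.m+[n∸m]≡n a≤b)) le)
    rewrite ℕ.m+[n∸m]≡n a≤b = v , s , d
... | no a≰b = Perm.id , (λ x _ → refl) , λ (p , q) → contradiction (ℕ.<⇒≤ (ℕ.≤-<-trans p q)) a≰b

-- The points of `M` are made fixed one by one, in increasing order. Each is exchanged with the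
-- position currently holding its value; neither of the two is an earlier point of `M`, so what has
-- been achieved survives.
fix : ∀ {m} (u : Pm m) (r : Region) (M : Fin m → Set) → (∀ x → Dec (M x)) → (∀ x → M x → x ∈ʳ r) →
  (∀ x → M x → flip u · x ∈ʳ r) → ∃ λ v → Supp r v × (∀ x → M x → (v ∘ₚ u) · x ≡ x)
fix {m} u r M M? M⊆ pre with go m ℕ.≤-refl
  where
  go : ∀ k → k ≤ m → ∃ λ v → Supp r v × (∀ x → toℕ x < k → M x → (v ∘ₚ u) · x ≡ x)
  go zero le = Perm.id , (λ x _ → refl) , λ x ()
  go (suc k) le with go k (ℕ.<⇒≤ le)
  ... | v , s , f with M? (fromℕ< le)
  ...   | no ¬M = v , s , g
    where
    g : ∀ x → toℕ x < suc k → M x → (v ∘ₚ u) · x ≡ x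
    g x l Mx with ℕ.m≤n⇒m<n∨m≡n (ℕ.≤-pred l)
    ... | inj₁ l' = f x l' Mx
    ... | inj₂ e = contradiction (subst M (Fin.toℕ-injective (trans e (sym (Fin.toℕ-fromℕ< le)))) Mx) ¬M
  ...   | yes Mz = t ∘ₚ v , Supp-∘ t v s-t s , g
    where
    z = fromℕ< le
    ez : toℕ z ≡ k
    ez = Fin.toℕ-fromℕ< le
    y = flip (v ∘ₚ u) · z
    y∈ : y ∈ʳ r
    y∈ = Supp-∈ r (flip v) (Supp-flip v s) (pre z Mz)
    t = transpose z y
    s-t : Supp r t
    s-t x n = transpose-off z y x (λ e → n (subst (_∈ʳ r) (sym e) (M⊆ z Mz))) (λ e → n (subst (_∈ʳ r) (sym e) y∈))
    g : ∀ x → toℕ x < suc k → M x → (t ∘ₚ v ∘ₚ u) · x ≡ x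
    g x l Mx with ℕ.m≤n⇒m<n∨m≡n (ℕ.≤-pred l)
    ... | inj₂ e = subst (λ q → (t ∘ₚ v ∘ₚ u) · q ≡ q) (Fin.toℕ-injective (trans ez (sym e)))
                     (trans (cong ((v ∘ₚ u) ·_) (transpose-l z y)) (Perm.inverseʳ (v ∘ₚ u)))
    ... | inj₁ l' = trans (cong ((v ∘ₚ u) ·_) (transpose-off z y x x≢z x≢y)) (f x l' Mx)
      where
      x≢z : x ≢ z
      x≢z e = ℕ.<⇒≢ l' (trans (cong toℕ e) ez)
      x≢y : x ≢ y
      x≢y e = x≢z (trans (sym (f x l' Mx)) (trans (cong ((v ∘ₚ u) ·_) e) (Perm.inverseʳ (v ∘ₚ u))))
... | v , s , f = v , s , λ x → f x (Fin.toℕ<n x)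

-- Reachability and factorisation

rg : ∀ {m} → Interval m → Region
rg (c , d) = toℕ c , suc (toℕ d)

infix 4 _∈ᵢ_
_∈ᵢ_ : ∀ {m} → Fin m → Interval m → Set
x ∈ᵢ I = x ∈ʳ rg I

Hop : ∀ {m} → Interval m → Fin m → Fin m → Set
Hop I i j = i ≡ j ⊎ (i ∈ᵢ I × j ∈ᵢ I)

Hop-sym : ∀ {m} {I : Interval m} {i j} → Hop I i j → Hop I j i
Hop-sym (inj₁ e) = inj₁ (sym e)
Hop-sym (inj₂ (a , b)) = inj₂ (b , a)

Hop-supp : ∀ {m} (I : Interval m) (v : Pm m) → Supp (rg I) v → ∀ i → Hop I i (v · i)
Hop-supp I v s i with i ∈? rg I
... | yes p = inj₂ (p , Supp-∈ (rg I) v s p)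
... | no ¬p = inj₁ (sym (s i ¬p))

-- The shadow of paths: hops are made in the order of the list, from sources to sinks, and a star
-- lets any strand of its interval continue on any other.
Reach : ∀ {m} → List (Interval m) → Fin m → Fin m → Set
Reach [] i j = i ≡ j
Reach (I ∷ L) i j = ∃ λ k → Hop I i k × Reach L k j

Reach-refl : ∀ {m} (L : List (Interval m)) i → Reach L i i
Reach-refl [] i = refl
Reach-refl (I ∷ L) i = i , inj₁ refl , Reach-refl L i

Reach-∷ʳ : ∀ {m} (L : List (Interval m)) {I i k j} → Reach L i k → Hop I k j → Reach (L ∷ʳ I) i j
Reach-∷ʳ [] refl h = _ , h , refl
Reach-∷ʳ (K ∷ L) (l , h' , r) h = l , h' , Reach-∷ʳ L r h

Reach-reverse : ∀ {m} (L : List (Interval m)) {i j} → Reach L i j → Reach (reverse L) j i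
Reach-reverse [] r = sym r
Reach-reverse (I ∷ L) (k , h , r) = subst (λ X → Reach X _ _) (sym (List.unfold-reverse I L))
  (Reach-∷ʳ (reverse L) (Reach-reverse L r) (Hop-sym {I = I} h))

Avoiding : ∀ {m} → Fin m → List (Interval m) → Set
Avoiding x L = All (λ K → ¬ x ∈ᵢ K) L

isolatedˡ : ∀ {m} {L : List (Interval m)} {x y} → Avoiding x L → Reach L x y → x ≡ y
isolatedˡ [] r = r
isolatedˡ (n ∷ a) (k , inj₁ refl , r) = isolatedˡ a r
isolatedˡ (n ∷ a) (k , inj₂ (p , _) , r) = contradiction p n

isolatedʳ : ∀ {m} {L : List (Interval m)} {x y} → Avoiding x L → Reach L y x → y ≡ x
isolatedʳ [] r = r
isolatedʳ (n ∷ a) (k , inj₁ refl , r) = isolatedʳ a r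
isolatedʳ (n ∷ a) (k , inj₂ (_ , q) , r) with refl ← isolatedʳ a r = contradiction q n

-- An interval contains everything between two of its points, so a strand that no interval contains
-- is a wall which no hop crosses.
stay-above : ∀ {m} {L : List (Interval m)} {x y z} → Avoiding x L → Reach L y z → x Fin.< y → x Fin.< z
stay-above [] refl l = l
stay-above (n ∷ a) (k , inj₁ refl , r) l = stay-above a r l
stay-above {L = I ∷ _} {x = x} (n ∷ a) (k , inj₂ (p , q) , r) l with ℕ.<-cmp (toℕ x) (toℕ k)
... | tri< x<k _ _ = stay-above a r x<k
... | tri≈ _ e _ = contradiction (subst (_∈ᵢ I) (sym (Fin.toℕ-injective e)) q) n
... | tri> _ _ k<x = contradiction (∈-convex (rg I) q p (ℕ.<⇒≤ k<x) (ℕ.<⇒≤ l)) n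

stay-below : ∀ {m} {L : List (Interval m)} {x y z} → Avoiding x L → Reach L y z → y Fin.< x → z Fin.< x
stay-below [] refl l = l
stay-below (n ∷ a) (k , inj₁ refl , r) l = stay-below a r l
stay-below {L = I ∷ _} {x = x} (n ∷ a) (k , inj₂ (p , q) , r) l with ℕ.<-cmp (toℕ x) (toℕ k)
... | tri> _ _ k<x = stay-below a r k<x
... | tri≈ _ e _ = contradiction (subst (_∈ᵢ I) (sym (Fin.toℕ-injective e)) q) n
... | tri< x<k _ _ = contradiction (∈-convex (rg I) p q (ℕ.<⇒≤ l) (ℕ.<⇒≤ x<k)) n

Fact : ∀ {m} → List (Interval m) → Pm m → Set
Fact [] u = u ≗ₚ Perm.id
Fact (I ∷ L) u = ∃ λ u' → ∃ λ v → Fact L u' × Supp (rg I) v × u ≗ₚ v ∘ₚ u'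

Fact-cong : ∀ {m} (L : List (Interval m)) (u w : Pm m) → u ≗ₚ w → Fact L u → Fact L w
Fact-cong [] u w e f i = trans (sym (e i)) (f i)
Fact-cong (I ∷ L) u w e (u' , v , f , s , g) = u' , v , f , s , λ i → trans (sym (e i)) (g i)

Fact-∷ʳ : ∀ {m} (L : List (Interval m)) I (u v : Pm m) → Fact L u → Supp (rg I) v → Fact (L ∷ʳ I) (u ∘ₚ v)
Fact-∷ʳ [] I u v f s = Perm.id , v , (λ _ → refl) , s , λ i → cong (v ·_) (f i)
Fact-∷ʳ (K ∷ L) I u v (u' , v' , f , s' , e) s = u' ∘ₚ v , v' , Fact-∷ʳ L I u' v f s , s' , λ i → cong (v ·_) (e i)

Fact-reverse : ∀ {m} (L : List (Interval m)) (u : Pm m) → Fact L u → Fact (reverse L) (flip u)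
Fact-reverse [] u f i = flip-unique u (f i)
Fact-reverse (I ∷ L) u (u' , v , f , s , e) = subst (λ X → Fact X (flip u)) (sym (List.unfold-reverse I L))
  (Fact-cong (reverse L ∷ʳ I) (flip u' ∘ₚ flip v) (flip u) (λ i → sym (flip-cong u (v ∘ₚ u') e i))
    (Fact-∷ʳ (reverse L) I (flip u') (flip v) (Fact-reverse L u' f) (Supp-flip v s)))

InReach : ∀ {m} → List (Interval m) → Pm m → Set
InReach L u = ∀ i → Reach L i (u · i)

Fact⇒InReach : ∀ {m} (L : List (Interval m)) (u : Pm m) → Fact L u → InReach L u
Fact⇒InReach [] u f i = sym (f i)
Fact⇒InReach (I ∷ L) u (u' , v , f , s , e) i = v · i , Hop-supp I v s i ,
  subst (Reach L (v · i)) (sym (e i)) (Fact⇒InReach L u' f (v · i))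

-- Maximal permutations

-- The two halves use different classes on purpose: `Fact` is at least as strong as being a covering
-- type, `InReach` at most as strong. Such a `w` is therefore the longest covering type, as
-- `IsMax⇒IsWOf` records.
IsMax : ∀ {m} → List (Interval m) → Pm m → Set
IsMax L w = Fact L w × (∀ u → InReach L u → u ≗ₚ w ⊎ length u < length w)

IsMax-cong : ∀ {m} {L : List (Interval m)} (u w : Pm m) → u ≗ₚ w → IsMax L u → IsMax L w
IsMax-cong {L = L} u w e (f , mx) = Fact-cong L u w e f , λ x r →
  [ (λ q → inj₁ (λ i → trans (q i) (e i))) , (λ l → inj₂ (subst (length x <_) (length-cong u w e) l)) ]′ (mx x r)

IsMax-unique : ∀ {m} {L : List (Interval m)} (u w : Pm m) → IsMax L u → IsMax L w → u ≗ₚ w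
IsMax-unique {L = L} u w (f , mx) (f' , mx') with mx w (Fact⇒InReach L w f') | mx' u (Fact⇒InReach L u f)
... | inj₁ e | _ = λ i → sym (e i)
... | inj₂ _ | inj₁ e = e
... | inj₂ l | inj₂ l' = contradiction l (ℕ.<-asym l')

IsMax-reverse : ∀ {m} (L : List (Interval m)) (w : Pm m) → IsMax L w → IsMax (reverse L) (flip w)
IsMax-reverse L w (f , mx) = Fact-reverse L w f , λ u r →
  [ (λ e → inj₁ (λ i → sym (flip-unique w (trans (sym (e (u · i))) (Perm.inverseˡ u)))))
  , (λ l → inj₂ (subst₂ _<_ (length-flip u) (sym (length-flip w)) l)) ]′ (mx (flip u) (back u r))
  where
  back : ∀ u → InReach (reverse L) u → InReach L (flip u)
  back u r j = subst₂ (λ X y → Reach X y (flip u · j)) (List.reverse-involutive L) (Perm.inverseʳ u)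
    (Reach-reverse (reverse L) (r (flip u · j)))

-- Strands of `J` are interchangeable at the sources: permuting the values on `J` keeps a
-- permutation in reach.
Twins : ∀ {m} → Region → List (Interval m) → Set
Twins J L = ∀ {x y z} → x ∈ʳ J → y ∈ʳ J → Reach L x z → Reach L y z

InReach-twins : ∀ {m} {J} {L : List (Interval m)} (u v : Pm m) → Twins J L → Supp J v → InReach L u → InReach L (v ∘ₚ u)
InReach-twins {J = J} u v tw s r x with x ∈? J
... | yes p = tw (Supp-∈ J v s p) p (r (v · x))
... | no ¬p = subst (λ y → Reach _ y (u · (v · x))) (s x ¬p) (r (v · x))

-- Sorting `w` on `J` stays in reach and does not lower the length, since the contribution of pairs
-- not both in `J` is unchanged. By maximality the sorted permutation is `w` itself.
IsMax-twins : ∀ {m} {J} {L : List (Interval m)} (w : Pm m) → Twins J L → proj₂ J ≤ m → IsMax L w → DecOn J w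
IsMax-twins {J = J} {L} w tw b (f , mx) with sort w J b
... | v , s , d with mx (v ∘ₚ w) (InReach-twins w v tw s (Fact⇒InReach L w f))
...   | inj₁ e = DecOn-cong (v ∘ₚ w) w e d
...   | inj₂ l = contradiction l (ℕ.≤⇒≯ (ℕ.+-cancelʳ-≤ (inside J w) _ _
          (subst (length w + inside J w ≤_) (sym (length-rearrange J w v s)) (ℕ.+-monoʳ-≤ (length w) (inside-dec-≤ J w (v ∘ₚ w) d)))))

-- The situation in which a star on `I` may be put in front of `L`: the strands of `I` split into
-- those that `L` does not touch at all and those in `J`, which `L` cannot tell apart.
record FrontOK {m} (I : Interval m) (J : Region) (L : List (Interval m)) : Set where
  field
    J⊆I   : ∀ {x : Fin m} → x ∈ʳ J → x ∈ᵢ I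
    bound : proj₂ J ≤ m
    avoid : ∀ {x} → x ∈ᵢ I → ¬ x ∈ʳ J → Avoiding x L
    twins : Twins J L

module _ {m : ℕ} {I : Interval m} {J : Region} {L : List (Interval m)} (ok : FrontOK I J L) where
  open FrontOK ok

  private
    -- A strand `x` of `I` untouched by `L` is reached only through `I`, so its value is taken
    -- inside `I` and `x` can be made a fixed point. The other strands of `I` form `J`, where twins
    -- make the order immaterial, so they may be sorted.
    settle : ∀ u → InReach (I ∷ L) u → ∃ λ v → Supp (rg I) v × InReach L (v ∘ₚ u) × DecOn J (v ∘ₚ u)
    settle u r = v₂ ∘ₚ v₁ , Supp-∘ v₂ v₁ (Supp-⊆ v₂ J⊆I s₂) s₁ , InReach-twins (v₁ ∘ₚ u) v₂ twins s₂ r₁ , d₂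
      where
      M : Fin m → Set
      M x = x ∈ᵢ I × ¬ x ∈ʳ J
      pre : ∀ x → M x → flip u · x ∈ᵢ I
      pre x (p , n) with (flip u · x) ∈? rg I
      ... | yes q = q
      ... | no ¬q with r (flip u · x)
      ...   | k , inj₂ (q , _) , _ = contradiction q ¬q
      ...   | k , inj₁ refl , t = contradiction (subst (_∈ᵢ I) (sym (isolatedʳ (avoid p n) (subst (Reach L k) (Perm.inverseʳ u) t))) p) ¬q
      fx = fix u (rg I) M (λ x → (x ∈? rg I) ×-dec ¬? (x ∈? J)) (λ x → proj₁) pre
      v₁ = proj₁ fx
      s₁ = proj₁ (proj₂ fx)
      f₁ = proj₂ (proj₂ fx)
      r₁ : InReach L (v₁ ∘ₚ u)
      r₁ x with x ∈? rg I | x ∈? J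
      ... | no n  | _ rewrite s₁ x n with r x
      ...   | k , inj₁ refl , t = t
      ...   | k , inj₂ (q , _) , _ = contradiction q n
      r₁ x | yes p | no n rewrite f₁ x (p , n) = Reach-refl L x
      -- All that is known is some `k` in `I` leading to the value at `x`. If `k` is in `J`, it is a
      -- twin of `x`; if not, `k` is isolated and already fixed, which would make it equal to `x`.
      r₁ x | yes p | yes q = fromI hop
        where
        hop : ∃ λ k → k ∈ᵢ I × Reach L k ((v₁ ∘ₚ u) · x)
        hop with r (v₁ · x)
        ... | k , inj₁ refl , t = k , Supp-∈ (rg I) v₁ s₁ p , t
        ... | k , inj₂ (_ , b) , t = k , b , t
        fromI : (∃ λ k → k ∈ᵢ I × Reach L k ((v₁ ∘ₚ u) · x)) → Reach L x ((v₁ ∘ₚ u) · x)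
        fromI (k , k∈ , t) with k ∈? J
        ... | yes kJ = twins kJ q t
        ... | no k∉ = contradiction (subst (_∈ʳ J) (·-injective (v₁ ∘ₚ u) (trans (sym (isolatedˡ (avoid k∈ k∉) t)) (sym (f₁ k (k∈ , k∉))))) q) k∉
      so = sort (v₁ ∘ₚ u) J bound
      v₂ = proj₁ so
      s₂ = proj₁ (proj₂ so)
      d₂ = proj₂ (proj₂ so)

    -- A pair in `I` with a member outside `J` contains an isolated strand, which is fixed and never
    -- crossed, so no permutation in reach of `L` inverts it. Only pairs in `J` count, and `w`
    -- inverts all of those.
    inside-≤ : ∀ u w → InReach L u → InReach L w → DecOn J w → inside (rg I) u ≤ inside (rg I) w
    inside-≤ u w ru rw dw = inside-mono (rg I) u w f
      where
      f : ∀ {i j} → i ∈ᵢ I → j ∈ᵢ I → i Fin.< j → u · j Fin.< u · i → w · j Fin.< w · i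
      f {i} {j} p q l h with i ∈? J | j ∈? J
      ... | yes a | yes b = dw a b l
      ... | no a  | _ rewrite sym (isolatedˡ (avoid p a) (ru i)) = contradiction (stay-above (avoid p a) (ru j) l) (ℕ.<-asym h)
      ... | yes a | no b rewrite sym (isolatedˡ (avoid q b) (ru j)) = contradiction (stay-below (avoid q b) (ru i) l) (ℕ.<-asym h)

  -- Rearranging u on I until it respects L changes only pairs inside I, and
  -- all pairs inside I are inverted by w' ∘ v.
  IsMax-step : ∀ w' v → IsMax L w' → Supp (rg I) v → DecOn (rg I) (v ∘ₚ w') → IsMax (I ∷ L) (v ∘ₚ w')
  IsMax-step w' v mx'@(f' , mx) s d = (w' , v , f' , s , λ _ → refl) , go
    where
    w = v ∘ₚ w'
    r = rg I
    go : ∀ u → InReach (I ∷ L) u → u ≗ₚ w ⊎ length u < length w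
    go u ru with settle u ru
    ... | z , sz , ru' , du' = cmp (mx u' ru')
      where
      u' = z ∘ₚ u
      rw' = Fact⇒InReach L w' f'
      -- Both are in reach of `L` and decreasing on `J`, so the comparison works in both directions.
      same : inside r u' ≡ inside r w'
      same = ℕ.≤-antisym (inside-≤ u' w' ru' rw' (IsMax-twins w' twins bound mx')) (inside-≤ w' u' rw' ru' du')
      eu : length u' + inside r u ≡ length u + inside r w'
      eu = trans (length-rearrange r u z sz) (cong (length u +_) same)
      ew : length w + inside r w' ≡ length w' + inside r w
      ew = length-rearrange r w' v s
      fin : length u' + inside r u < length w' + inside r w → length u < length w
      fin l = ℕ.+-cancelʳ-< (inside r w') _ _ (subst₂ _<_ eu (sym ew) l)
      cmp : u' ≗ₚ w' ⊎ length u' < length w' → u ≗ₚ w ⊎ length u < length w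
      cmp (inj₂ l) = inj₂ (fin (ℕ.+-mono-<-≤ l (inside-dec-≤ r u w d)))
      -- Now `u` and `w` are rearrangements on `I` of the same permutation. Either `u` misses an
      -- inversion there and is shorter, or it is decreasing too and uniqueness identifies it with
      -- `w`.
      cmp (inj₁ e) with DecOn? r u
      ... | inj₂ (i , j , a , b , l , n) = inj₂ (fin (ℕ.+-mono-≤-< (ℕ.≤-reflexive (length-cong u' w' e)) (inside-dec-< r u w d a b l n)))
      ... | inj₁ du = inj₁ λ i → trans (u≗ i) (cong (w ·_) (DecOn-unique r w p sp d (DecOn-cong u (p ∘ₚ w) u≗ du) i))
        where
        p = flip z ∘ₚ flip v
        sp : Supp r p
        sp = Supp-∘ (flip z) (flip v) (Supp-flip z sz) (Supp-flip v s)
        u≗ : u ≗ₚ p ∘ₚ w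
        u≗ i = trans (cong (u ·_) (sym (Perm.inverseʳ z))) (trans (e (flip z · i)) (cong (w' ·_) (sym (Perm.inverseʳ v))))

  IsMax-extend : ∀ w' → IsMax L w' → ∃ λ v → Supp (rg I) v × DecOn (rg I) (v ∘ₚ w') × IsMax (I ∷ L) (v ∘ₚ w')
  IsMax-extend w' mx with sort w' (rg I) (Fin.toℕ<n (proj₂ I))
  ... | v , s , d = v , s , d , IsMax-step w' v mx s d

IsMax-[] : ∀ {m} → IsMax {m} [] Perm.id
IsMax-[] = (λ _ → refl) , λ u r → inj₁ (λ i → sym (r i))

-- Sums over labels

sumFin-zero : ∀ {m} {f : Fin m → ℕ} → (∀ i → f i ≡ 0) → sumFin f ≡ 0
sumFin-zero {zero}  e = refl
sumFin-zero {suc m} e = cong₂ _+_ (e zero) (sumFin-zero (e ∘ suc))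

sumFin-δ : ∀ {m} (i : Fin m) (f : Fin m → ℕ) → (∀ x → x ≢ i → f x ≡ 0) → sumFin f ≡ f i
sumFin-δ zero    f z = trans (cong (f zero +_) (sumFin-zero (λ x → z (suc x) λ ()))) (ℕ.+-identityʳ _)
sumFin-δ (suc i) f z = trans (cong (_+ sumFin (f ∘ suc)) (z zero λ ())) (sumFin-δ i (f ∘ suc) (λ x n → z (suc x) (n ∘ Fin.suc-injective)))

sumFin-pos : ∀ {m} (f : Fin m → ℕ) i → 0 < f i → 0 < sumFin f
sumFin-pos f zero    p = ℕ.<-≤-trans p (ℕ.m≤m+n _ _)
sumFin-pos f (suc i) p = ℕ.<-≤-trans (sumFin-pos (f ∘ suc) i p) (ℕ.m≤n+m _ _)

sumFin-pos⁻ : ∀ {m} (f : Fin m → ℕ) → 0 < sumFin f → ∃ λ i → 0 < f i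
sumFin-pos⁻ {suc m} f p with f zero in eq
... | suc _ = zero , subst (0 <_) (sym eq) (s≤s z≤n)
... | zero with i , q ← sumFin-pos⁻ (f ∘ suc) p = suc i , q

-- Isomorphisms

mapV-id : ∀ {m k} (x : V m k) → mapV (λ i → i) x ≡ x
mapV-id (src i) = refl
mapV-id (snk i) = refl
mapV-id (int i) = refl

≅-refl : ∀ {m} (N : Network m) → N ≅ N
≅-refl N = Perm.id , λ x y → cong₂ (mult N) (mapV-id x) (mapV-id y)

mapV-inverse : ∀ {m k l} (σ : Perm.Permutation k l) (x : V m l) → mapV (Inverse.to σ) (mapV (Inverse.from σ) x) ≡ x
mapV-inverse σ (src i) = refl
mapV-inverse σ (snk i) = refl
mapV-inverse σ (int i) = cong int (Perm.inverseʳ σ)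

mapV-∘ : ∀ {m k l n} (f : Fin k → Fin l) (g : Fin l → Fin n) (x : V m k) → mapV (g ∘ f) x ≡ mapV g (mapV f x)
mapV-∘ f g (src i) = refl
mapV-∘ f g (snk i) = refl
mapV-∘ f g (int i) = refl

≅-sym : ∀ {m} (N M : Network m) → N ≅ M → M ≅ N
≅-sym N M (σ , e) = flip σ , λ x y →
  trans (sym (e (mapV (Inverse.from σ) x) (mapV (Inverse.from σ) y))) (cong₂ (mult M) (mapV-inverse σ x) (mapV-inverse σ y))

≅-trans : ∀ {m} (N M P : Network m) → N ≅ M → M ≅ P → N ≅ P
≅-trans N M P (σ , e) (τ , f) = σ ∘ₚ τ , λ x y →
  trans (cong₂ (mult P) (mapV-∘ (Inverse.to σ) (Inverse.to τ) x) (mapV-∘ (Inverse.to σ) (Inverse.to τ) y)) (trans (f _ _) (e x y))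

≅-pointwise : ∀ {m k} (f g : V m k → V m k → ℕ) → (∀ x y → g x y ≡ f x y) → net k f ≅ net k g
≅-pointwise f g e = Perm.id , λ x y → trans (cong₂ g (mapV-id x) (mapV-id y)) (e x y)

-- Composition with a star on the left, in closed form

-- Vertex `int zero` is the centre of the new star. It takes over the edges that leave the sources
-- of `I` in `N`, parallel ones adding their multiplicities.
stepMult : ∀ {m} (I : Interval m) (N : Network m) → V m (suc (size N)) → V m (suc (size N)) → ℕ
stepMult (c , d) N _             (src _)       = 0
stepMult (c , d) N (src i)       (int zero)    = indicator (inI c d i)
stepMult (c , d) N (int _)       (int zero)    = 0
stepMult (c , d) N (snk _)       (int zero)    = 0
stepMult (c , d) N (src i)       (int (suc y)) = if inI c d i then 0 else mult N (src i) (int y)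
stepMult (c , d) N (src i)       (snk y)       = if inI c d i then 0 else mult N (src i) (snk y)
stepMult (c , d) N (int zero)    (int (suc y)) = sumFin (λ x → indicator (inI c d x) * mult N (src x) (int y))
stepMult (c , d) N (int zero)    (snk y)       = sumFin (λ x → indicator (inI c d x) * mult N (src x) (snk y))
stepMult (c , d) N (int (suc x)) (int (suc y)) = mult N (int x) (int y)
stepMult (c , d) N (int (suc x)) (snk y)       = mult N (int x) (snk y)
stepMult (c , d) N (snk x)       (int (suc y)) = mult N (snk x) (int y)
stepMult (c , d) N (snk x)       (snk y)       = mult N (snk x) (snk y)

stepNet : ∀ {m} → Interval m → Network m → Network m
stepNet I N = net (suc (size N)) (stepMult I N)

netOf : ∀ {m} → List (Interval m) → Network m
netOf []      = trivial
netOf (I ∷ L) = stepNet I (netOf L)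

NoIn : ∀ {m} → Network m → Set
NoIn N = ∀ x i → mult N x (src i) ≡ 0

NoIn-netOf : ∀ {m} (L : List (Interval m)) → NoIn (netOf L)
NoIn-netOf []      (src _) i = refl
NoIn-netOf []      (snk _) i = refl
NoIn-netOf (I ∷ L) x i = refl

NoIn-trivial : ∀ {m} → NoIn (trivial {m})
NoIn-trivial (src _) i = refl
NoIn-trivial (snk _) i = refl

NoIn-star : ∀ {m} (c d : Fin m) → NoIn (star c d)
NoIn-star c d with c Fin.≟ d
... | yes _ = NoIn-trivial
... | no _ = λ { (src _) i → refl ; (snk _) i → refl ; (int _) i → refl }

NoIn-• : ∀ {m} (E F : Network m) → NoIn E → NoIn (E • F)
NoIn-• E F n (src i) j = n (src i) j
NoIn-• E F n (snk i) j = refl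
NoIn-• E F n (int k) j with Fin.splitAt (size E) k
... | inj₁ a = n (int a) j
... | inj₂ b = refl

if-cong : ∀ {A : Set} (b : Bool) {x y x' y' : A} → x ≡ x' → y ≡ y' → (if b then x else y) ≡ (if b then x' else y')
if-cong true  e f = e
if-cong false e f = f

step-cong : ∀ {m} (I : Interval m) (N M : Network m) → N ≅ M → stepNet I N ≅ stepNet I M
step-cong (c , d) N M (σ , e) = Perm.lift₀ σ , eq
  where
  eq : ∀ x y → stepMult (c , d) M (mapV (Inverse.to (Perm.lift₀ σ)) x) (mapV (Inverse.to (Perm.lift₀ σ)) y) ≡ stepMult (c , d) N x y
  eq x (src _) = refl
  eq (src i) (int zero) = refl
  eq (int zero) (int zero) = refl
  eq (int (suc _)) (int zero) = refl
  eq (snk _) (int zero) = refl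
  eq (src i) (int (suc y)) = if-cong (inI c d i) refl (e (src i) (int y))
  eq (src i) (snk y) = if-cong (inI c d i) refl (e (src i) (snk y))
  eq (int zero) (int (suc y)) = sumFin-cong (λ x → cong (indicator (inI c d x) *_) (e (src x) (int y)))
  eq (int zero) (snk y) = sumFin-cong (λ x → cong (indicator (inI c d x) *_) (e (src x) (snk y)))
  eq (int (suc x)) (int (suc y)) = e (int x) (int y)
  eq (int (suc x)) (snk y) = e (int x) (snk y)
  eq (snk x) (int (suc y)) = e (snk x) (int y)
  eq (snk x) (snk y) = e (snk x) (snk y)

inI-view : ∀ {m} (I : Interval m) (x : Fin m) →
  (x ∈ᵢ I × inI (proj₁ I) (proj₂ I) x ≡ true) ⊎ (¬ x ∈ᵢ I × inI (proj₁ I) (proj₂ I) x ≡ false)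
inI-view (c , d) x = go ((c Fin.≤? x) ×-dec (x Fin.≤? d)) refl
  where
  go : (q : Dec (c Fin.≤ x × x Fin.≤ d)) → does q ≡ inI c d x →
    (x ∈ᵢ (c , d) × inI c d x ≡ true) ⊎ (¬ x ∈ᵢ (c , d) × inI c d x ≡ false)
  go (yes (a , b)) e = inj₁ ((a , s≤s b) , sym e)
  go (no n) e = inj₂ ((λ { (a , s≤s b) → n (a , b) }) , sym e)

Disjoint : ∀ {m} → Interval m → Interval m → Set
Disjoint I K = ∀ {x} → x ∈ᵢ I → x ∈ᵢ K → ⊥

-- The isomorphism exchanges the two new centres. Disjointness makes the multiplicity between them
-- vanish in both orders, and lets the strands of one interval pass the other star unchanged.
step-swap : ∀ {m} (I K : Interval m) (N : Network m) → Disjoint I K → stepNet I (stepNet K N) ≅ stepNet K (stepNet I N)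
step-swap {m} I@(c , d) K@(c' , d') N dis = permutation sw sw sw-sw sw-sw , eq
  where
  k = size N
  sw : Fin (suc (suc k)) → Fin (suc (suc k))
  sw zero = suc zero
  sw (suc zero) = zero
  sw (suc (suc j)) = suc (suc j)
  sw-sw : ∀ j → sw (sw j) ≡ j
  sw-sw zero = refl
  sw-sw (suc zero) = refl
  sw-sw (suc (suc j)) = refl
  ifs : ∀ (a b : Bool) (n : ℕ) → (if a then 0 else (if b then 0 else n)) ≡ (if b then 0 else (if a then 0 else n))
  ifs true true n = refl
  ifs true false n = refl
  ifs false true n = refl
  ifs false false n = refl
  bypass : ∀ (A B : Interval m) → Disjoint A B → ∀ x n →
    indicator (inI (proj₁ A) (proj₂ A) x) * n ≡ indicator (inI (proj₁ A) (proj₂ A) x) * (if inI (proj₁ B) (proj₂ B) x then 0 else n)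
  bypass A B D x n with inI-view A x | inI-view B x
  ... | inj₂ (_ , e) | _ rewrite e = refl
  ... | inj₁ (p , _) | inj₁ (q , _) = contradiction q (D p)
  ... | inj₁ (_ , e) | inj₂ (_ , f) rewrite e | f = refl
  none : ∀ (A B : Interval m) → Disjoint A B → ∀ x → indicator (inI (proj₁ A) (proj₂ A) x) * indicator (inI (proj₁ B) (proj₂ B) x) ≡ 0
  none A B D x with inI-view A x | inI-view B x
  ... | inj₂ (_ , e) | _ rewrite e = refl
  ... | inj₁ (p , _) | inj₁ (q , _) = contradiction q (D p)
  ... | inj₁ (_ , e) | inj₂ (_ , f) rewrite e | f = refl
  direct : ∀ (A B : Interval m) → Disjoint A B → ∀ x →
    (if inI (proj₁ A) (proj₂ A) x then 0 else indicator (inI (proj₁ B) (proj₂ B) x)) ≡ indicator (inI (proj₁ B) (proj₂ B) x)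
  direct A B D x with inI-view A x | inI-view B x
  ... | inj₂ (_ , e) | _ rewrite e = refl
  ... | inj₁ (p , _) | inj₁ (q , _) = contradiction q (D p)
  ... | inj₁ (_ , e) | inj₂ (_ , f) rewrite e | f = refl
  dis' : Disjoint K I
  dis' p q = dis q p
  eq : ∀ x y → stepMult K (stepNet I N) (mapV sw x) (mapV sw y) ≡ stepMult I (stepNet K N) x y
  eq x (src _) = refl
  eq (src i) (int zero) = direct K I dis' i
  eq (src i) (int (suc zero)) = sym (direct I K dis i)
  eq (src i) (int (suc (suc j))) = ifs (inI c' d' i) (inI c d i) _
  eq (src i) (snk j) = ifs (inI c' d' i) (inI c d i) _
  eq (snk i) (int zero) = refl
  eq (snk i) (int (suc zero)) = refl
  eq (snk i) (int (suc (suc j))) = refl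
  eq (snk i) (snk j) = refl
  eq (int zero) (int zero) = refl
  eq (int zero) (int (suc zero)) = sym (sumFin-zero (none I K dis))
  eq (int zero) (int (suc (suc j))) = sumFin-cong (λ x → bypass I K dis x (mult N (src x) (int j)))
  eq (int zero) (snk j) = sumFin-cong (λ x → bypass I K dis x (mult N (src x) (snk j)))
  eq (int (suc zero)) (int zero) = sumFin-zero (none K I dis')
  eq (int (suc zero)) (int (suc zero)) = refl
  eq (int (suc zero)) (int (suc (suc j))) = sumFin-cong (λ x → sym (bypass K I dis' x (mult N (src x) (int j))))
  eq (int (suc zero)) (snk j) = sumFin-cong (λ x → sym (bypass K I dis' x (mult N (src x) (snk j))))
  eq (int (suc (suc i))) (int zero) = refl
  eq (int (suc (suc i))) (int (suc zero)) = refl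
  eq (int (suc (suc i))) (int (suc (suc j))) = refl
  eq (int (suc (suc i))) (snk j) = refl

δ-sum : ∀ {m} (i : Fin m) (f : Fin m → ℕ) → sumFin (λ x → indicator (does (i Fin.≟ x)) * f x) ≡ f i
δ-sum i f = trans (sumFin-δ i _ (λ x n → cong (λ b → indicator b * f x) (dec-false (i Fin.≟ x) (n ∘ sym))))
  (trans (cong (λ b → indicator b * f i) (dec-true (i Fin.≟ i) refl)) (ℕ.+-identityʳ _))

δ-sum-if : ∀ {m} (i : Fin m) (b : Bool) (f : Fin m → ℕ) →
  sumFin (λ x → indicator (does (i Fin.≟ x) ∧ (if b then false else true)) * f x) ≡ (if b then 0 else f i)
δ-sum-if i true  f = sumFin-zero (λ x → cong (λ b → indicator b * f x) (∧-false (does (i Fin.≟ x))))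
  where
  ∧-false : ∀ b → b ∧ false ≡ false
  ∧-false true = refl
  ∧-false false = refl
δ-sum-if i false f = trans (sumFin-cong (λ x → cong (λ b → indicator b * f x) (∧-true (does (i Fin.≟ x))))) (δ-sum i f)
  where
  ∧-true : ∀ b → b ∧ true ≡ b
  ∧-true true = refl
  ∧-true false = refl

star-step : ∀ {m} (c d : Fin m) (N : Network m) → c ≢ d → (star c d • N) ≅ stepNet (c , d) N
star-step c d N ne with c Fin.≟ d
... | yes e = contradiction e ne
... | no _ = ≅-pointwise _ (stepMult (c , d) N) λ where
    (src i) (src j) → refl
    (int zero) (src j) → refl
    (int (suc _)) (src j) → refl
    (snk _) (src j) → refl
    (src i) (int zero) → refl
    (int zero) (int zero) → refl
    (int (suc _)) (int zero) → refl
    (snk _) (int zero) → refl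
    (src i) (int (suc j)) → sym (δ-sum-if i (inI c d i) (λ x → mult N (src x) (int j)))
    (src i) (snk j) → sym (δ-sum-if i (inI c d i) (λ x → mult N (src x) (snk j)))
    (int zero) (int (suc j)) → refl
    (int zero) (snk j) → refl
    (int (suc _)) (int (suc j)) → refl
    (int (suc _)) (snk j) → refl
    (snk _) (int (suc j)) → refl
    (snk _) (snk j) → refl

star-single : ∀ {m} (c d : Fin m) → c ≡ d → star c d ≡ trivial
star-single c d e with c Fin.≟ d
... | yes _ = refl
... | no n = contradiction e n

trivial-• : ∀ {m} (N : Network m) → NoIn N → (trivial • N) ≅ N
trivial-• N n = ≅-pointwise _ (mult N) λ where
    (src i) (src j) → n (src i) j
    (int i) (src j) → n (int i) j
    (snk i) (src j) → n (snk i) j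
    (src i) (int j) → sym (δ-sum i (λ x → mult N (src x) (int j)))
    (src i) (snk j) → sym (δ-sum i (λ x → mult N (src x) (snk j)))
    (int i) (int j) → refl
    (int i) (snk j) → refl
    (snk i) (int j) → refl
    (snk i) (snk j) → refl

-- The left factor has the shape that `starBC` takes on a one-point interval, where both halves of
-- the mirror pair are trivial.
trivial-•-• : ∀ {m} (N : Network m) → NoIn N → ((trivial • trivial) • N) ≅ N
trivial-•-• {m} N n = ≅-pointwise _ (mult N) λ where
    (src i) (src j) → n (src i) j
    (int i) (src j) → n (int i) j
    (snk i) (src j) → n (snk i) j
    (src i) (int j) → sym (δδ i (λ x → mult N (src x) (int j)))
    (src i) (snk j) → sym (δδ i (λ x → mult N (src x) (snk j)))
    (int i) (int j) → refl
    (int i) (snk j) → refl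
    (snk i) (int j) → refl
    (snk i) (snk j) → refl
  where
  δδ : ∀ (i : Fin m) (f : Fin m → ℕ) →
    sumFin (λ x → sumFin (λ z → indicator (does (i Fin.≟ z)) * indicator (does (z Fin.≟ x))) * f x) ≡ f i
  δδ i f = trans (sumFin-cong (λ x → cong (_* f x) (δ-sum i (λ z → indicator (does (z Fin.≟ x)))))) (δ-sum i f)

-- In `prodBC` the two stars of a mirror pair are composed with each other before meeting `N`. The
-- multiplicities are computed for this bracketing directly, which takes the place of associativity.
star-star-step : ∀ {m} (c d c' d' : Fin m) (N : Network m) → c ≢ d → c' ≢ d' →
  ((star c d • star c' d') • N) ≅ stepNet (c , d) (stepNet (c' , d') N)
star-star-step {m} c d c' d' N ne ne' with c Fin.≟ d | c' Fin.≟ d'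
... | yes e | _ = contradiction e ne
... | no _ | yes e = contradiction e ne'
... | no _ | no _ = ≅-pointwise _ (stepMult (c , d) (stepNet (c' , d') N)) λ where
    (src i) (src j) → refl
    (int zero) (src j) → refl
    (int (suc zero)) (src j) → refl
    (int (suc (suc _))) (src j) → refl
    (snk _) (src j) → refl
    (src i) (int zero) → refl
    (int zero) (int zero) → refl
    (int (suc zero)) (int zero) → refl
    (int (suc (suc _))) (int zero) → refl
    (snk _) (int zero) → refl
    (src i) (int (suc zero)) → sym (δ-sum-if i (inI c d i) (λ x → indicator (inI c' d' x)))
    (int zero) (int (suc zero)) → refl
    (int (suc zero)) (int (suc zero)) → refl
    (int (suc (suc _))) (int (suc zero)) → refl
    (snk _) (int (suc zero)) → refl
    (src i) (int (suc (suc j))) → thru i (λ x → mult N (src x) (int j))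
    (src i) (snk j) → thru i (λ x → mult N (src x) (snk j))
    (int zero) (int (suc (suc j))) → out (λ x → mult N (src x) (int j))
    (int zero) (snk j) → out (λ x → mult N (src x) (snk j))
    (int (suc zero)) (int (suc (suc j))) → refl
    (int (suc zero)) (snk j) → refl
    (int (suc (suc _))) (int (suc (suc j))) → refl
    (int (suc (suc _))) (snk j) → refl
    (snk _) (int (suc (suc j))) → refl
    (snk _) (snk j) → refl
  where
  edge₁ edge₂ : Fin m → Fin m → ℕ
  edge₁ i z = indicator (does (i Fin.≟ z) ∧ (if inI c d i then false else true))
  edge₂ z x = indicator (does (z Fin.≟ x) ∧ (if inI c' d' z then false else true))
  contract : ∀ (g : Fin m → ℕ) (h : Fin m → ℕ) →
    sumFin (λ x → sumFin (λ z → g z * edge₂ z x) * h x) ≡ sumFin (λ z → g z * (if inI c' d' z then 0 else h z))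
  contract g h = begin
    sumFin (λ x → sumFin (λ z → g z * edge₂ z x) * h x)   ≡⟨ sumFin-cong (λ x → *-sum (h x) (λ z → g z * edge₂ z x)) ⟩
    sumFin (λ x → sumFin (λ z → g z * edge₂ z x * h x))   ≡⟨ pairSum-comm (λ x z → g z * edge₂ z x * h x) ⟩
    sumFin (λ z → sumFin (λ x → g z * edge₂ z x * h x))   ≡⟨ sumFin-cong (λ z → trans (sumFin-cong (λ x → ℕ.*-assoc (g z) (edge₂ z x) (h x))) (sum-* (g z) (λ x → edge₂ z x * h x))) ⟩
    sumFin (λ z → g z * sumFin (λ x → edge₂ z x * h x))   ≡⟨ sumFin-cong (λ z → cong (g z *_) (δ-sum-if z (inI c' d' z) h)) ⟩
    sumFin (λ z → g z * (if inI c' d' z then 0 else h z)) ∎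
    where
    open ≡-Reasoning
    sum-* : ∀ {m} k (f : Fin m → ℕ) → sumFin (λ x → k * f x) ≡ k * sumFin f
    sum-* {zero}  k f = sym (ℕ.*-zeroʳ k)
    sum-* {suc m} k f = trans (cong (k * f zero +_) (sum-* k (f ∘ suc))) (sym (ℕ.*-distribˡ-+ k (f zero) (sumFin (f ∘ suc))))
    *-sum : ∀ {m} k (f : Fin m → ℕ) → sumFin f * k ≡ sumFin (λ x → f x * k)
    *-sum {zero}  k f = refl
    *-sum {suc m} k f = trans (ℕ.*-distribʳ-+ k (f zero) (sumFin (f ∘ suc))) (cong (f zero * k +_) (*-sum k (f ∘ suc)))
  thru : ∀ i (h : Fin m → ℕ) → (if inI c d i then 0 else (if inI c' d' i then 0 else h i)) ≡ sumFin (λ x → sumFin (λ z → edge₁ i z * edge₂ z x) * h x)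
  thru i h = sym (trans (contract (edge₁ i) h) (δ-sum-if i (inI c d i) (λ z → if inI c' d' z then 0 else h z)))
  out : ∀ (h : Fin m → ℕ) → sumFin (λ z → indicator (inI c d z) * (if inI c' d' z then 0 else h z)) ≡ sumFin (λ x → sumFin (λ z → indicator (inI c d z) * edge₂ z x) * h x)
  out h = sym (contract (λ z → indicator (inI c d z)) h)

NonSingle : ∀ {m} → Interval m → Set
NonSingle (c , d) = c ≢ d

nonSingle? : ∀ {m} → Decidable (NonSingle {m})
nonSingle? (c , d) = ¬? (c Fin.≟ d)

NoIn-prodA : ∀ {m} (L : List (Interval m)) → NoIn (prodA L)
NoIn-prodA [] = NoIn-trivial
NoIn-prodA ((c , d) ∷ L) = NoIn-• (star c d) (prodA L) (NoIn-star c d)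

prodA≅netOf : ∀ {m} (L : List (Interval m)) → prodA L ≅ netOf (filter nonSingle? L)
prodA≅netOf [] = ≅-refl trivial
prodA≅netOf ((c , d) ∷ L) = go (c Fin.≟ d)
  where
  P = prodA ((c , d) ∷ L)
  Q = netOf (filter nonSingle? L)
  go : Dec (c ≡ d) → P ≅ netOf (filter nonSingle? ((c , d) ∷ L))
  go (no n) = subst (λ X → P ≅ netOf X) (sym (List.filter-accept nonSingle? n))
    (≅-trans P (stepNet (c , d) (prodA L)) (stepNet (c , d) Q) (star-step c d (prodA L) n) (step-cong (c , d) (prodA L) Q (prodA≅netOf L)))
  go (yes e) = subst (λ X → P ≅ netOf X) (sym (List.filter-reject nonSingle? (λ n → n e)))
    (≅-trans P (prodA L) Q (subst (λ S → (S • prodA L) ≅ prodA L) (sym (star-single c d e)) (trivial-• (prodA L) (NoIn-prodA L)))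
      (prodA≅netOf L))

expand : ∀ n → List (Interval (n + n)) → List (Interval (n + n))
expand n [] = []
expand n ((c , d) ∷ L) with c Fin.≟ bar n d
... | yes _ = (c , d) ∷ expand n L
... | no _  = (c , d) ∷ (bar n d , bar n c) ∷ expand n L

bar-involutive : ∀ n x → bar n (bar n x) ≡ x
bar-involutive n = Fin.opposite-involutive

bar-injective : ∀ n {x y} → bar n x ≡ bar n y → x ≡ y
bar-injective n {x} {y} e = trans (sym (bar-involutive n x)) (trans (cong (bar n) e) (bar-involutive n y))

NoIn-prodBC : ∀ n (L : List (Interval (n + n))) → NoIn (prodBC n L)
NoIn-prodBC n [] = NoIn-trivial
NoIn-prodBC n ((c , d) ∷ L) = NoIn-• (starBC n c d) (prodBC n L) star-part
  where
  star-part : NoIn (starBC n c d)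
  star-part with c Fin.≟ bar n d
  ... | yes _ = NoIn-star c d
  ... | no _ = NoIn-• (star c d) _ (NoIn-star c d)

starBC-step : ∀ n c d (N : Network (n + n)) X → c ≢ d → N ≅ netOf (expand n X) →
  (starBC n c d • N) ≅ netOf (expand n ((c , d) ∷ X))
starBC-step n c d N X ne i with c Fin.≟ bar n d
... | yes _ = ≅-trans (star c d • N) (stepNet (c , d) N) (stepNet (c , d) Q) (star-step c d N ne) (step-cong (c , d) N Q i)
  where Q = netOf (expand n X)
... | no _ = ≅-trans ((star c d • star (bar n d) (bar n c)) • N) (stepNet (c , d) (stepNet K N)) (stepNet (c , d) (stepNet K Q))
               (star-star-step c d (bar n d) (bar n c) N ne (λ e → ne (sym (bar-injective n e))))
               (step-cong (c , d) (stepNet K N) (stepNet K Q) (step-cong K N Q i))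
  where
  Q = netOf (expand n X)
  K = bar n d , bar n c

starBC-single : ∀ n c d (N : Network (n + n)) → NoIn N → c ≡ d → (starBC n c d • N) ≅ N
starBC-single n c d N no-in e with c Fin.≟ bar n d
... | yes _ = subst (λ S → (S • N) ≅ N) (sym (star-single c d e)) (trivial-• N no-in)
... | no _ = subst₂ (λ S T → ((S • T) • N) ≅ N) (sym (star-single c d e)) (sym (star-single (bar n d) (bar n c) (cong (bar n) (sym e))))
               (trivial-•-• N no-in)

prodBC≅netOf : ∀ n (L : List (Interval (n + n))) → prodBC n L ≅ netOf (expand n (filter nonSingle? L))
prodBC≅netOf n [] = ≅-refl trivial
prodBC≅netOf n ((c , d) ∷ L) = go (c Fin.≟ d)
  where
  P = prodBC n ((c , d) ∷ L)
  go : Dec (c ≡ d) → P ≅ netOf (expand n (filter nonSingle? ((c , d) ∷ L)))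
  go (no ne) = subst (λ X → P ≅ netOf (expand n X)) (sym (List.filter-accept nonSingle? ne))
    (starBC-step n c d (prodBC n L) (filter nonSingle? L) ne (prodBC≅netOf n L))
  go (yes e) = subst (λ X → P ≅ netOf (expand n X)) (sym (List.filter-reject nonSingle? (λ x → x e)))
    (≅-trans P (prodBC n L) (netOf (expand n (filter nonSingle? L))) (starBC-single n c d (prodBC n L) (NoIn-prodBC n L) e) (prodBC≅netOf n L))

-- Paths

private
  ≢0 : ∀ {A : Set} {n} → n ≡ 0 → 0 < n → A
  ≢0 refl ()

  mult-pos : ∀ (b : Bool) n → 0 < indicator b * n → b ≡ true × 0 < n
  mult-pos true n p = refl , subst (0 <_) (ℕ.+-identityʳ n) p

  if-pos : ∀ (b : Bool) n → 0 < (if b then 0 else n) → b ≡ false × 0 < n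
  if-pos false n p = refl , p

  ind-pos : ∀ (b : Bool) → 0 < indicator b → b ≡ true
  ind-pos true p = refl

in⁺ : ∀ {m} (I : Interval m) x → inI (proj₁ I) (proj₂ I) x ≡ true → x ∈ᵢ I
in⁺ I x e with inI-view I x
... | inj₁ (p , _) = p
... | inj₂ (_ , f) with () ← trans (sym e) f

module _ {m : ℕ} (I : Interval m) (N : Network m) where
  private
    c = proj₁ I
    d = proj₂ I

  path-from-int : ∀ {a j} → Path (stepNet I N) (int (suc a)) (snk j) → Path N (int a) (snk j)
  path-from-snk : ∀ {a j} → Path (stepNet I N) (snk a) (snk j) → Path N (snk a) (snk j)
  path-from-int (edge p) = edge p
  path-from-int (_∷_ {y = int zero} () π)
  path-from-int (_∷_ {y = int (suc _)} p π) = p ∷ path-from-int π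
  path-from-int (_∷_ {y = snk _} p π) = p ∷ path-from-snk π
  path-from-snk (edge p) = edge p
  path-from-snk (_∷_ {y = int zero} () π)
  path-from-snk (_∷_ {y = int (suc _)} p π) = p ∷ path-from-int π
  path-from-snk (_∷_ {y = snk _} p π) = p ∷ path-from-snk π

  path-from-centre : ∀ {j} → Path (stepNet I N) (int zero) (snk j) → ∃ λ k → k ∈ᵢ I × Path N (src k) (snk j)
  path-from-centre {j} (edge p) with sumFin-pos⁻ (λ x → indicator (inI c d x) * mult N (src x) (snk j)) p
  ... | k , q with mult-pos (inI c d k) (mult N (src k) (snk j)) q
  ...   | e , q' = k , in⁺ I k e , edge q'
  path-from-centre (_∷_ {y = int (suc y)} p π) with sumFin-pos⁻ (λ x → indicator (inI c d x) * mult N (src x) (int y)) p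
  ... | k , q with mult-pos (inI c d k) (mult N (src k) (int y)) q
  ...   | e , q' = k , in⁺ I k e , q' ∷ path-from-int π
  path-from-centre (_∷_ {y = snk y} p π) with sumFin-pos⁻ (λ x → indicator (inI c d x) * mult N (src x) (snk y)) p
  ... | k , q with mult-pos (inI c d k) (mult N (src k) (snk y)) q
  ...   | e , q' = k , in⁺ I k e , q' ∷ path-from-snk π

  path-from-src : ∀ {i j} → Path (stepNet I N) (src i) (snk j) → ∃ λ k → Hop I i k × Path N (src k) (snk j)
  path-from-src {i} {j} (edge p) = i , inj₁ refl , edge (proj₂ (if-pos (inI c d i) (mult N (src i) (snk j)) p))
  path-from-src {i} (_∷_ {y = int zero} p π) with path-from-centre π
  ... | k , k∈ , π' = k , inj₂ (in⁺ I i (ind-pos (inI c d i) p) , k∈) , π'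
  path-from-src {i} (_∷_ {y = int (suc y)} p π) = i , inj₁ refl , proj₂ (if-pos (inI c d i) (mult N (src i) (int y)) p) ∷ path-from-int π
  path-from-src {i} (_∷_ {y = snk y} p π) = i , inj₁ refl , proj₂ (if-pos (inI c d i) (mult N (src i) (snk y)) p) ∷ path-from-snk π

Path⇒Reach : ∀ {m} (L : List (Interval m)) {i j} → Path (netOf L) (src i) (snk j) → Reach L i j
Path⇒Reach [] {i} {j} (edge p) with i Fin.≟ j
... | yes e = e
Path⇒Reach [] (_∷_ {y = snk y} p (edge ()))
Path⇒Reach [] (_∷_ {y = snk y} p (_∷_ () π))
Path⇒Reach (I ∷ L) π with path-from-src I (netOf L) π
... | k , h , π' = k , h , Path⇒Reach L π'

-- Covering families

module _ {m : ℕ} (I : Interval m) (N : Network m) (noIn : NoIn N) where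
  private
    c = proj₁ I
    d = proj₂ I

  -- A path of N from a source in I is continued backwards through the centre of the new star.
  emb : V m (size N) → V m (suc (size N))
  emb (src i) = if inI c d i then int zero else src i
  emb (snk i) = snk i
  emb (int i) = int (suc i)

  emb-edge : ∀ x y → 0 < mult N x y → 0 < stepMult I N (emb x) (emb y)
  emb-edge x (src j) p = ≢0 (noIn x j) p
  emb-edge (src i) (int j) p with inI c d i in eq
  ... | true = sumFin-pos (λ x → indicator (inI c d x) * mult N (src x) (int j)) i (subst (λ b → 0 < indicator b * mult N (src i) (int j)) (sym eq) (subst (0 <_) (sym (ℕ.+-identityʳ _)) p))
  ... | false = subst (λ b → 0 < (if b then 0 else mult N (src i) (int j))) (sym eq) p
  emb-edge (src i) (snk j) p with inI c d i in eq
  ... | true = sumFin-pos (λ x → indicator (inI c d x) * mult N (src x) (snk j)) i (subst (λ b → 0 < indicator b * mult N (src i) (snk j)) (sym eq) (subst (0 <_) (sym (ℕ.+-identityʳ _)) p))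
  ... | false = subst (λ b → 0 < (if b then 0 else mult N (src i) (snk j))) (sym eq) p
  emb-edge (snk i) (int j) p = p
  emb-edge (snk i) (snk j) p = p
  emb-edge (int i) (int j) p = p
  emb-edge (int i) (snk j) p = p

  lift : ∀ {x y} → Path N x y → Path (stepNet I N) (emb x) (emb y)
  lift (edge {x} {y} p) = edge (emb-edge x y p)
  lift (_∷_ {x} {y} p π) = emb-edge x y p ∷ lift π

  lift-on : ∀ {x y a b} {π : Path N a b} → EdgeOn x y π → EdgeOn (emb x) (emb y) (lift π)
  lift-on (here-edge p) = here-edge _
  lift-on (here p π) = here _ _
  lift-on (there p e) = there _ (lift-on e)

  edge-origin : ∀ x y → 0 < stepMult I N x y →
    (∃ λ i → x ≡ src i × y ≡ int zero × i ∈ᵢ I) ⊎ (∃ λ x' → ∃ λ y' → emb x' ≡ x × emb y' ≡ y × 0 < mult N x' y')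
  edge-origin (src i) (int zero) p = inj₁ (i , refl , refl , in⁺ I i (ind-pos (inI c d i) p))
  edge-origin (src i) (int (suc y)) p with if-pos (inI c d i) (mult N (src i) (int y)) p
  ... | e , q = inj₂ (src i , int y , cong (λ b → if b then int zero else src i) e , refl , q)
  edge-origin (src i) (snk y) p with if-pos (inI c d i) (mult N (src i) (snk y)) p
  ... | e , q = inj₂ (src i , snk y , cong (λ b → if b then int zero else src i) e , refl , q)
  edge-origin (int zero) (int (suc y)) p with sumFin-pos⁻ (λ x → indicator (inI c d x) * mult N (src x) (int y)) p
  ... | k , q with mult-pos (inI c d k) (mult N (src k) (int y)) q
  ...   | e , q' = inj₂ (src k , int y , cong (λ b → if b then int zero else src k) e , refl , q')
  edge-origin (int zero) (snk y) p with sumFin-pos⁻ (λ x → indicator (inI c d x) * mult N (src x) (snk y)) p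
  ... | k , q with mult-pos (inI c d k) (mult N (src k) (snk y)) q
  ...   | e , q' = inj₂ (src k , snk y , cong (λ b → if b then int zero else src k) e , refl , q')
  edge-origin (int (suc x)) (int (suc y)) p = inj₂ (int x , int y , refl , refl , p)
  edge-origin (int (suc x)) (snk y) p = inj₂ (int x , snk y , refl , refl , p)
  edge-origin (snk x) (int (suc y)) p = inj₂ (snk x , int y , refl , refl , p)
  edge-origin (snk x) (snk y) p = inj₂ (snk x , snk y , refl , refl , p)

  Covers-step : (u' v : Pm m) → Supp (rg I) v → Covers N (u' ·_) → Covers (stepNet I N) ((v ∘ₚ u') ·_)
  Covers-step u' v s (π , cov) = (λ i → proj₁ (fam i)) , cov'
    where
    -- The path for `i` continues as the old path for `v · i`. With it is recorded what it is
    -- responsible for: the edge into the centre if `i` lies in `I`, and the images of all edges on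
    -- that old path.
    fam : ∀ i → Σ (Path (stepNet I N) (src i) (snk (u' · (v · i)))) λ ρ →
      (i ∈ᵢ I → EdgeOn (src i) (int zero) ρ) × (∀ {x y} → EdgeOn x y (π (v · i)) → EdgeOn (emb x) (emb y) ρ)
    fam i with inI-view I i
    ... | inj₂ (n , e) = subst (λ k → Path (stepNet I N) (src i) (snk (u' · k))) (sym (s i n)) ρ , (λ p → contradiction p n) , on
      where
      ρ' : Path (stepNet I N) (emb (src i)) (snk (u' · i))
      ρ' = lift (π i)
      es : emb (src i) ≡ src i
      es = cong (λ b → if b then int zero else src i) e
      ρ = subst (λ a → Path (stepNet I N) a (snk (u' · i))) es ρ'
      on : ∀ {x y} → EdgeOn x y (π (v · i)) → EdgeOn (emb x) (emb y) (subst (λ k → Path (stepNet I N) (src i) (snk (u' · k))) (sym (s i n)) ρ)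
      on {x} {y} = aux (v · i) (s i n)
        where
        aux : ∀ k (q : k ≡ i) → EdgeOn x y (π k) → EdgeOn (emb x) (emb y) (subst (λ k → Path (stepNet I N) (src i) (snk (u' · k))) (sym q) ρ)
        aux k refl o = aux' es (lift-on o)
          where
          aux' : ∀ {a} (es : emb (src i) ≡ a) → EdgeOn (emb x) (emb y) ρ' → EdgeOn (emb x) (emb y) (subst (λ a → Path (stepNet I N) a (snk (u' · i))) es ρ')
          aux' refl o = o
    ... | inj₁ (p , e) = p0 ∷ ρ , (λ _ → here _ _) , λ o → there _ (aux' es (lift-on o))
      where
      e' : inI c d (v · i) ≡ true
      e' with inI-view I (v · i)
      ... | inj₁ (_ , q) = q
      ... | inj₂ (n , _) = contradiction (Supp-∈ (rg I) v s p) n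
      es : emb (src (v · i)) ≡ int zero
      es = cong (λ b → if b then int zero else src (v · i)) e'
      p0 : 0 < stepMult I N (src i) (int zero)
      p0 = subst (λ b → 0 < indicator b) (sym e) (s≤s z≤n)
      ρ' : Path (stepNet I N) (emb (src (v · i))) (snk (u' · (v · i)))
      ρ' = lift (π (v · i))
      ρ = subst (λ a → Path (stepNet I N) a (snk (u' · (v · i)))) es ρ'
      aux' : ∀ {a x y} (es : emb (src (v · i)) ≡ a) → EdgeOn x y ρ' → EdgeOn x y (subst (λ a → Path (stepNet I N) a (snk (u' · (v · i)))) es ρ')
      aux' refl o = o
    cov' : ∀ x y → 0 < stepMult I N x y → ∃ λ i → EdgeOn x y (proj₁ (fam i))
    cov' x y p with edge-origin x y p
    ... | inj₁ (i , refl , refl , i∈) = i , proj₁ (proj₂ (fam i)) i∈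
    ... | inj₂ (x' , y' , refl , refl , q) with cov x' y' q
    ...   | k , o = flip v · k , proj₂ (proj₂ (fam (flip v · k))) (subst (λ k → EdgeOn x' y' (π k)) (sym (Perm.inverseʳ v)) o)

Covers-cong : ∀ {m} (N : Network m) {f g : Fin m → Fin m} → (∀ i → f i ≡ g i) → Covers N f → Covers N g
Covers-cong N {f} {g} e (π , cov) = (λ i → move (e i) (π i)) , λ x y p → let i , o = cov x y p in i , move-on (e i) o
  where
  move : ∀ {i j k} → j ≡ k → Path N (src i) (snk j) → Path N (src i) (snk k)
  move refl π = π
  move-on : ∀ {i j k x y} (q : j ≡ k) {π : Path N (src i) (snk j)} → EdgeOn x y π → EdgeOn x y (move q π)
  move-on refl o = o

Fact⇒Covers : ∀ {m} (L : List (Interval m)) (u : Pm m) → Fact L u → Covers (netOf L) (u ·_)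
Fact⇒Covers [] u f = Covers-cong trivial (λ i → sym (f i)) ((λ i → edge (self i)) , cov)
  where
  self : ∀ i → 0 < indicator (does (i Fin.≟ i))
  self i = subst (λ b → 0 < indicator b) (sym (dec-true (i Fin.≟ i) refl)) (s≤s z≤n)
  cov : ∀ x y → 0 < mult trivial x y → ∃ λ i → EdgeOn x y (edge {x = src i} {y = snk i} (self i))
  cov (src i) (snk j) p with i Fin.≟ j
  ... | yes refl = i , here-edge _
Fact⇒Covers (I ∷ L) u (u' , v , f , s , e) =
  Covers-cong (netOf (I ∷ L)) (λ i → sym (e i)) (Covers-step I (netOf L) (NoIn-netOf L) u' v s (Fact⇒Covers L u' f))

Covers-≅ : ∀ {m} (N M : Network m) (f : Fin m → Fin m) → N ≅ M → Covers N f → Covers M f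
Covers-≅ {m} N M f (σ , e) (π , cov) = (λ i → mapP (π i)) , cov'
  where
  φ : V m (size N) → V m (size M)
  φ = mapV (Inverse.to σ)
  mapP : ∀ {x y} → Path N x y → Path M (φ x) (φ y)
  mapP (edge {x} {y} p) = edge (subst (0 <_) (sym (e x y)) p)
  mapP (_∷_ {x} {y} p π) = subst (0 <_) (sym (e x y)) p ∷ mapP π
  mapP-on : ∀ {x y a b} {π : Path N a b} → EdgeOn x y π → EdgeOn (φ x) (φ y) (mapP π)
  mapP-on (here-edge p) = here-edge _
  mapP-on (here p π) = here _ _
  mapP-on (there p o) = there _ (mapP-on o)
  cov' : ∀ x y → 0 < mult M x y → ∃ λ i → EdgeOn x y (mapP (π i))
  cov' x y p with cov (mapV (Inverse.from σ) x) (mapV (Inverse.from σ) y)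
      (subst (0 <_) (trans (sym (cong₂ (mult M) (mapV-inverse σ x) (mapV-inverse σ y))) (e _ _)) p)
  ... | i , o = i , subst₂ (λ a b → EdgeOn a b (mapP (π i))) (mapV-inverse σ x) (mapV-inverse σ y) (mapP-on o)

IsWOf-≅ : ∀ {m} (N M : Network m) (f : Fin m → Fin m) → N ≅ M → IsWOf N f → IsWOf M f
IsWOf-≅ N M f i (p , c , mx) = p , Covers-≅ N M f i c , λ u q d → mx u q (Covers-≅ M N u (≅-sym N M i) d)

IsMax⇒IsWOf : ∀ {m} (L : List (Interval m)) (w : Pm m) → IsMax L w → IsWOf (netOf L) (w ·_)
IsMax⇒IsWOf L w (f , mx) = ·-injective w , Fact⇒Covers L w f , λ u p (π , _) → mx (toPerm u p) (λ i → Path⇒Reach L (π i))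

IsWOf-unique : ∀ {m} (N : Network m) (f g : Fin m → Fin m) → IsWOf N f → IsWOf N g → ∀ i → f i ≡ g i
IsWOf-unique N f g (p , c , mx) (p' , c' , mx') with mx g p' c' | mx' f p c
... | inj₁ e | _ = λ i → sym (e i)
... | inj₂ _ | inj₁ e = e
... | inj₂ l | inj₂ l' = contradiction l (ℕ.<-asym l')

-- Commutation of disjoint stars

infix 4 _~_
data _~_ {m} : List (Interval m) → List (Interval m) → Set where
  ~-refl  : ∀ {L} → L ~ L
  ~-swap  : ∀ {I K L} → Disjoint I K → I ∷ K ∷ L ~ K ∷ I ∷ L
  ~-cons  : ∀ {I L L'} → L ~ L' → I ∷ L ~ I ∷ L'
  ~-trans : ∀ {L L' L''} → L ~ L' → L' ~ L'' → L ~ L''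

~⇒≅ : ∀ {m} {L L' : List (Interval m)} → L ~ L' → netOf L ≅ netOf L'
~⇒≅ {L = L} ~-refl = ≅-refl (netOf L)
~⇒≅ (~-swap {I} {K} {L} d) = step-swap I K (netOf L) d
~⇒≅ (~-cons {I} {L} {L'} r) = step-cong I (netOf L) (netOf L') (~⇒≅ r)
~⇒≅ (~-trans {L} {L'} {L''} r s) = ≅-trans (netOf L) (netOf L') (netOf L'') (~⇒≅ r) (~⇒≅ s)

~-sym : ∀ {m} {L L' : List (Interval m)} → L ~ L' → L' ~ L
~-sym ~-refl = ~-refl
~-sym (~-swap d) = ~-swap (λ p q → d q p)
~-sym (~-cons r) = ~-cons (~-sym r)
~-sym (~-trans r s) = ~-trans (~-sym s) (~-sym r)

~-All : ∀ {m} {P : Interval m → Set} {L L'} → L ~ L' → All P L → All P L'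
~-All ~-refl a = a
~-All (~-swap _) (p ∷ q ∷ a) = q ∷ p ∷ a
~-All (~-cons r) (p ∷ a) = p ∷ ~-All r a
~-All (~-trans r s) a = ~-All s (~-All r a)

~-Reach : ∀ {m} {L L' : List (Interval m)} → L ~ L' → ∀ {i j} → Reach L i j → Reach L' i j
~-Reach ~-refl r = r
~-Reach (~-swap d) (k , inj₁ refl , l , h , r) = l , h , l , inj₁ refl , r
~-Reach (~-swap d) (k , inj₂ pq , l , inj₁ refl , r) = _ , inj₁ refl , k , inj₂ pq , r
~-Reach (~-swap d) (k , inj₂ (p , q) , l , inj₂ (p' , q') , r) = ⊥-elim (d q p')
~-Reach (~-cons s) (k , h , r) = k , h , ~-Reach s r
~-Reach (~-trans s t) r = ~-Reach t (~-Reach s r)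

~-∷ʳ : ∀ {m} {L L' : List (Interval m)} {I} → L ~ L' → L ∷ʳ I ~ L' ∷ʳ I
~-∷ʳ ~-refl = ~-refl
~-∷ʳ (~-swap d) = ~-swap d
~-∷ʳ (~-cons r) = ~-cons (~-∷ʳ r)
~-∷ʳ (~-trans r s) = ~-trans (~-∷ʳ r) (~-∷ʳ s)

~-to-front : ∀ {m} (L₁ : List (Interval m)) {I L₂} → All (Disjoint I) L₁ → L₁ ++ I ∷ L₂ ~ I ∷ L₁ ++ L₂
~-to-front [] a = ~-refl
~-to-front (K ∷ L₁) (d ∷ a) = ~-trans (~-cons (~-to-front L₁ a)) (~-swap (λ p q → d q p))

~-to-back : ∀ {m} (L₁ : List (Interval m)) {I L₂} → All (Disjoint I) L₂ → L₁ ++ I ∷ L₂ ~ (L₁ ++ L₂) ∷ʳ I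
~-to-back (K ∷ L₁) a = ~-cons (~-to-back L₁ a)
~-to-back [] [] = ~-refl
~-to-back [] (d ∷ a) = ~-trans (~-swap d) (~-cons (~-to-back [] a))

All-reverse : ∀ {A : Set} {P : A → Set} {xs} → All P xs → All P (reverse xs)
All-reverse {xs = []} [] = []
All-reverse {P = P} {xs = x ∷ xs} (p ∷ a) = subst (All P) (sym (List.unfold-reverse x xs)) (All.++⁺ (All-reverse a) (p ∷ []))

-- Codes: building a zig-zag list from right to left

LeftOf : ∀ {m} → Interval m → List (Interval m) → Set
LeftOf (c , d) L = c Fin.< d × All (λ K → c Fin.< proj₁ K × d Fin.< proj₂ K) L

-- The index is the least left endpoint (m for the empty list).
data Code {m} : List (Interval m) → ℕ → Set where
  nil   : Code [] m
  front : ∀ {I L s} → Code L s → LeftOf I L → Twins (s , suc (toℕ (proj₂ I))) L → Code (I ∷ L) (toℕ (proj₁ I))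
  -- The condition on `s` says that `I` overlaps the leftmost interval of `L`. An interval disjoint
  -- from all the others could stand at either end; it is always put at the front, which keeps the
  -- form canonical.
  back  : ∀ {I L s} → Code L s → LeftOf I L → s ≤ toℕ (proj₂ I) → Twins (s , suc (toℕ (proj₂ I))) (reverse L) →
          Code (L ∷ʳ I) (toℕ (proj₁ I))

code-≤ : ∀ {m} {L : List (Interval m)} {s} → Code L s → All (λ K → s ≤ toℕ (proj₁ K)) L
code-≤ nil = []
code-≤ (front C (_ , l) t) = ℕ.≤-refl ∷ All.map (ℕ.<⇒≤ ∘ proj₁) l
code-≤ (back C (_ , l) _ t) = All.++⁺ (All.map (ℕ.<⇒≤ ∘ proj₁) l) (ℕ.≤-refl ∷ [])

code-attains : ∀ {m} {L : List (Interval m)} {s} → Code L s → s < m → ¬ All (λ K → s < toℕ (proj₁ K)) L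
code-attains nil l = contradiction l (ℕ.n≮n _)
code-attains (front C _ _) _ (p ∷ _) = ℕ.n≮n _ p
code-attains (back {L = L} C _ _ _) _ a = ℕ.n≮n _ (All.head (All.++⁻ʳ L a))

code-left : ∀ {m} {L : List (Interval m)} {s I} → Code L s → LeftOf I L → toℕ (proj₁ I) < s
code-left {I = I} nil _ = Fin.toℕ<n (proj₁ I)
code-left (front C _ _) (_ , p ∷ _) = proj₁ p
code-left (back {L = L} C _ _ _) (_ , a) = proj₁ (All.head (All.++⁻ʳ L a))

leftmost-ok : ∀ {m} {I : Interval m} {s L} → toℕ (proj₁ I) < s → All (λ K → s ≤ toℕ (proj₁ K)) L →
    Twins (s , suc (toℕ (proj₂ I))) L → FrontOK I (s , suc (toℕ (proj₂ I))) L
leftmost-ok {I = I} c<s lb tw = record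
  { J⊆I   = λ (p , q) → ℕ.≤-trans (ℕ.<⇒≤ c<s) p , q
  ; bound = Fin.toℕ<n (proj₂ I)
  ; avoid = λ {x} (p , q) n → All.map (λ s≤ (a , _) → n (ℕ.≤-trans s≤ a , q)) lb
  ; twins = tw
  }

reverse-∷ʳ : ∀ {A : Set} (x : A) xs → reverse (xs ∷ʳ x) ≡ x ∷ reverse xs
reverse-∷ʳ x xs = List.reverse-++ xs (x ∷ [])

code-max : ∀ {m} {L : List (Interval m)} {s} → Code L s → ∃ (IsMax L)
code-max nil = Perm.id , IsMax-[]
code-max (front C l t) with code-max C
... | w' , mx with IsMax-extend (leftmost-ok (code-left C l) (code-≤ C) t) w' mx
...   | v , _ , _ , mx' = v ∘ₚ w' , mx'
code-max (back {I} {L} C l _ t) with code-max C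
... | w' , mx with IsMax-extend (leftmost-ok (code-left C l) (All-reverse (code-≤ C)) t) (flip w') (IsMax-reverse L w' mx)
...   | v , _ , _ , mx' = flip (v ∘ₚ flip w') , subst (λ X → IsMax X (flip (v ∘ₚ flip w')))
          (trans (List.unfold-reverse I (reverse L)) (cong (_∷ʳ I) (List.reverse-involutive L)))
          (IsMax-reverse (I ∷ reverse L) (v ∘ₚ flip w') mx')

-- Reading off the leftmost interval of a code from its maximal permutation

-- What adding `I` at the front means for the permutations alone, with the list forgotten. An
-- interval added at the back gives the same record for the inverses.
record Peel {m} (I : Interval m) (s : ℕ) (w w' : Pm m) : Set where
  field
    c<d   : proj₁ I Fin.< proj₂ I
    c<s   : toℕ (proj₁ I) < s
    v     : Pm m
    supp  : Supp (rg I) v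
    eq    : w ≗ₚ v ∘ₚ w'
    dec   : DecOn (rg I) w
    fixed : ∀ {x} → toℕ x < s → w' · x ≡ x
    dec'  : DecOn (s , suc (toℕ (proj₂ I))) w'

  private
    c = proj₁ I
    d = proj₂ I
    c∈ : c ∈ᵢ I
    c∈ = ℕ.≤-refl , ℕ.<-trans c<d ℕ.≤-refl
    d∈ : d ∈ᵢ I
    d∈ = ℕ.<⇒≤ c<d , ℕ.≤-refl

  w-below : ∀ {x} → x Fin.< c → w · x ≡ x
  w-below {x} l = trans (eq x) (trans (cong (w' ·_) (supp x (λ (p , _) → ℕ.<⇒≱ l p))) (fixed (ℕ.<-trans l c<s)))

  -- The value `c` is fixed by `w'`, so `w` takes it somewhere on `I`, and `d` carries the smallest
  -- value on `I`. Values below `c` are taken by the fixed points left of `c`.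
  w-d : w · d ≡ c
  w-d = Fin.toℕ-injective (ℕ.≤-antisym le ge)
    where
    y = flip v · c
    y∈ : y ∈ᵢ I
    y∈ = Supp-∈ (rg I) (flip v) (Supp-flip v supp) c∈
    wy : w · y ≡ c
    wy = trans (eq y) (trans (cong (w' ·_) (Perm.inverseʳ v)) (fixed c<s))
    le : w · d Fin.≤ c
    le with ℕ.m≤n⇒m<n∨m≡n (ℕ.≤-pred (proj₂ y∈))
    ... | inj₁ y<d = ℕ.<⇒≤ (subst (w · d Fin.<_) wy (dec y∈ d∈ y<d))
    ... | inj₂ y≡d = ℕ.≤-reflexive (cong toℕ (trans (cong (w ·_) (sym (Fin.toℕ-injective y≡d))) wy))
    ge : c Fin.≤ w · d
    ge with toℕ (w · d) ℕ.<? toℕ c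
    ... | no n = ℕ.≮⇒≥ n
    ... | yes l = contradiction (subst (Fin._< c) (·-injective w (w-below l)) l) (ℕ.<-asym c<d)

  -- Walking left from `d`, where the value is `c`, each step raises the value by at least one.
  w-c : d Fin.≤ w · c
  w-c = subst (_≤ toℕ (w · c)) (ℕ.m∸n+n≡m (ℕ.<⇒≤ c<d)) (up (toℕ d ℕ.∸ toℕ c) c c∈ (ℕ.m∸n+n≡m (ℕ.<⇒≤ c<d)))
    where
    up : ∀ k x → x ∈ᵢ I → k + toℕ x ≡ toℕ d → k + toℕ c ≤ toℕ (w · x)
    up zero x _ e = ℕ.≤-reflexive (cong toℕ (sym (trans (cong (w ·_) (Fin.toℕ-injective e)) w-d)))
    up (suc k) x x∈ e = ℕ.≤-<-trans (up k x⁺ x⁺∈ (trans (cong (k +_) ex) (trans (ℕ.+-suc k (toℕ x)) e))) (dec x∈ x⁺∈ (ℕ.≤-reflexive (sym ex)))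
      where
      x<d : toℕ x < toℕ d
      x<d = subst (toℕ x <_) e (s≤s (ℕ.m≤n+m (toℕ x) k))
      x⁺ : Fin m
      x⁺ = fromℕ< (ℕ.≤-<-trans x<d (Fin.toℕ<n d))
      ex : toℕ x⁺ ≡ suc (toℕ x)
      ex = Fin.toℕ-fromℕ< _
      x⁺∈ : x⁺ ∈ᵢ I
      x⁺∈ = subst (λ z → toℕ c ≤ z × z < suc (toℕ d)) (sym ex) (ℕ.m≤n⇒m≤1+n (proj₁ x∈) , s≤s x<d)

  -- The value `w' · s` is taken by `w` on `I`, and the largest value on `I` sits at `c`. This
  -- strictness decides whether the interval was added at the front or at the back.
  w-c-strict : s ≤ toℕ d → (∀ x → toℕ x ≡ s → d Fin.< w' · x) → d Fin.< w · c
  w-c-strict s≤d ext = ℕ.<-≤-trans (subst (d Fin.<_) (sym wy) (ext x ex)) top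
    where
    x : Fin m
    x = fromℕ< (ℕ.≤-<-trans s≤d (Fin.toℕ<n d))
    ex : toℕ x ≡ s
    ex = Fin.toℕ-fromℕ< _
    x∈ : x ∈ᵢ I
    x∈ = subst (λ z → toℕ c ≤ z × z < suc (toℕ d)) (sym ex) (ℕ.<⇒≤ c<s , s≤s s≤d)
    y = flip v · x
    y∈ : y ∈ᵢ I
    y∈ = Supp-∈ (rg I) (flip v) (Supp-flip v supp) x∈
    wy : w · y ≡ w' · x
    wy = trans (eq y) (cong (w' ·_) (Perm.inverseʳ v))
    top : w · y Fin.≤ w · c
    top with ℕ.m≤n⇒m<n∨m≡n (proj₁ y∈)
    ... | inj₁ c<y = ℕ.<⇒≤ (dec c∈ y∈ c<y)
    ... | inj₂ c≡y = ℕ.≤-reflexive (cong (λ z → toℕ (w · z)) (sym (Fin.toℕ-injective c≡y)))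

-- The set w(I) determines where w' stops fixing points, hence w'.
peel-unique : ∀ {m} {I : Interval m} {s t} (w w₁ w₂ : Pm m) → Peel I s w w₁ → Peel I t w w₂ →
  (∀ x → toℕ x ≡ s → proj₂ I Fin.< flip w₁ · x) → (∀ x → toℕ x ≡ t → proj₂ I Fin.< flip w₂ · x) → w₁ ≗ₚ w₂
peel-unique {m} {I} w w₁ w₂ P Q ext₁ ext₂ = go P Q ext₁ ext₂
  where
  d = proj₂ I
  module _ {w₁ w₂ : Pm m} {s t : ℕ} (P : Peel I s w w₁) (Q : Peel I t w w₂) where
    private
      module P = Peel P
      module Q = Peel Q
    p = flip Q.v ∘ₚ P.v
    p-supp : Supp (rg I) p
    p-supp = Supp-∘ (flip Q.v) P.v (Supp-flip Q.v Q.supp) P.supp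
    p-eq : w₂ ≗ₚ p ∘ₚ w₁
    p-eq x = trans (cong (w₂ ·_) (sym (Perm.inverseʳ Q.v))) (trans (sym (Q.eq (flip Q.v · x))) (P.eq (flip Q.v · x)))

    -- If both permutations fix everything below `s`, they differ by a permutation of [s,d] only,
    -- and both are decreasing there.
    same : (∀ {x} → toℕ x < s → w₂ · x ≡ x) → DecOn (s , suc (toℕ d)) w₂ → w₁ ≗ₚ w₂
    same f dd x = sym (trans (p-eq x) (cong (w₁ ·_) (DecOn-unique (s , suc (toℕ d)) w₁ p supp' P.dec' (DecOn-cong w₂ (p ∘ₚ w₁) p-eq dd) x)))
      where
      supp' : Supp (s , suc (toℕ d)) p
      supp' y n with y ∈? rg I
      ... | no y∉ = p-supp y y∉
      ... | yes (_ , y≤d) = ·-injective w₁ (trans (sym (p-eq y)) (trans (f y<s) (sym (P.fixed y<s))))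
        where
        y<s : toℕ y < s
        y<s = ℕ.≰⇒> (λ s≤y → n (s≤y , y≤d))

    -- If `s` lies in `I`, then `w₂` fixes it, so `w₁` takes the value `s` inside `I`, whereas `ext`
    -- places it beyond `d`. If `s` exceeds `d`, the region [s,d] is empty and `same` applies.
    below : s < t → (∀ x → toℕ x ≡ s → d Fin.< flip w₁ · x) → w₁ ≗ₚ w₂
    below s<t ext with s ℕ.≤? toℕ d
    ... | no s≰d = same (λ l → Q.fixed (ℕ.<-trans l s<t)) (λ (a , b) → contradiction (ℕ.≤-trans a (ℕ.≤-pred b)) s≰d)
    ... | yes s≤d = contradiction (ext x ex) (ℕ.≤⇒≯ (subst (Fin._≤ d) (sym (flip-unique w₁ at)) (ℕ.≤-pred (proj₂ (Supp-∈ (rg I) p p-supp x∈)))))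
      where
      x : Fin m
      x = fromℕ< (ℕ.≤-<-trans s≤d (Fin.toℕ<n d))
      ex : toℕ x ≡ s
      ex = Fin.toℕ-fromℕ< _
      x∈ : x ∈ᵢ I
      x∈ = subst (λ z → toℕ (proj₁ I) ≤ z × z < suc (toℕ d)) (sym ex) (ℕ.<⇒≤ P.c<s , s≤s s≤d)
      at : w₁ · (p · x) ≡ x
      at = trans (sym (p-eq x)) (Q.fixed (subst (_< t) (sym ex) s<t))

  go : ∀ {s t} → Peel I s w w₁ → Peel I t w w₂ →
    (∀ x → toℕ x ≡ s → d Fin.< flip w₁ · x) → (∀ x → toℕ x ≡ t → d Fin.< flip w₂ · x) → w₁ ≗ₚ w₂
  go {s} {t} P Q ext₁ ext₂ with ℕ.<-cmp s t
  ... | tri< l _ _ = below P Q l ext₁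
  ... | tri≈ _ refl _ = same P Q (Peel.fixed Q) (Peel.dec' Q)
  ... | tri> _ _ l = λ x → sym (below Q P l ext₂ x)

peel-of-max : ∀ {m} {I : Interval m} {s L} (w w' : Pm m) → proj₁ I Fin.< proj₂ I → toℕ (proj₁ I) < s →
  All (λ K → s ≤ toℕ (proj₁ K)) L → Twins (s , suc (toℕ (proj₂ I))) L →
  IsMax L w' → IsMax (I ∷ L) w → Peel I s w w'
peel-of-max {I = I} {s} {L} w w' c<d c<s lb tw mx' mx with IsMax-extend (leftmost-ok c<s lb tw) w' mx'
... | v , sv , dv , mxv = record
  { c<d = c<d ; c<s = c<s ; v = v ; supp = sv ; eq = e
  ; dec = DecOn-cong (v ∘ₚ w') w (λ i → sym (e i)) dv
  ; fixed = λ {x} l → sym (isolatedˡ (All.map (λ s≤ (a , _) → ℕ.<⇒≱ (ℕ.<-≤-trans l s≤) a) lb) (Fact⇒InReach L w' (proj₁ mx') x))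
  ; dec' = IsMax-twins w' tw (Fin.toℕ<n (proj₂ I)) mx'
  }
  where
  e : w ≗ₚ v ∘ₚ w'
  e = IsMax-unique w (v ∘ₚ w') mx mxv

peel-front : ∀ {m} {I : Interval m} {s L} (w : Pm m) → Code L s → LeftOf I L → Twins (s , suc (toℕ (proj₂ I))) L →
  IsMax (I ∷ L) w → ∃ λ w' → IsMax L w' × Peel I s w w'
peel-front w C l t mx with code-max C
... | w' , mx' = w' , mx' , peel-of-max w w' (proj₁ l) (code-left C l) (code-≤ C) t mx' mx

peel-back : ∀ {m} {I : Interval m} {s L} (w : Pm m) → Code L s → LeftOf I L → Twins (s , suc (toℕ (proj₂ I))) (reverse L) →
  IsMax (L ∷ʳ I) w → ∃ λ w' → IsMax L w' × Peel I s (flip w) (flip w')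
peel-back {I = I} {L = L} w C l t mx with code-max C
... | w' , mx' = w' , mx' , peel-of-max (flip w) (flip w') (proj₁ l) (code-left C l) (All-reverse (code-≤ C)) t (IsMax-reverse L w' mx')
  (subst (λ X → IsMax X (flip w)) (reverse-∷ʳ I L) (IsMax-reverse (L ∷ʳ I) w mx))

-- One of `w` and its inverse sends `s` to the right endpoint of the leftmost interval, the other at
-- least as far. With `b` the right endpoint of an interval added further left, this supplies the
-- hypothesis of `peel-unique` and `w-c-strict`.
code-ext : ∀ {m} {L : List (Interval m)} {s b} (w : Pm m) → Code L s → IsMax L w → All (λ K → b < toℕ (proj₂ K)) L →
  ∀ x → toℕ x ≡ s → b < toℕ (w · x) × b < toℕ (flip w · x)
code-ext w nil mx a x e = contradiction (subst (_< _) e (Fin.toℕ<n x)) (ℕ.n≮n _)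
code-ext {b = b} w (front {I} C l t) mx (b< ∷ _) x e with Fin.toℕ-injective e | peel-front w C l t mx
... | refl | w' , mx' , P = ℕ.<-≤-trans b< (Peel.w-c P) , subst (λ z → b < toℕ z) (sym (flip-unique w (Peel.w-d P))) b<
code-ext {b = b} w (back {I} {L} C l _ t) mx a x e with Fin.toℕ-injective e | peel-back w C l t mx
... | refl | w' , mx' , P = subst (λ z → b < toℕ z) (sym (flip-unique (flip w) (Peel.w-d P))) b< , ℕ.<-≤-trans b< (Peel.w-c P)
  where b< = All.head (All.++⁻ʳ L a)

private
  not-id : ∀ {m} {I : Interval m} {s} {w w' : Pm m} → Peel I s w w' → ¬ (w · proj₁ I ≡ proj₁ I)
  not-id P e = ℕ.<⇒≱ (Peel.c<d P) (subst (_ Fin.≤_) e (Peel.w-c P))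

  same-c : ∀ {m} {I K : Interval m} {s t} {u w u' w' : Pm m} → Peel I s u u' → Peel K t w w' →
    (∀ {x} → u · x ≡ x → w · x ≡ x) → (∀ {x} → w · x ≡ x → u · x ≡ x) → proj₁ I ≡ proj₁ K
  same-c {I = I} {K} P Q f g with ℕ.<-cmp (toℕ (proj₁ I)) (toℕ (proj₁ K))
  ... | tri< l _ _ = contradiction (g (Peel.w-below Q l)) (not-id P)
  ... | tri≈ _ e _ = Fin.toℕ-injective e
  ... | tri> _ _ l = contradiction (f (Peel.w-below P l)) (not-id Q)

  same-I : ∀ {m} {I K : Interval m} {s t} {w u' w' : Pm m} → Peel I s w u' → Peel K t w w' → I ≡ K
  same-I {w = w} P Q = cong₂ _,_ c≡ (·-injective w (trans (Peel.w-d P) (trans c≡ (sym (Peel.w-d Q)))))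
    where c≡ = same-c P Q (λ e → e) (λ e → e)

  -- A front interval gives `w⁻¹(c) ≤ w(c)`, a back interval the strict opposite.
  front≠back : ∀ {m} {I K : Interval m} {s t} {w w₁ w₂ : Pm m} → Peel I s w w₁ → Peel K t (flip w) w₂ →
    t ≤ toℕ (proj₂ K) → (∀ x → toℕ x ≡ t → proj₂ K Fin.< w₂ · x) → ⊥
  front≠back {I = I} {K} {w = w} P Q t≤d ext with refl ← same-c P Q (flip-unique w) (flip-unique (flip w)) =
    ℕ.n≮n _ (ℕ.<-≤-trans
      (subst (proj₂ K Fin.<_) (flip-unique w (Peel.w-d P)) (Peel.w-c-strict Q t≤d ext))
      (subst (proj₂ I Fin.≤_) (flip-unique (flip w) (Peel.w-d Q)) (Peel.w-c P)))

-- Both codes are peeled in parallel: the common `w` dictates the interval (`same-I`) and the side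
-- (`front≠back`), and `peel-unique` hands one and the same smaller permutation to the recursion.
code-injective : ∀ {m} {L₁ L₂ : List (Interval m)} {s₁ s₂} (w : Pm m) → Code L₁ s₁ → Code L₂ s₂ →
  IsMax L₁ w → IsMax L₂ w → L₁ ~ L₂
code-injective w nil nil _ _ = ~-refl
code-injective w nil (front C l t) (f , _) mx₂ with peel-front w C l t mx₂
... | _ , _ , P = contradiction (f _) (not-id P)
code-injective w nil (back C l _ t) (f , _) mx₂ with peel-back w C l t mx₂
... | _ , _ , P = contradiction (flip-unique w (f _)) (not-id P)
code-injective w (front C l t) nil mx₁ (f , _) with peel-front w C l t mx₁
... | _ , _ , P = contradiction (f _) (not-id P)
code-injective w (back C l _ t) nil mx₁ (f , _) with peel-back w C l t mx₁
... | _ , _ , P = contradiction (flip-unique w (f _)) (not-id P)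
code-injective w (front C l t) (front C' l' t') mx₁ mx₂ with peel-front w C l t mx₁ | peel-front w C' l' t' mx₂
... | w₁ , m₁ , P | w₂ , m₂ , Q with refl ← same-I P Q =
  ~-cons (code-injective w₁ C C' m₁ (IsMax-cong w₂ w₁ (λ i → sym (peel-unique w w₁ w₂ P Q
    (λ x e → proj₂ (code-ext w₁ C m₁ (All.map proj₂ (proj₂ l)) x e))
    (λ x e → proj₂ (code-ext w₂ C' m₂ (All.map proj₂ (proj₂ l')) x e)) i)) m₂))
code-injective w (back C l _ t) (back C' l' _ t') mx₁ mx₂ with peel-back w C l t mx₁ | peel-back w C' l' t' mx₂
... | w₁ , m₁ , P | w₂ , m₂ , Q with refl ← same-I P Q =
  ~-∷ʳ (code-injective w₁ C C' m₁ (IsMax-cong w₂ w₁ (flip-cong (flip w₂) (flip w₁) (λ i → sym (peel-unique (flip w) (flip w₁) (flip w₂) P Q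
    (λ x e → proj₁ (code-ext w₁ C m₁ (All.map proj₂ (proj₂ l)) x e))
    (λ x e → proj₁ (code-ext w₂ C' m₂ (All.map proj₂ (proj₂ l')) x e)) i))) m₂))
code-injective w (front C l t) (back C' l' s≤ t') mx₁ mx₂ with peel-front w C l t mx₁ | peel-back w C' l' t' mx₂
... | w₁ , m₁ , P | w₂ , m₂ , Q = ⊥-elim (front≠back P Q s≤ (λ x e → proj₂ (code-ext w₂ C' m₂ (All.map proj₂ (proj₂ l')) x e)))
code-injective w (back C l s≤ t) (front C' l' t') mx₁ mx₂ with peel-back w C l t mx₁ | peel-front w C' l' t' mx₂
... | w₁ , m₁ , P | w₂ , m₂ , Q = ⊥-elim (front≠back Q P s≤ (λ x e → proj₂ (code-ext w₁ C m₁ (All.map proj₂ (proj₂ l)) x e)))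

-- Zig-zag lists are codes up to commutation

NonNest : ∀ {m} → List (Interval m) → Set
NonNest L = ∀ {a b} → (a ∷ b ∷ []) ⊆ L → ¬ NestedIn a b × ¬ NestedIn b a

ZZ : ∀ {m} → List (Interval m) → Set
ZZ L = ∀ {a b c} → (a ∷ b ∷ c ∷ []) ⊆ L → Meets a b → Meets b c →
  (proj₁ a Fin.< proj₁ b × proj₁ b Fin.< proj₁ c) ⊎ (proj₁ b Fin.< proj₁ a × proj₁ c Fin.< proj₁ b)

Proper : ∀ {m} → Interval m → Set
Proper (c , d) = c Fin.< d

data Extract {m} (f : Interval m → ℕ) (L : List (Interval m)) : Set where
  extract : ∀ L₁ I L₂ → L ≡ L₁ ++ I ∷ L₂ → All (λ K → f I ≤ f K) (L₁ ++ L₂) → Extract f L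

extract-min : ∀ {m} (f : Interval m → ℕ) I L → Extract f (I ∷ L)
extract-min f I [] = extract [] I [] refl []
extract-min f I (K ∷ L) with extract-min f K L
... | extract L₁ M L₂ e a with f I ℕ.≤? f M
...   | yes l = extract [] I (K ∷ L) refl (subst (All (λ K → f I ≤ f K)) (sym e)
          (All.++⁺ (All.map (ℕ.≤-trans l) (All.++⁻ˡ L₁ a)) (l ∷ All.map (ℕ.≤-trans l) (All.++⁻ʳ L₁ a))))
...   | no n = extract (I ∷ L₁) M L₂ (cong (I ∷_) e) (ℕ.<⇒≤ (ℕ.≰⇒> n) ∷ a)

module _ {A : Set} where

  before : ∀ {a x : A} {xs} ys → a ∈ xs → (a ∷ x ∷ []) ⊆ (xs ++ x ∷ ys)
  before ys p = ++⁺ (from∈ p) (refl ∷ minimum ys)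

  after : ∀ {b x : A} xs {ys} → b ∈ ys → (x ∷ b ∷ []) ⊆ (xs ++ x ∷ ys)
  after xs p = ++⁺ (minimum xs) (refl ∷ from∈ p)

  around : ∀ {a b x : A} {xs ys} → a ∈ xs → b ∈ ys → (a ∷ x ∷ b ∷ []) ⊆ (xs ++ x ∷ ys)
  around p q = ++⁺ (from∈ p) (refl ∷ from∈ q)

  drop-middle : ∀ (x : A) xs {ys} → (xs ++ ys) ⊆ (xs ++ x ∷ ys)
  drop-middle x xs = ++⁺ {as = xs} ⊆-refl (skip x ⊆-refl)

  ⊆-right : ∀ {P : A → Set} {a b : A} xs {ys} → (a ∷ b ∷ []) ⊆ (xs ++ ys) → All (¬_ ∘ P) xs → P a → (a ∷ b ∷ []) ⊆ ys
  ⊆-right [] p [] pa = p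
  ⊆-right (x ∷ xs) (skip _ p) (_ ∷ n) pa = ⊆-right xs p n pa
  ⊆-right (x ∷ xs) (refl ∷ p) (n ∷ _) pa = contradiction pa n

  ⊆-left : ∀ {P : A → Set} {a b : A} xs {ys} → (a ∷ b ∷ []) ⊆ (xs ++ ys) → All (¬_ ∘ P) ys → P a → P b → (a ∷ b ∷ []) ⊆ xs
  ⊆-left {P} {a} {b} xs p n pa pb = two xs p
    where
    one : ∀ zs {b} → P b → (b ∷ []) ⊆ (zs ++ _) → (b ∷ []) ⊆ zs
    one [] pb p = contradiction pb (All.head (All-resp-⊆ p n))
    one (z ∷ zs) pb (skip _ p) = skip z (one zs pb p)
    one (z ∷ zs) pb (refl ∷ p) = refl ∷ minimum zs
    two : ∀ zs → (a ∷ b ∷ []) ⊆ (zs ++ _) → (a ∷ b ∷ []) ⊆ zs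
    two [] p = contradiction pa (All.head (All-resp-⊆ p n))
    two (z ∷ zs) (skip _ p) = skip z (two zs p)
    two (z ∷ zs) (refl ∷ p) = refl ∷ one zs pb p

Near : ∀ {m} → Interval m → Interval m → Set
Near I K = proj₁ K Fin.≤ proj₂ I

-- All intervals near I contain its right endpoint; the first one in the list contains the whole of J.
near-twins : ∀ {m} {I : Interval m} {s} L → s ≤ toℕ (proj₂ I) → All (λ K → proj₂ I Fin.< proj₂ K) L →
  (∀ {a b} → (a ∷ b ∷ []) ⊆ L → Near I a → Near I b → proj₁ a Fin.≤ proj₁ b) →
  ¬ All (λ K → s < toℕ (proj₁ K)) L → Twins (s , suc (toℕ (proj₂ I))) L
near-twins [] s≤d _ _ n = contradiction [] n
near-twins {m} {I} {s} (K ∷ L) s≤d (d< ∷ dL) ord n {x} {y} {z} x∈ y∈ (k , h , r) with proj₁ K Fin.≤? proj₂ I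
... | yes near = k , hop h , r
  where
  -- Otherwise every interval would start after `s`: the near ones by `ord`, the others because they
  -- start after the right endpoint of `I`.
  cK≤s : toℕ (proj₁ K) ≤ s
  cK≤s = ℕ.≮⇒≥ λ s<cK → n (s<cK ∷ All.tabulate (λ {b} b∈ → later s<cK b∈))
    where
    later : s < toℕ (proj₁ K) → ∀ {b} → b ∈ L → s < toℕ (proj₁ b)
    later s<cK {b} b∈ with proj₁ b Fin.≤? proj₂ I
    ... | yes nb = ℕ.<-≤-trans s<cK (ord (refl ∷ from∈ b∈) near nb)
    ... | no ¬nb = ℕ.≤-<-trans s≤d (ℕ.≰⇒> ¬nb)
  J⊆K : ∀ {z : Fin m} → z ∈ʳ (s , suc (toℕ (proj₂ I))) → z ∈ᵢ K
  J⊆K (a , b) = ℕ.≤-trans cK≤s a , ℕ.<-≤-trans b (ℕ.m≤n⇒m≤1+n d<)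
  hop : Hop K x k → Hop K y k
  hop (inj₁ refl) = inj₂ (J⊆K y∈ , J⊆K x∈)
  hop (inj₂ (_ , b)) = inj₂ (J⊆K y∈ , b)
... | no far = y , inj₁ refl , near-twins {I = I} L s≤d dL (λ p → ord (skip K p)) (λ a → n (ℕ.≤-<-trans s≤d (ℕ.≰⇒> far) ∷ a)) x∈ y∈ (stay h r)
  where
  stay : Hop K x k → Reach L k z → Reach L x z
  stay (inj₁ refl) r = r
  stay (inj₂ (p , _)) r = contradiction (ℕ.≤-trans (proj₁ p) (ℕ.≤-pred (proj₂ x∈))) far

private
  meets-pair : ∀ {m} {I a b : Interval m} → proj₂ I Fin.< proj₂ a → proj₂ I Fin.< proj₂ b → Near I a → Near I b → Meets a b
  meets-pair {I = I} p q na nb = proj₂ I , na , ℕ.<⇒≤ p , nb , ℕ.<⇒≤ q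

  meets-near : ∀ {m} {I a : Interval m} → proj₁ I Fin.< proj₂ I → proj₂ I Fin.< proj₂ a → Near I a → Meets I a
  meets-near {I = I} p q na = proj₂ I , ℕ.<⇒≤ p , ℕ.≤-refl , na , ℕ.<⇒≤ q

  Meets-sym : ∀ {m} {a b : Interval m} → Meets a b → Meets b a
  Meets-sym (x , p , q , r , s) = x , r , s , p , q

-- The interval `I` with the least left endpoint cannot meet one interval before it and another
-- after it, since both start further right and the zig-zag condition wants monotone starts. So it
-- commutes to one end of the list. The number `k` bounds the recursion.
toCode : ∀ {m} k (L : List (Interval m)) → List.length L ≤ k → All Proper L → NonNest L → ZZ L →
  ∃ λ L' → ∃ λ s → Code L' s × L ~ L'
toCode {m} k [] _ _ _ _ = [] , m , nil , ~-refl
toCode {m} (suc k) (I₀ ∷ L₀) len≤′ pr′ nn′ zz′ with extract-min (toℕ ∘ proj₁) I₀ L₀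
... | extract L₁ I L₂ e lb = subst (λ X → ∃ λ L' → ∃ λ s → Code L' s × X ~ L') (sym e)
  (build (toCode k L short (All-resp-⊆ sub pr) (λ p → nn (⊆-trans p sub)) (λ p → zz (⊆-trans p sub))))
  where
  len≤ = subst (λ X → List.length X ≤ suc k) e len≤′
  pr = subst (All Proper) e pr′
  nn : NonNest (L₁ ++ I ∷ L₂)
  nn = subst (λ X → NonNest X) e (λ {_} {_} → nn′)
  zz : ZZ (L₁ ++ I ∷ L₂)
  zz = subst (λ X → ZZ X) e (λ {_} {_} {_} → zz′)
  L = L₁ ++ L₂
  sub : L ⊆ (L₁ ++ I ∷ L₂)
  sub = drop-middle I L₁
  short : List.length L ≤ k
  short = ℕ.≤-pred (subst (_≤ suc k) (trans (List.length-++ L₁) (trans (ℕ.+-suc _ _) (cong suc (sym (List.length-++ L₁))))) len≤)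
  properI : Proper I
  properI = All.head (All.++⁻ʳ L₁ pr)
  apart : ∀ {K} → proj₁ I Fin.≤ proj₁ K → ¬ NestedIn I K × ¬ NestedIn K I → proj₁ I Fin.< proj₁ K × proj₂ I Fin.< proj₂ K
  apart {K} c≤ (n₁ , n₂) = ℕ.≤∧≢⇒< c≤ (λ e → n₁ (ℕ.≤-reflexive (sym e) , ℕ.<⇒≤ d<)) , d<
    where
    d< : proj₂ I Fin.< proj₂ K
    d< = ℕ.≰⇒> (λ l → n₂ (c≤ , l))
  swap× : ∀ {A B : Set} → A × B → B × A
  swap× (a , b) = b , a
  left : LeftOf I L
  left = properI , All.++⁺
    (All.tabulate (λ K∈ → apart (All.lookup (All.++⁻ˡ L₁ lb) K∈) (swap× (nn (before L₂ K∈)))))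
    (All.tabulate (λ K∈ → apart (All.lookup (All.++⁻ʳ L₁ lb) K∈) (nn (after L₁ K∈))))
  d<₁ : ∀ {K} → K ∈ L₁ → proj₂ I Fin.< proj₂ K
  d<₁ K∈ = proj₂ (All.lookup (All.++⁻ˡ L₁ (proj₂ left)) K∈)
  d<₂ : ∀ {K} → K ∈ L₂ → proj₂ I Fin.< proj₂ K
  d<₂ K∈ = proj₂ (All.lookup (All.++⁻ʳ L₁ (proj₂ left)) K∈)
  far⇒disjoint : ∀ {X} → All (¬_ ∘ Near I) X → All (Disjoint I) X
  far⇒disjoint = All.map (λ n {x} (_ , q) (p , _) → n (ℕ.≤-trans p (ℕ.≤-pred q)))
  members : ∀ {a b : Interval m} {X} → (a ∷ b ∷ []) ⊆ X → a ∈ X × b ∈ X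
  members (skip _ p) = let a , b = members p in there a , there b
  members (refl ∷ p) = here refl , there (mem p)
    where
    mem : ∀ {b : Interval m} {X} → (b ∷ []) ⊆ X → b ∈ X
    mem (skip _ p) = there (mem p)
    mem (refl ∷ p) = here refl

  build : (∃ λ L' → ∃ λ s → Code L' s × L ~ L') → ∃ λ L' → ∃ λ s → Code L' s × (L₁ ++ I ∷ L₂) ~ L'
  build (L' , s , C , r) with any? (λ K → proj₁ K Fin.≤? proj₂ I) L₁
  ... | no none = I ∷ L' , toℕ (proj₁ I) , front C left' tw , ~-trans (~-to-front L₁ (far⇒disjoint far)) (~-cons r)
    where
    far : All (¬_ ∘ Near I) L₁
    far = All.¬Any⇒All¬ L₁ none
    left' : LeftOf I L'
    left' = properI , ~-All r (proj₂ left)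
    -- Near intervals contain the right endpoint of `I` and hence meet each other. The triple
    -- `I , a , b` starts with an ascent, so it must ascend throughout.
    ord : ∀ {a b} → (a ∷ b ∷ []) ⊆ L → Near I a → Near I b → proj₁ a Fin.≤ proj₁ b
    ord {a} {b} p na nb with ⊆-right {P = Near I} L₁ p far na
    ... | q with members q
    ...   | a∈ , b∈ with zz (++⁺ (minimum L₁) (refl ∷ q)) (meets-near {I = I} properI (d<₂ a∈) na) (meets-pair {I = I} (d<₂ a∈) (d<₂ b∈) na nb)
    ...     | inj₁ (_ , l) = ℕ.<⇒≤ l
    ...     | inj₂ (l , _) = contradiction (proj₁ (All.lookup (All.++⁻ʳ L₁ (proj₂ left)) a∈)) (ℕ.<-asym l)
    tw : Twins (s , suc (toℕ (proj₂ I))) L'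
    tw x∈ y∈ t = ~-Reach r (near-twins {I = I} L s≤d (All.map proj₂ (proj₂ left)) ord
      (λ a → code-attains C (ℕ.≤-<-trans s≤d (Fin.toℕ<n (proj₂ I))) (~-All r a)) x∈ y∈ (~-Reach (~-sym r) t))
      where
      s≤d : s ≤ toℕ (proj₂ I)
      s≤d = ℕ.≤-trans (proj₁ x∈) (ℕ.≤-pred (proj₂ x∈))
  ... | yes some with find some
  ...   | K₁ , K₁∈ , near₁ = L' ∷ʳ I , toℕ (proj₁ I) , back C left' s≤d₁ tw , ~-trans (~-to-back L₁ (far⇒disjoint far)) (~-∷ʳ r)
    where
    meets₁ : Meets K₁ I
    meets₁ = Meets-sym {a = I} {K₁} (meets-near {I = I} properI (d<₁ K₁∈) near₁)
    far : All (¬_ ∘ Near I) L₂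
    far = All.tabulate λ K∈ near → [ (λ (l , _) → ℕ.<-asym l (proj₁ (All.lookup (All.++⁻ˡ L₁ (proj₂ left)) K₁∈)))
                                  , (λ (_ , l) → ℕ.<-asym l (proj₁ (All.lookup (All.++⁻ʳ L₁ (proj₂ left)) K∈))) ]′
                                  (zz (around K₁∈ K∈) meets₁ (meets-near {I = I} properI (d<₂ K∈) near))
    left' : LeftOf I L'
    left' = properI , ~-All r (proj₂ left)
    s≤d₁ : s ≤ toℕ (proj₂ I)
    s≤d₁ = ℕ.≤-trans (All.lookup (All.++⁻ˡ L₁ (~-All (~-sym r) (code-≤ C))) K₁∈) near₁
    ord : ∀ {a b} → (a ∷ b ∷ []) ⊆ reverse L → Near I a → Near I b → proj₁ a Fin.≤ proj₁ b
    ord {a} {b} p na nb with ⊆-left {P = Near I} L₁ (subst ((b ∷ a ∷ []) ⊆_) (List.reverse-involutive L) (reverse⁺ p)) far nb na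
    ... | q with members q
    ...   | b∈ , a∈ with zz (++⁺ q (refl {x = I} ∷ minimum L₂)) (meets-pair {I = I} (d<₁ b∈) (d<₁ a∈) nb na)
                         (Meets-sym {a = I} {a} (meets-near {I = I} properI (d<₁ a∈) na))
    ...     | inj₁ (_ , l) = contradiction (proj₁ (All.lookup (All.++⁻ˡ L₁ (proj₂ left)) a∈)) (ℕ.<-asym l)
    ...     | inj₂ (l , _) = ℕ.<⇒≤ l
    toRev : ∀ {X Y : List (Interval m)} → X ~ Y → ∀ {x z} → Reach (reverse X) x z → Reach (reverse Y) x z
    toRev {X} {Y} r {x} {z} t = Reach-reverse Y (~-Reach r (subst (λ Z → Reach Z z x) (List.reverse-involutive X) (Reach-reverse (reverse X) t)))
    tw : Twins (s , suc (toℕ (proj₂ I))) (reverse L')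
    tw x∈ y∈ t = toRev r (near-twins {I = I} (reverse L) s≤d₁ (All-reverse (All.map proj₂ (proj₂ left))) ord
      (λ a → code-attains C (ℕ.≤-<-trans s≤d₁ (Fin.toℕ<n (proj₂ I))) (~-All r (subst (All _) (List.reverse-involutive L) (All-reverse a)))) x∈ y∈ (toRev (~-sym r) t))

-- Conditions on positions and conditions on sublists

module _ {A : Set} where

  ⊆⇒lookup₁ : ∀ {a : A} {L} → (a ∷ []) ⊆ L → ∃ λ i → List.lookup L i ≡ a
  ⊆⇒lookup₁ (skip _ p) = let i , e = ⊆⇒lookup₁ p in suc i , e
  ⊆⇒lookup₁ (refl ∷ _) = zero , refl

  ⊆⇒lookup₂ : ∀ {a b : A} {L} → (a ∷ b ∷ []) ⊆ L → ∃ λ i → ∃ λ j → i Fin.< j × List.lookup L i ≡ a × List.lookup L j ≡ b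
  ⊆⇒lookup₂ (skip _ p) = let i , j , l , e , f = ⊆⇒lookup₂ p in suc i , suc j , s≤s l , e , f
  ⊆⇒lookup₂ (refl ∷ p) = let j , f = ⊆⇒lookup₁ p in zero , suc j , s≤s z≤n , refl , f

  ⊆⇒lookup₃ : ∀ {a b c : A} {L} → (a ∷ b ∷ c ∷ []) ⊆ L → ∃ λ i → ∃ λ j → ∃ λ k → i Fin.< j × j Fin.< k ×
    List.lookup L i ≡ a × List.lookup L j ≡ b × List.lookup L k ≡ c
  ⊆⇒lookup₃ (skip _ p) = let i , j , k , l , l' , e , f , g = ⊆⇒lookup₃ p in suc i , suc j , suc k , s≤s l , s≤s l' , e , f , g
  ⊆⇒lookup₃ (refl ∷ p) = let j , k , l , f , g = ⊆⇒lookup₂ p in zero , suc j , suc k , s≤s z≤n , s≤s l , refl , f , g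

  lookup⇒⊆₁ : ∀ (L : List A) i → (List.lookup L i ∷ []) ⊆ L
  lookup⇒⊆₁ (x ∷ L) zero = refl ∷ minimum L
  lookup⇒⊆₁ (x ∷ L) (suc i) = skip x (lookup⇒⊆₁ L i)

  lookup⇒⊆₂ : ∀ (L : List A) {i j} → i Fin.< j → (List.lookup L i ∷ List.lookup L j ∷ []) ⊆ L
  lookup⇒⊆₂ (x ∷ L) {zero} {suc j} _ = refl ∷ lookup⇒⊆₁ L j
  lookup⇒⊆₂ (x ∷ L) {suc i} {suc j} (s≤s l) = skip x (lookup⇒⊆₂ L l)

  lookup⇒⊆₃ : ∀ (L : List A) {i j k} → i Fin.< j → j Fin.< k → (List.lookup L i ∷ List.lookup L j ∷ List.lookup L k ∷ []) ⊆ L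
  lookup⇒⊆₃ (x ∷ L) {zero} {suc j} {suc k} _ (s≤s l) = refl ∷ lookup⇒⊆₂ L l
  lookup⇒⊆₃ (x ∷ L) {suc i} {suc j} {suc k} (s≤s l) (s≤s l') = skip x (lookup⇒⊆₃ L l l')

module _ {m : ℕ} {L : List (Interval m)} where

  toNonNest : DistinctNonNesting L → NonNest L
  toNonNest h p with ⊆⇒lookup₂ p
  ... | i , j , l , refl , refl = proj₂ (h i j ne) , proj₂ (h j i (ne ∘ sym))
    where
    ne : i ≢ j
    ne e = ℕ.<⇒≢ l (cong toℕ e)

  fromNonNest : NonNest L → DistinctNonNesting L
  fromNonNest h i j ne = (λ e → not-nested (subst (NestedIn (List.lookup L i)) e (ℕ.≤-refl , ℕ.≤-refl))) , not-nested
    where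
    not-nested : ¬ NestedIn (List.lookup L i) (List.lookup L j)
    not-nested with ℕ.<-cmp (toℕ i) (toℕ j)
    ... | tri< l _ _ = proj₁ (h (lookup⇒⊆₂ L l))
    ... | tri≈ _ e _ = contradiction (Fin.toℕ-injective e) ne
    ... | tri> _ _ l = proj₂ (h (lookup⇒⊆₂ L l))

  toZZ : ZigZag L → ZZ L
  toZZ h p with ⊆⇒lookup₃ p
  ... | i , j , k , l , l' , refl , refl , refl = h i j k l l'

  fromZZ : ZZ L → ZigZag L
  fromZZ h i j k l l' = h (lookup⇒⊆₃ L l l')

NonNest-⊆ : ∀ {m} {L L' : List (Interval m)} → L' ⊆ L → NonNest L → NonNest L'
NonNest-⊆ s h p = h (⊆-trans p s)

properOf : ∀ {m} {L : List (Interval m)} → All ValidI L → All Proper (filter nonSingle? L)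
properOf {L = L} v = All.zipWith (λ {(l , ne) → ℕ.≤∧≢⇒< l (ne ∘ Fin.toℕ-injective)})
  (All-resp-⊆ (filter-⊆ nonSingle? L) v , All.all-filter nonSingle? L)

proper⇒nonSingle : ∀ {m} {L : List (Interval m)} → All Proper L → filter nonSingle? L ≡ L
proper⇒nonSingle pr = List.filter-all nonSingle? (All.map (λ l e → ℕ.<⇒≢ l (cong toℕ e)) pr)

InZA⇒Code : ∀ {m} (N : Network m) → InZA N → ∃ λ L → ∃ λ s → Code L s × N ≅ netOf L
InZA⇒Code {m} N (inj₁ i) = [] , m , nil , i
InZA⇒Code N (inj₂ (L , v , nn , zz , i)) with toCode (List.length L⁰) L⁰ ℕ.≤-refl (properOf v)
    (NonNest-⊆ (filter-⊆ nonSingle? L) (toNonNest nn)) (λ p → toZZ zz (⊆-trans p (filter-⊆ nonSingle? L)))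
  where L⁰ = filter nonSingle? L
... | L' , s , C , r = L' , s , C , ≅-trans N (prodA L) (netOf L') i (≅-trans (prodA L) (netOf (filter nonSingle? L)) (netOf L') (prodA≅netOf L) (~⇒≅ r))

-- Symmetric permutations

module BC (n : ℕ) where

  m : ℕ
  m = n + n

  Pos Neg : Fin m → Set
  Pos x = n ≤ toℕ x
  Neg x = toℕ x < n

  bar-sum : ∀ x → toℕ (bar n x) + suc (toℕ x) ≡ n + n
  bar-sum x = trans (cong (_+ suc (toℕ x)) (Fin.opposite-prop x)) (ℕ.m∸n+n≡m (Fin.toℕ<n x))

  bar-< : ∀ {x y} → x Fin.< y → bar n y Fin.< bar n x
  bar-< {x} {y} l = ℕ.+-cancelʳ-< (suc (toℕ x)) _ _
    (subst (toℕ (bar n y) + suc (toℕ x) <_) (trans (bar-sum y) (sym (bar-sum x))) (ℕ.+-monoʳ-< (toℕ (bar n y)) (s≤s l)))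

  bar-≤ : ∀ {x y} → x Fin.≤ y → bar n y Fin.≤ bar n x
  bar-≤ {x} {y} l with ℕ.m≤n⇒m<n∨m≡n l
  ... | inj₁ l' = ℕ.<⇒≤ (bar-< l')
  ... | inj₂ e  = ℕ.≤-reflexive (cong (λ z → toℕ (bar n z)) (sym (Fin.toℕ-injective e)))

  bar-<′ : ∀ {x y} → x Fin.< bar n y → y Fin.< bar n x
  bar-<′ {x} {y} l = subst (Fin._< bar n x) (bar-involutive n y) (bar-< l)

  bar-≤ʳ : ∀ {x y} → bar n x Fin.≤ y → bar n y Fin.≤ x
  bar-≤ʳ {x} {y} l = subst (bar n y Fin.≤_) (bar-involutive n x) (bar-≤ l)

  bar-≤ˡ : ∀ {x y} → x Fin.≤ bar n y → y Fin.≤ bar n x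
  bar-≤ˡ {x} {y} l = subst (Fin._≤ bar n x) (bar-involutive n y) (bar-≤ l)

  Pos-bar : ∀ {x} → Pos x → Neg (bar n x)
  Pos-bar {x} p = ℕ.+-cancelʳ-< (suc (toℕ x)) _ _ (subst (_< n + suc (toℕ x)) (sym (bar-sum x)) (ℕ.+-monoʳ-< n (s≤s p)))

  Neg-bar : ∀ {x} → Neg x → Pos (bar n x)
  Neg-bar {x} p = ℕ.+-cancelʳ-≤ (suc (toℕ x)) _ _ (subst (n + suc (toℕ x) ≤_) (sym (bar-sum x)) (ℕ.+-monoʳ-≤ n p))

  Neg⇒¬Pos : ∀ {x} → Neg x → ¬ Pos x
  Neg⇒¬Pos = ℕ.<⇒≱

  pos? : ∀ x → Pos x ⊎ Neg x
  pos? x with n ℕ.≤? toℕ x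
  ... | yes p = inj₁ p
  ... | no n  = inj₂ (ℕ.≰⇒> n)

  Neg<Pos : ∀ {x y} → Neg x → Pos y → x Fin.< y
  Neg<Pos = ℕ.<-≤-trans

  mirror : Interval m → Interval m
  mirror (c , d) = bar n d , bar n c

  ∈-mirror : ∀ {I x} → x ∈ᵢ I → bar n x ∈ᵢ mirror I
  ∈-mirror (p , s≤s q) = bar-≤ q , s≤s (bar-≤ p)

  ∈-mirror⁻ : ∀ {I x} → x ∈ᵢ mirror I → bar n x ∈ᵢ I
  ∈-mirror⁻ (p , s≤s q) = bar-≤ˡ q , s≤s (bar-≤ʳ p)

  conj : Pm m → Pm m
  conj v = Perm.reverse ∘ₚ (v ∘ₚ Perm.reverse)

  Supp-conj : ∀ {I} v → Supp (rg I) v → Supp (rg (mirror I)) (conj v)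
  Supp-conj {I} v s x n∉ = trans (cong (bar n) (s (bar n x) (λ p → n∉ (subst (_∈ᵢ mirror I) (bar-involutive n x) (∈-mirror p))))) (bar-involutive n x)

  Supp-comm : ∀ {r r'} (v v' : Pm m) → Supp r v → Supp r' v' → (∀ {x : Fin m} → x ∈ʳ r → x ∈ʳ r' → ⊥) → ∀ x → v' · (v · x) ≡ v · (v' · x)
  Supp-comm {r} {r'} v v' s s' dis x with x ∈? r | x ∈? r'
  ... | yes p | _ = trans (s' (v · x) (dis (Supp-∈ r v s p))) (cong (v ·_) (sym (s' x (dis p))))
  ... | no p | yes q = trans (cong (v' ·_) (s x p)) (sym (s (v' · x) (λ t → dis t (Supp-∈ r' v' s' q))))
  ... | no p | no q = trans (cong (v' ·_) (s x p)) (trans (s' x q) (sym (trans (cong (v ·_) (s' x q)) (s x p))))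

  -- spec₁ amounts to avoiding 1 2̄, 2̄ 1, 2̄ 1̄ (with |w q| < |w p| written as w p < w q < -w p),
  -- and spec₂, given spec₁, to avoiding 312 and 3 1̄ 2.
  record Special (w : Pm m) : Set where
    field
      symm  : ∀ x → w · bar n x ≡ bar n (w · x)
      spec₁ : ∀ {p q} → Pos p → Pos q → Neg (w · p) → w · p Fin.< w · q → w · q Fin.< bar n (w · p) → Neg (w · q) × q Fin.< p
      spec₂ : ∀ {p q r} → Pos p → p Fin.< q → q Fin.< r → Pos (w · r) → w · r Fin.< w · p → w · q Fin.< w · r → ⊥

  Special-id : Special Perm.id
  Special-id = record
    { symm  = λ _ → refl
    ; spec₁ = λ p q ng → contradiction p (Neg⇒¬Pos ng)
    ; spec₂ = λ p l l' _ l'' → contradiction l'' (ℕ.<-asym (ℕ.<-trans l l'))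
    }

  Pos⇒∉mirror : ∀ {c d x} → Pos c → Pos x → ¬ x ∈ᵢ mirror (c , d)
  Pos⇒∉mirror {c} pc px (_ , q) = ℕ.<⇒≱ (Pos-bar pc) (ℕ.≤-trans px (ℕ.≤-pred q))

  mirror-disjoint : ∀ {c d} → Pos c → ∀ {x : Fin m} → x ∈ᵢ (c , d) → x ∈ᵢ mirror (c , d) → ⊥
  mirror-disjoint pc (p , _) = Pos⇒∉mirror pc (ℕ.≤-trans pc p)

  sym-rearrange : ∀ {c d} w v → Pos c → Supp (rg (c , d)) v → (∀ x → w · bar n x ≡ bar n (w · x)) →
    ∀ x → (v ∘ₚ (conj v ∘ₚ w)) · bar n x ≡ bar n ((v ∘ₚ (conj v ∘ₚ w)) · x)
  sym-rearrange {c} {d} w v pc s sy x = begin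
    w · (conj v · (v · bar n x))                ≡⟨ cong (w ·_) (Supp-comm v (conj v) s (Supp-conj {c , d} v s) (mirror-disjoint pc) (bar n x)) ⟩
    w · (v · (conj v · bar n x))                ≡⟨ cong (λ z → w · (v · bar n (v · z))) (bar-involutive n x) ⟩
    w · (v · bar n (v · x))                     ≡⟨ cong (w ·_) (bar-involutive n _) ⟨
    w · (bar n (bar n (v · bar n (v · x))))     ≡⟨ sy _ ⟩
    bar n (w · (conj v · (v · x)))              ∎
    where open ≡-Reasoning

  module _ {c d : Fin m} (pc : Pos c) (w v : Pm m) (s : Supp (rg (c , d)) v) where

    v-Pos : ∀ {x} → Pos x → Pos (v · x)
    v-Pos {x} px with x ∈? rg (c , d)
    ... | yes p = ℕ.≤-trans pc (proj₁ (Supp-∈ (rg (c , d)) v s p))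
    ... | no p = subst Pos (sym (s x p)) px

    on-Pos : ∀ {x} → Pos x → (v ∘ₚ (conj v ∘ₚ w)) · x ≡ w · (v · x)
    on-Pos px = cong (w ·_) (Supp-conj {c , d} v s _ (Pos⇒∉mirror pc (v-Pos px)))

    -- With t = suc d this sorts w on [c,d]; with smaller t it undoes the last step of a construction of w.
    Special-rearrange : Special w → ∀ t → t ≤ suc (toℕ d) → DecOn (toℕ c , t) (v ∘ₚ (conj v ∘ₚ w)) →
      (∀ x → t ≤ toℕ x → (v ∘ₚ (conj v ∘ₚ w)) · x ≡ x) → (n ≤ t) → Special (v ∘ₚ (conj v ∘ₚ w))
    Special-rearrange S t t≤ dec fx n≤t = record
      { symm  = sym-rearrange w v pc s S.symm
      ; spec₁ = s₁
      ; spec₂ = s₂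
      }
      where
      module S = Special S
      u = v ∘ₚ (conj v ∘ₚ w)
      I = c , d
      small : ∀ {x} → Neg (u · x) → toℕ x < t
      small {x} ng = ℕ.≰⇒> (λ t≤x → Neg⇒¬Pos ng (subst Pos (sym (fx x t≤x)) (ℕ.≤-trans n≤t t≤x)))
      s₁ : ∀ {p q} → Pos p → Pos q → Neg (u · p) → u · p Fin.< u · q → u · q Fin.< bar n (u · p) → Neg (u · q) × q Fin.< p
      s₁ {p} {q} pp pq ng l l' with S.spec₁ (v-Pos pp) (v-Pos pq) (subst Neg ep ng) (subst₂ Fin._<_ ep eq l) (subst₂ (λ a b → a Fin.< bar n b) eq ep l')
        where
        ep = on-Pos pp
        eq = on-Pos pq
      ... | ng' , vq<vp = ngq , order
        where
        ngq : Neg (u · q)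
        ngq = subst Neg (sym (on-Pos pq)) ng'
        order : q Fin.< p
        order with both? (rg I) q p
        ... | no nb = Supp-<⁻ (rg I) v s nb vq<vp
        ... | yes (a , b) = DecOn-⁻ u dec (proj₁ a , small ngq) (proj₁ b , small ng) l
      s₂ : ∀ {p q r} → Pos p → p Fin.< q → q Fin.< r → Pos (u · r) → u · r Fin.< u · p → u · q Fin.< u · r → ⊥
      s₂ {p} {q} {r} pp p<q q<r Pr r<p q<r' with t ℕ.≤? toℕ r
      -- Here `r` is a fixed point, so the larger value `u · p` is at least `t` and is a fixed point
      -- as well. Then `u · p` is `p` itself, and `r < p`.
      ... | yes t≤r = ℕ.<-asym (ℕ.<-trans p<q q<r) (subst₂ Fin._<_ (fx r t≤r) up≡p r<p)
        where
        up≡p : u · p ≡ p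
        up≡p = ·-injective u (fx (u · p) (ℕ.≤-trans t≤r (ℕ.<⇒≤ (subst (Fin._< u · p) (fx r t≤r) r<p))))
      ... | no t≰r with both? (rg I) q r
      ...   | yes (a , b) = ℕ.<-asym q<r' (dec (proj₁ a , ℕ.<-trans q<r (ℕ.≰⇒> t≰r)) (proj₁ b , ℕ.≰⇒> t≰r) q<r)
      ...   | no nb = S.spec₂ (v-Pos pp) (Supp-< (rg I) v s nb' p<q) (Supp-< (rg I) v s nb q<r)
                (subst Pos (on-Pos pr) Pr) (subst₂ Fin._<_ (on-Pos pr) (on-Pos pp) r<p) (subst₂ Fin._<_ (on-Pos pq) (on-Pos pr) q<r')
        where
        pq = ℕ.≤-trans pp (ℕ.<⇒≤ p<q)
        pr = ℕ.≤-trans pq (ℕ.<⇒≤ q<r)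
        -- If `q` were in `I`, so would be `r`, because `c ≤ q < r < t ≤ d + 1`. Hence `v` keeps the
        -- order of all three positions.
        nb' : ¬ (p ∈ᵢ I × q ∈ᵢ I)
        nb' (a , b) = nb (b , (ℕ.≤-trans (proj₁ b) (ℕ.<⇒≤ q<r) , ℕ.<-≤-trans (ℕ.≰⇒> t≰r) t≤))

  -- Normal form of descending lists, and their maximal permutations

  data Desc : List (Interval m) → Set where
    nil    : Desc []
    centre : ∀ {a} → Pos a → Desc ((bar n a , a) ∷ [])
    -- Both endpoints descend strictly along the whole list, whether or not the intervals meet. As
    -- `centre` has no tail, a central interval comes last.
    pos    : ∀ {c d S} → Pos c → c Fin.< d → All (λ K → proj₁ K Fin.< c × proj₂ K Fin.< d) S → Desc S → Desc ((c , d) ∷ S)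

  expand-pos : ∀ {c d S} → Pos c → c Fin.< d → expand n ((c , d) ∷ S) ≡ (c , d) ∷ mirror (c , d) ∷ expand n S
  expand-pos {c} {d} pc l with c Fin.≟ bar n d
  ... | yes e = contradiction (subst Pos e pc) (Neg⇒¬Pos (Pos-bar (ℕ.≤-trans pc (ℕ.<⇒≤ l))))
  ... | no _ = refl

  expand-centre : ∀ {a} → expand n ((bar n a , a) ∷ []) ≡ (bar n a , a) ∷ []
  expand-centre {a} with bar n a Fin.≟ bar n a
  ... | yes _ = refl
  ... | no ne = contradiction refl ne

  Within : Fin m → Interval m → Set
  Within D K = bar n D Fin.≤ proj₁ K × proj₂ K Fin.≤ D

  Desc-within : ∀ {S D} → Desc S → Pos D → All (λ K → proj₂ K Fin.≤ D) S → All (Within D) (expand n S)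
  Desc-within nil pD _ = []
  Desc-within (centre {a} pa) pD (l ∷ _) = subst (All (Within _)) (sym expand-centre) ((bar-≤ l , l) ∷ [])
  Desc-within {D = D} (pos {c} {d} {S} pc c<d _ S') pD (l ∷ a) = subst (All (Within _)) (sym (expand-pos {S = S} pc c<d))
    ((ℕ.<⇒≤ (Neg<Pos (Pos-bar pD) pc) , l) ∷ (bar-≤ l , ℕ.<⇒≤ (Neg<Pos (Pos-bar pc) pD)) ∷ Desc-within S' pD a)

  avoid-above : ∀ {D x L} → D Fin.< x → All (Within D) L → Avoiding x L
  avoid-above l = All.map (λ (_ , k) (_ , q) → ℕ.<⇒≱ l (ℕ.≤-trans (ℕ.≤-pred q) k))

  avoid-below : ∀ {D x L} → x Fin.< bar n D → All (Within D) L → Avoiding x L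
  avoid-below l = All.map (λ (k , _) (p , _) → ℕ.<⇒≱ l (ℕ.≤-trans k p))

  twins-first : ∀ {J} {K : Interval m} {L} → (∀ {x : Fin m} → x ∈ʳ J → x ∈ᵢ K) → Twins J (K ∷ L)
  twins-first sub x∈ y∈ (k , inj₁ refl , r) = k , inj₂ (sub y∈ , sub x∈) , r
  twins-first sub x∈ y∈ (k , inj₂ (_ , q) , r) = k , inj₂ (sub y∈ , q) , r

  twins-skip : ∀ {J} {K : Interval m} {L} → (∀ {x : Fin m} → x ∈ʳ J → ¬ x ∈ᵢ K) → Twins J L → Twins J (K ∷ L)
  twins-skip ne tw x∈ y∈ (k , inj₁ refl , r) = _ , inj₁ refl , tw x∈ y∈ r
  twins-skip ne tw x∈ y∈ (k , inj₂ (p , _) , r) = contradiction p (ne x∈)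

  -- Let `D` be the right endpoint of the head of `S`, the largest label in its intervals. Of [c,d]
  -- only the strands from `c` to `D` can be touched, and the head contains them all, which makes
  -- them twins. On the mirror side the mirror of the head does the same, or the head itself if it
  -- is central.
  Desc-front : ∀ {c d S} → Pos c → c Fin.< d → All (λ K → proj₁ K Fin.< c × proj₂ K Fin.< d) S → Desc S →
    (∃ λ J' → FrontOK (mirror (c , d)) J' (expand n S)) × (∃ λ J → FrontOK (c , d) J (mirror (c , d) ∷ expand n S))
  Desc-front {c} {d} pc c<d a nil =
    ((0 , 0) , record { J⊆I = λ () ; bound = z≤n ; avoid = λ _ _ → [] ; twins = λ () }) ,
    ((0 , 0) , record { J⊆I = λ () ; bound = z≤n ; avoid = λ p _ → mirror-disjoint {c} {d} pc p ∷ [] ; twins = λ () })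
  Desc-front {c} {d} {S} pc c<d a S' = go S' a
    where
    module _ {K : Interval m} {T} (dK : Desc (K ∷ T)) (a : All (λ K → proj₁ K Fin.< c × proj₂ K Fin.< d) (K ∷ T))
             (pD : Pos (proj₂ K)) (top : All (λ X → proj₂ X Fin.≤ proj₂ K) (K ∷ T)) where
      D = proj₂ K
      D<d = proj₂ (All.head a)
      J J' : Region
      J = toℕ c , suc (toℕ D)
      J' = rg (bar n D , bar n c)
      within = Desc-within dK pD top
      J∈I : ∀ {x : Fin m} → x ∈ʳ J → x ∈ᵢ (c , d)
      J∈I (p , q) = p , ℕ.<-trans q (s≤s D<d)
      J'∈I : ∀ {x : Fin m} → x ∈ʳ J' → x ∈ᵢ mirror (c , d)
      J'∈I (p , q) = ℕ.≤-trans (ℕ.<⇒≤ (bar-< D<d)) p , q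
      result : Twins J' (expand n (K ∷ T)) → Twins J (expand n (K ∷ T)) →
        (∃ λ J' → FrontOK (mirror (c , d)) J' (expand n (K ∷ T))) × (∃ λ J → FrontOK (c , d) J (mirror (c , d) ∷ expand n (K ∷ T)))
      result t' t =
        (J' , record { J⊆I = J'∈I ; bound = Fin.toℕ<n _ ; twins = t'
                     ; avoid = λ (p , q) no → avoid-below (ℕ.≰⇒> (λ l → no (l , q))) within }) ,
        (J , record { J⊆I = J∈I ; bound = Fin.toℕ<n D ; twins = twins-skip (λ p → mirror-disjoint {c} {d} pc (J∈I p)) t
                    ; avoid = λ (p , q) no → mirror-disjoint {c} {d} pc (p , q) ∷ avoid-above (ℕ.≰⇒> (λ l → no (p , s≤s l))) within })
    go : ∀ {S} → Desc S → All (λ K → proj₁ K Fin.< c × proj₂ K Fin.< d) S →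
      (∃ λ J' → FrontOK (mirror (c , d)) J' (expand n S)) × (∃ λ J → FrontOK (c , d) J (mirror (c , d) ∷ expand n S))
    go nil a = Desc-front pc c<d a nil
    go dK@(centre {e} pe) a@((ba<c , _) ∷ _) = result dK a pe (ℕ.≤-refl ∷ [])
      (subst (Twins _) (sym expand-centre) (twins-first (λ (p , q) → p , ℕ.<-trans q (s≤s (subst (bar n c Fin.<_) (bar-involutive n e) (bar-< ba<c))))))
      (subst (Twins _) (sym expand-centre) (twins-first (λ (p , q) → ℕ.≤-trans (ℕ.<⇒≤ ba<c) p , q)))
    go dK@(pos {c'} {d'} {T} pc' c'<d' b _) a@((c'<c , _) ∷ _) = result dK a (ℕ.≤-trans pc' (ℕ.<⇒≤ c'<d')) (ℕ.≤-refl ∷ All.map (ℕ.<⇒≤ ∘ proj₂) b)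
      (subst (Twins _) (sym (expand-pos {S = T} pc' c'<d')) (twins-skip
        (λ (_ , q) (p , _) → ℕ.<⇒≱ (Pos-bar pc) (ℕ.≤-trans pc' (ℕ.≤-trans p (ℕ.≤-pred q))))
        (twins-first (λ (p , q) → p , ℕ.<-trans q (s≤s (bar-< c'<c))))))
      (subst (Twins _) (sym (expand-pos {S = T} pc' c'<d')) (twins-first (λ (p , q) → ℕ.≤-trans (ℕ.<⇒≤ c'<c) p , q)))

  IsMax-above : ∀ {S D w} → Desc S → Pos D → All (λ K → proj₂ K Fin.≤ D) S → IsMax (expand n S) w → ∀ {x} → D Fin.< x → w · x ≡ x
  IsMax-above {S} {w = w} dS pD a (f , _) {x} l = sym (isolatedˡ (avoid-above l (Desc-within dS pD a)) (Fact⇒InReach (expand n S) w f x))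

  DecOn-conj : ∀ {I} w v → (∀ x → w · bar n x ≡ bar n (w · x)) → DecOn (rg I) (v ∘ₚ w) → DecOn (rg (mirror I)) (conj v ∘ₚ w)
  DecOn-conj {I} w v sy d {i} {j} p q l = subst₂ Fin._<_ (sym (sy _)) (sym (sy _)) (bar-< (d (∈-mirror⁻ q) (∈-mirror⁻ p) (bar-< l)))

  -- Two extensions: the mirror interval is added first, rearranged by `conj v`, which is decreasing
  -- there by the symmetry of `w`; then [c,d] is added, rearranged by `v`.
  IsMax-pos : ∀ {c d S} w v → Pos c → c Fin.< d → All (λ K → proj₁ K Fin.< c × proj₂ K Fin.< d) S → Desc S →
    IsMax (expand n S) w → (∀ x → w · bar n x ≡ bar n (w · x)) → Supp (rg (c , d)) v → DecOn (rg (c , d)) (v ∘ₚ w) →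
    IsMax (expand n ((c , d) ∷ S)) (v ∘ₚ (conj v ∘ₚ w))
  IsMax-pos {c} {d} {S} w v pc c<d a dS mx sy s dec with Desc-front pc c<d a dS
  ... | (_ , ok') , (_ , ok) = subst (λ X → IsMax X (v ∘ₚ (conj v ∘ₚ w))) (sym (expand-pos {S = S} pc c<d))
    (IsMax-step ok (conj v ∘ₚ w) v (IsMax-step ok' w (conj v) mx (Supp-conj {c , d} v s) (DecOn-conj {c , d} w v sy dec)) s
      (λ {i} {j} p q l → subst₂ Fin._<_ (sym (on-Pos pc w v s (ℕ.≤-trans pc (proj₁ q)))) (sym (on-Pos pc w v s (ℕ.≤-trans pc (proj₁ p)))) (dec p q l)))

  IsMax-centre : ∀ {a} w → Supp (rg (bar n a , a)) w → DecOn (rg (bar n a , a)) w → IsMax (expand n ((bar n a , a) ∷ [])) w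
  IsMax-centre {a} w s d = subst (λ X → IsMax X w) (sym expand-centre)
    (IsMax-cong (w ∘ₚ Perm.id) w (λ _ → refl)
      (IsMax-step {J = 0 , 0} (record { J⊆I = λ () ; bound = z≤n ; avoid = λ _ _ → [] ; twins = λ () }) Perm.id w IsMax-[] s d))

  -- The conjugate of `w` is decreasing on the same self-mirrored interval, so uniqueness makes `w`
  -- symmetric. For positive `x` up to `a`, decrease from `x̄` to `x` then says that `w(x)` lies
  -- below its own negative, hence is negative.
  Special-centre : ∀ {a} w → Pos a → Supp (rg (bar n a , a)) w → DecOn (rg (bar n a , a)) w → Special w
  Special-centre {a} w pa s dec = record { symm = sy ; spec₁ = s₁ ; spec₂ = s₂ }
    where
    I = bar n a , a
    mI : ∀ {x : Fin m} → x ∈ᵢ mirror I → x ∈ᵢ I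
    mI {x} (p , q) = p , subst (λ z → toℕ x < suc (toℕ z)) (bar-involutive n a) q
    mI⁻ : ∀ {x : Fin m} → x ∈ᵢ I → x ∈ᵢ mirror I
    mI⁻ {x} (p , q) = p , subst (λ z → toℕ x < suc (toℕ z)) (sym (bar-involutive n a)) q
    p = conj w ∘ₚ flip w
    p-id : ∀ x → p · x ≡ x
    p-id = DecOn-unique (rg I) w p (Supp-∘ (conj w) (flip w) (Supp-⊆ (conj w) mI (Supp-conj {I} w s)) (Supp-flip w s)) dec
      (λ {i} {j} a b l → subst₂ Fin._<_ (sym (Perm.inverseʳ w)) (sym (Perm.inverseʳ w)) (DecOn-conj {I} Perm.id w (λ _ → refl) dec (mI⁻ a) (mI⁻ b) l))
    conj≡ : ∀ x → conj w · x ≡ w · x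
    conj≡ x = trans (sym (Perm.inverseʳ w)) (cong (w ·_) (p-id x))
    sy : ∀ x → w · bar n x ≡ bar n (w · x)
    sy x = trans (sym (conj≡ (bar n x))) (cong (λ z → bar n (w · z)) (bar-involutive n x))
    in-I : ∀ {x} → Pos x → x Fin.≤ a → x ∈ᵢ I
    in-I px l = ℕ.<⇒≤ (Neg<Pos (Pos-bar pa) px) , s≤s l
    out : ∀ {x} → a Fin.< x → w · x ≡ x
    out l = s _ (λ (_ , q) → ℕ.<⇒≱ l (ℕ.≤-pred q))
    negative : ∀ {x} → Pos x → x Fin.≤ a → Neg (w · x)
    negative {x} px l with pos? (w · x)
    ... | inj₂ ng = ng
    ... | inj₁ p = contradiction (subst (w · x Fin.<_) (sy x)
          (dec (mI (∈-mirror (in-I px l))) (in-I px l) (Neg<Pos (Pos-bar px) px)))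
          (ℕ.<-asym (Neg<Pos (Pos-bar p) p))
    s₁ : ∀ {p q} → Pos p → Pos q → Neg (w · p) → w · p Fin.< w · q → w · q Fin.< bar n (w · p) → Neg (w · q) × q Fin.< p
    s₁ {p} {q} pp pq ng l l' with toℕ p ℕ.≤? toℕ a | toℕ q ℕ.≤? toℕ a
    ... | no n≤ | _ = contradiction (subst Pos (sym (out (ℕ.≰⇒> n≤))) pp) (Neg⇒¬Pos ng)
    ... | yes p≤ | yes q≤ = negative pq q≤ , DecOn-⁻ w dec (in-I pq q≤) (in-I pp p≤) l
    ... | yes p≤ | no q≰ = contradiction (ℕ.<-trans (subst (Fin._< bar n (w · p)) (out (ℕ.≰⇒> q≰)) l') (s≤s (bar-≤ʳ (proj₁ (Supp-∈ (rg I) w s (in-I pp p≤)))))) (λ k → q≰ (ℕ.≤-pred k))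
    s₂ : ∀ {p q r} → Pos p → p Fin.< q → q Fin.< r → Pos (w · r) → w · r Fin.< w · p → w · q Fin.< w · r → ⊥
    s₂ {p} {q} {r} pp p<q q<r Pr r<p _ with toℕ r ℕ.≤? toℕ a
    ... | yes r≤ = Neg⇒¬Pos (negative (ℕ.≤-trans pp (ℕ.<⇒≤ (ℕ.<-trans p<q q<r))) r≤) Pr
    ... | no r≰ = ℕ.<-asym (ℕ.<-trans p<q q<r) (subst₂ Fin._<_ wr wp r<p)
      where
      wr = out (ℕ.≰⇒> r≰)
      wp : w · p ≡ p
      wp = ·-injective w (out (ℕ.<-trans (ℕ.≰⇒> r≰) (subst (Fin._< w · p) wr r<p)))

  Desc-max : ∀ {S} → Desc S → ∃ λ w → IsMax (expand n S) w × Special w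
  Desc-max nil = Perm.id , IsMax-[] , Special-id
  Desc-max (centre {a} pa) with sort Perm.id (rg (bar n a , a)) (Fin.toℕ<n a)
  ... | v , s , d = v , IsMax-centre v s d , Special-centre v pa s d
  Desc-max (pos {c} {d} {S} pc c<d a dS) with Desc-max dS
  ... | w , mx , sp with sort w (rg (c , d)) (Fin.toℕ<n d)
  ...   | v , s , dec = u , mxu , Special-rearrange pc w v s sp (suc (toℕ d)) ℕ.≤-refl
            (λ {i} {j} p q l → subst₂ Fin._<_ (sym (on-Pos pc w v s (ℕ.≤-trans pc (proj₁ q)))) (sym (on-Pos pc w v s (ℕ.≤-trans pc (proj₁ p)))) (dec p q l))
            (λ x l → IsMax-above (pos pc c<d a dS) pd (ℕ.≤-refl ∷ All.map (ℕ.<⇒≤ ∘ proj₂) a) mxu l)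
            (ℕ.≤-trans pd (ℕ.n≤1+n _))
    where
    pd : Pos d
    pd = ℕ.≤-trans pc (ℕ.<⇒≤ c<d)
    u = v ∘ₚ (conj v ∘ₚ w)
    mxu : IsMax (expand n ((c , d) ∷ S)) u
    mxu = IsMax-pos w v pc c<d a dS mx (Special.symm sp) s dec

  -- Recovering the descending list from a special permutation

  Desc-proper : ∀ {S} → Desc S → All (λ K → proj₁ K Fin.< proj₂ K) S
  Desc-proper nil = []
  Desc-proper (centre p) = Neg<Pos (Pos-bar p) p ∷ []
  Desc-proper (pos _ l _ S) = l ∷ Desc-proper S

  -- A downward search for the start `s` of the run of values ending at `E` that are all taken
  -- inside [c,E], cut off at `c`. These values become fixed points when [c,E] is removed. The value
  -- just below `s`, if still at least `c`, is taken outside, which later forces the next interval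
  -- to start left of `c`.
  stop : ∀ (w : Pm m) (c E : Fin m) → c Fin.≤ E → flip w · E ∈ᵢ (c , E) →
    ∃ λ s → toℕ c ≤ s × s ≤ toℕ E × (∀ x → s ≤ toℕ x → x Fin.≤ E → flip w · x ∈ᵢ (c , E)) ×
            (∀ x → suc (toℕ x) ≡ s → c Fin.≤ x → ¬ flip w · x ∈ᵢ (c , E))
  stop w c E c≤E E∈ = go (toℕ E ℕ.∸ toℕ c) (ℕ.≤-reflexive (ℕ.m∸n+n≡m c≤E))
    (λ x l l' → subst (λ z → flip w · z ∈ᵢ (c , E)) (Fin.toℕ-injective (ℕ.≤-antisym (subst (_≤ toℕ x) (ℕ.m∸n+n≡m c≤E) l) l')) E∈)
    where
    go : ∀ k → k + toℕ c ≤ toℕ E → (∀ x → k + toℕ c ≤ toℕ x → x Fin.≤ E → flip w · x ∈ᵢ (c , E)) →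
      ∃ λ s → toℕ c ≤ s × s ≤ toℕ E × (∀ x → s ≤ toℕ x → x Fin.≤ E → flip w · x ∈ᵢ (c , E)) ×
              (∀ x → suc (toℕ x) ≡ s → c Fin.≤ x → ¬ flip w · x ∈ᵢ (c , E))
    go zero le good = toℕ c , ℕ.≤-refl , le , good , λ x e l _ → ℕ.<⇒≱ (ℕ.≤-reflexive e) l
    go (suc k) le good with (flip w · y) ∈? rg (c , E)
      where
      y : Fin m
      y = fromℕ< (ℕ.<-trans (ℕ.<-≤-trans (ℕ.n<1+n _) le) (Fin.toℕ<n E))
    ... | yes y∈ = go k (ℕ.<⇒≤ le) good'
      where
      good' : ∀ x → k + toℕ c ≤ toℕ x → x Fin.≤ E → flip w · x ∈ᵢ (c , E)
      good' x l l' with ℕ.m≤n⇒m<n∨m≡n l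
      ... | inj₁ l'' = good x l'' l'
      ... | inj₂ e = subst (λ z → flip w · z ∈ᵢ (c , E)) (Fin.toℕ-injective (trans (Fin.toℕ-fromℕ< _) e)) y∈
    ... | no y∉ = suc k + toℕ c , ℕ.m≤n+m _ _ , le , good , λ x e _ x∈ →
      y∉ (subst (λ z → flip w · z ∈ᵢ (c , E)) (Fin.toℕ-injective (trans (ℕ.suc-injective e) (sym (Fin.toℕ-fromℕ< _)))) x∈)

  -- The last clause locates the head of S: it starts at or before the position of the largest moved value.
  Result : ℕ → Pm m → Set
  Result t w = ∃ λ S → Desc S × IsMax (expand n S) w × All (λ K → toℕ (proj₂ K) < t) S ×
    (∀ p → suc (toℕ (w · p)) ≡ t → All (λ K → proj₁ K Fin.≤ p) S)

  module _ (w : Pm m) (sp : Special w) (E : Fin m) (pE : Pos E) (fx : ∀ x → E Fin.< x → w · x ≡ x) where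
    open Special sp

    below : ∀ {x} → x Fin.≤ E → w · x Fin.≤ E
    below {x} l = ℕ.≮⇒≥ (λ E< → ℕ.<⇒≱ (subst (E Fin.<_) (·-injective w (fx (w · x) E<)) E<) l)

    -- The positive position `q₀ = p̄` carries `Ē`, the least value available, so `spec₁` at `q₀`
    -- makes the values at all positive positions up to `E` negative. Applied to two such positions,
    -- `spec₁` forces them to decrease, and symmetry gives the negative half.
    centre-case : ∀ p → w · p ≡ E → Neg p → Result (suc (toℕ E)) w
    centre-case p wp np = (I ∷ []) , centre pE , IsMax-centre w supp dec , ℕ.≤-refl ∷ [] ,
      λ q e → subst (bar n E Fin.≤_) (sym (·-injective w (trans (Fin.toℕ-injective (ℕ.suc-injective e)) (sym wp)))) p≥ ∷ []
      where
      I = bar n E , E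
      supp : Supp (rg I) w
      supp x x∉ with toℕ x ℕ.≤? toℕ E
      ... | no l = fx x (ℕ.≰⇒> l)
      ... | yes l = bar-injective n (trans (sym (symm x)) (fx (bar n x) (bar-<′ (ℕ.≰⇒> (λ k → x∉ (k , s≤s l))))))
      p≥ : bar n E Fin.≤ p
      p≥ with p ∈? rg I
      ... | yes (a , _) = a
      ... | no p∉ = contradiction (subst Pos (sym (trans (sym (supp p p∉)) wp)) pE) (Neg⇒¬Pos np)
      q₀ = bar n p
      pq₀ : Pos q₀
      pq₀ = Neg-bar np
      wq₀ : w · q₀ ≡ bar n E
      wq₀ = trans (symm p) (cong (bar n) wp)
      in-I : ∀ {x} → Pos x → x Fin.≤ E → x ∈ᵢ I
      in-I px l = ℕ.<⇒≤ (Neg<Pos (Pos-bar pE) px) , s≤s l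
      negative : ∀ {q} → Pos q → q Fin.≤ E → Neg (w · q)
      negative {q} pq l with q Fin.≟ q₀
      ... | yes e = subst Neg (sym (trans (cong (w ·_) e) wq₀)) (Pos-bar pE)
      ... | no ne = proj₁ (spec₁ pq₀ pq (subst Neg (sym wq₀) (Pos-bar pE))
              (subst (Fin._< w · q) (sym wq₀) (ℕ.≤∧≢⇒< (proj₁ (Supp-∈ (rg I) w supp (in-I pq l))) (λ e → ne (·-injective w (trans (sym (Fin.toℕ-injective e)) (sym wq₀))))))
              (subst (w · q Fin.<_) (sym (trans (cong (bar n) wq₀) (bar-involutive n E))) (ℕ.≤∧≢⇒< (below l)
                (λ e → Neg⇒¬Pos np (subst Pos (·-injective w (trans (Fin.toℕ-injective e) (sym wp))) pq)))))
      dec⁺ : ∀ {i j} → Pos i → j Fin.≤ E → i Fin.< j → w · j Fin.< w · i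
      dec⁺ {i} {j} pi j≤ l with ℕ.<-cmp (toℕ (w · j)) (toℕ (w · i))
      ... | tri< a _ _ = a
      ... | tri≈ _ e _ = contradiction (cong toℕ (sym (·-injective w (Fin.toℕ-injective e)))) (ℕ.<⇒≢ l)
      ... | tri> _ _ g = contradiction (proj₂ (spec₁ pi pj ni g (Neg<Pos nj (Neg-bar ni)))) (ℕ.<-asym l)
        where
        pj = ℕ.≤-trans pi (ℕ.<⇒≤ l)
        ni = negative pi (ℕ.≤-trans (ℕ.<⇒≤ l) j≤)
        nj = negative pj j≤
      dec : DecOn (rg I) w
      dec {i} {j} i∈ j∈ l with pos? i | pos? j
      ... | inj₁ pi | _ = dec⁺ pi (ℕ.≤-pred (proj₂ j∈)) l
      ... | inj₂ ni | inj₁ pj = Neg<Pos (negative pj (ℕ.≤-pred (proj₂ j∈))) (subst Pos (trans (cong (bar n) (symm i)) (bar-involutive n _)) (Neg-bar (negative (Neg-bar ni) (bar-≤ʳ (proj₁ i∈)))))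
      ... | inj₂ ni | inj₂ nj = subst₂ Fin._<_ (bar-involutive n _) (bar-involutive n _)
              (bar-< (subst₂ Fin._<_ (symm i) (symm j) (dec⁺ (Neg-bar nj) (bar-≤ʳ (proj₁ i∈)) (bar-< l))))

    module PosCase (c : Fin m) (wc : w · c ≡ E) (pc : Pos c) (ne : c ≢ E) where
      I = c , E
      c<E : c Fin.< E
      c<E = ℕ.≤∧≢⇒< (ℕ.≮⇒≥ (λ l → ne (trans (sym (fx c l)) wc))) (ne ∘ Fin.toℕ-injective)
      less : ∀ {x} → c Fin.< x → x Fin.≤ E → w · x Fin.< w · c
      less {x} l l' = subst (w · x Fin.<_) (sym wc) (ℕ.≤∧≢⇒< (below l') (λ e → ℕ.<⇒≢ l (cong toℕ (·-injective w (trans wc (sym (Fin.toℕ-injective e)))))))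
      -- The value at `c` is the largest. An ascent to its right would complete a 312 or a 3 1̄ 2
      -- with it if its top is positive, which `spec₂` forbids; if its top is negative, both values
      -- are, which `spec₁` forbids.
      dec : DecOn (rg I) w
      dec {i} {j} (c≤i , _) (_ , s≤s j≤E) l with ℕ.m≤n⇒m<n∨m≡n c≤i
      ... | inj₂ e rewrite sym (Fin.toℕ-injective {i = c} {j = i} e) = less l j≤E
      ... | inj₁ c<i with ℕ.<-cmp (toℕ (w · j)) (toℕ (w · i))
      ...   | tri< a _ _ = a
      ...   | tri≈ _ e _ = contradiction (cong toℕ (sym (·-injective w (Fin.toℕ-injective e)))) (ℕ.<⇒≢ l)
      ...   | tri> _ _ g with pos? (w · j)
      ...     | inj₁ pj = ⊥-elim (spec₂ pc c<i l pj (less (ℕ.<-trans c<i l) j≤E) g)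
      ...     | inj₂ nj = contradiction (proj₂ (spec₁ pi (ℕ.≤-trans pi (ℕ.<⇒≤ l)) ni g (Neg<Pos nj (Neg-bar ni)))) (ℕ.<-asym l)
        where
        pi = ℕ.≤-trans pc c≤i
        ni = ℕ.<-trans g nj

      c∈ : flip w · E ∈ᵢ I
      c∈ = subst (_∈ᵢ I) (sym (flip-unique w wc)) (ℕ.≤-refl , s≤s (ℕ.<⇒≤ c<E))

      module Peeled (s : ℕ) (c≤s : toℕ c ≤ s) (s≤E : s ≤ toℕ E)
        (bad : ∀ x → suc (toℕ x) ≡ s → c Fin.≤ x → ¬ flip w · x ∈ᵢ I)
        (v : Pm m) (supp : Supp (rg I) v) (fixM : ∀ x → s ≤ toℕ x → x Fin.≤ E → w · (v · x) ≡ x)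
        (decJ : DecOn (toℕ c , s) (v ∘ₚ w)) where
        n≤s : n ≤ s
        n≤s = ℕ.≤-trans pc c≤s
        w' = v ∘ₚ (conj v ∘ₚ w)
        on : ∀ {x} → Pos x → w' · x ≡ w · (v · x)
        on = on-Pos pc w v supp
        fx' : ∀ x → s ≤ toℕ x → w' · x ≡ x
        fx' x s≤x with toℕ x ℕ.≤? toℕ E
        ... | yes x≤E = trans (on (ℕ.≤-trans n≤s s≤x)) (fixM x s≤x x≤E)
        ... | no x≰E = trans (on (ℕ.≤-trans n≤s s≤x)) (trans (cong (w ·_) (supp x (λ (_ , l) → x≰E (ℕ.≤-pred l)))) (fx x (ℕ.≰⇒> x≰E)))
        sp' : Special w'
        sp' = Special-rearrange pc w v supp sp s (ℕ.m≤n⇒m≤1+n s≤E)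
          (λ {i} {j} p q l → subst₂ Fin._<_ (sym (on (ℕ.≤-trans pc (proj₁ q)))) (sym (on (ℕ.≤-trans pc (proj₁ p)))) (decJ p q l)) fx' n≤s
        v⁻ = flip v
        supp⁻ = Supp-flip v supp
        restore : v⁻ ∘ₚ (conj v⁻ ∘ₚ w') ≗ₚ w
        restore x = begin
          w · (conj v · (v · (conj v⁻ · (v⁻ · x))))                ≡⟨ cong (λ z → w · (conj v · (v · z))) (Supp-comm v⁻ (conj v⁻) supp⁻ (Supp-conj {I} v⁻ supp⁻) (mirror-disjoint pc) x) ⟩
          w · (conj v · (v · (v⁻ · (conj v⁻ · x))))                ≡⟨ cong (λ z → w · (conj v · z)) (Perm.inverseʳ v) ⟩
          w · bar n (v · bar n (bar n (v⁻ · bar n x)))             ≡⟨ cong (λ z → w · bar n (v · z)) (bar-involutive n _) ⟩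
          w · bar n (v · (v⁻ · bar n x))                           ≡⟨ cong (λ z → w · bar n z) (Perm.inverseʳ v) ⟩
          w · bar n (bar n x)                                      ≡⟨ cong (w ·_) (bar-involutive n x) ⟩
          w · x                                                    ∎
          where open ≡-Reasoning
        dec' : DecOn (rg I) (v⁻ ∘ₚ w')
        dec' {i} {j} p q l = subst₂ Fin._<_ (sym (at q)) (sym (at p)) (dec p q l)
          where
          at : ∀ {x} → x ∈ᵢ I → w' · (v⁻ · x) ≡ w · x
          at {x} x∈ = trans (on (v-Pos pc w' v⁻ supp⁻ (ℕ.≤-trans pc (proj₁ x∈)))) (cong (w ·_) (Perm.inverseʳ v))
        assemble : Result s w' → Result (suc (toℕ E)) w
        assemble (S , dS , mx , ub , head) = (c , E) ∷ S , pos pc c<E smaller dS ,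
          IsMax-cong (v⁻ ∘ₚ (conj v⁻ ∘ₚ w')) w restore (IsMax-pos w' v⁻ pc c<E smaller dS mx (Special.symm sp') supp⁻ dec') ,
          ℕ.≤-refl ∷ All.map (λ l → ℕ.<-≤-trans l (ℕ.m≤n⇒m≤1+n s≤E)) ub ,
          λ p e → subst (λ z → All (λ K → proj₁ K Fin.≤ z) ((c , E) ∷ S)) (sym (·-injective w (trans (Fin.toℕ-injective (ℕ.suc-injective e)) (sym wc))))
            (ℕ.≤-refl ∷ All.map (ℕ.<⇒≤ ∘ proj₁) smaller)
          where
          starts : All (λ K → proj₁ K Fin.< c) S
          starts with ℕ.m≤n⇒m<n∨m≡n c≤s
          ... | inj₂ e = All.zipWith (λ (l , l') → ℕ.<-trans l (subst (_ <_) (sym e) l')) (Desc-proper dS , ub)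
          -- Let `p` be the position of the value `s - 1` in `w'`. If `p` were in [c,E], then `w`
          -- would take this value at `v · p`, inside [c,E], against `bad`; beyond `E` everything is
          -- fixed. So `p < c`, and `head` bounds all left endpoints by `p`.
          ... | inj₁ c<s = All.map (λ l → ℕ.≤-<-trans l p<c) (head p ps)
            where
            x : Fin m
            x = fromℕ< {ℕ.pred s} (ℕ.≤-<-trans (ℕ.pred[n]≤n) (ℕ.≤-<-trans s≤E (Fin.toℕ<n E)))
            ex : suc (toℕ x) ≡ s
            ex = trans (cong suc (Fin.toℕ-fromℕ< _)) (ℕ.suc-pred s {{ℕ.>-nonZero (ℕ.≤-<-trans z≤n c<s)}})
            p = flip w' · x
            ps : suc (toℕ (w' · p)) ≡ s
            ps = trans (cong (suc ∘ toℕ) (Perm.inverseʳ w')) ex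
            x≤E : x Fin.≤ E
            x≤E = ℕ.<⇒≤ (subst (_≤ toℕ E) (sym ex) s≤E)
            c≤x : c Fin.≤ x
            c≤x = ℕ.≤-pred (subst (toℕ c <_) (sym ex) c<s)
            p<c : p Fin.< c
            p<c = ℕ.≰⇒> λ c≤p → [ (λ p≤E → bad x ex c≤x (subst (_∈ᵢ I)
                      (sym (flip-unique w (trans (sym (on (ℕ.≤-trans pc c≤p))) (Perm.inverseʳ w')))) (Supp-∈ (rg I) v supp (c≤p , s≤s p≤E))))
                    , (λ E<p → ℕ.<⇒≱ E<p (subst (Fin._≤ E) (trans (sym (Perm.inverseʳ w')) (fx' p (ℕ.≤-trans s≤E (ℕ.<⇒≤ E<p)))) x≤E)) ]′ (ℕ.≤-<-connex (toℕ p) (toℕ E))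
          smaller : All (λ K → proj₁ K Fin.< c × proj₂ K Fin.< E) S
          smaller = All.zipWith (λ (l , l') → l , ℕ.<-≤-trans l' s≤E) (starts , ub)

    -- The interval [c,E] is undone in two moves: `v₁` makes the values from `s` to `E` fixed
    -- points, and `v₂` sorts the rest, [c,s), decreasingly, as the twins of the smaller product
    -- demand.
    pos-case : ∀ c → w · c ≡ E → Pos c → c ≢ E →
      (∀ w' → Special w' → ∀ s → n ≤ s → s ≤ toℕ E → (∀ x → s ≤ toℕ x → w' · x ≡ x) → Result s w') → Result (suc (toℕ E)) w
    pos-case c wc pc ne rec with stop w c E (ℕ.<⇒≤ c<E) c∈
      where open PosCase c wc pc ne
    ... | s , c≤s , s≤E , good , bad with fix w (rg (c , E)) (λ x → s ≤ toℕ x × x Fin.≤ E) (λ x → (s ℕ.≤? toℕ x) ×-dec (x Fin.≤? E))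
        (λ x (a , b) → ℕ.≤-trans c≤s a , s≤s b) (λ x (a , b) → good x a b)
    ...   | v₁ , s₁ , f₁ with sort (v₁ ∘ₚ w) (toℕ c , s) (ℕ.≤-trans s≤E (ℕ.<⇒≤ (Fin.toℕ<n E)))
    ...     | v₂ , s₂ , d₂ = assemble (rec w' sp' s n≤s s≤E fx')
      where
      open PosCase c wc pc ne
      open Peeled s c≤s s≤E bad (v₂ ∘ₚ v₁)
        (Supp-∘ v₂ v₁ (Supp-⊆ v₂ (λ (a , b) → a , ℕ.<-≤-trans b (ℕ.m≤n⇒m≤1+n s≤E)) s₂) s₁)
        (λ x s≤x x≤E → trans (cong (λ z → w · (v₁ · z)) (s₂ x (λ (_ , l) → ℕ.<⇒≱ l s≤x))) (f₁ x (s≤x , x≤E)))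
        d₂

  -- Recursion on the bound `t` from which on everything is fixed, with `k` at least `t - n`. At
  -- `t = n` all positive labels are fixed, and by symmetry so are the negative ones.
  toDesc : ∀ k w → Special w → ∀ t → n ≤ t → t ≤ n + k → t ≤ m → (∀ x → t ≤ toℕ x → w · x ≡ x) → Result t w
  toDesc k w sp t n≤t t≤ t≤m fx with ℕ.m≤n⇒m<n∨m≡n n≤t
  ... | inj₂ refl = [] , nil , IsMax-cong Perm.id w (λ x → sym (w-id x)) IsMax-[] , [] , λ _ _ → []
    where
    w-id : ∀ x → w · x ≡ x
    w-id x with pos? x
    ... | inj₁ p = fx x p
    ... | inj₂ ng = bar-injective n (trans (sym (Special.symm sp x)) (fx (bar n x) (Neg-bar ng)))
  toDesc zero w sp t n≤t t≤ t≤m fx | inj₁ n<t = contradiction (subst (t ≤_) (ℕ.+-identityʳ n) t≤) (ℕ.<⇒≱ n<t)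
  toDesc (suc k) w sp (suc t) n≤t t≤ t≤m fx | inj₁ (s≤s n≤t') = cases (p Fin.≟ E) (pos? p)
    where
    E : Fin m
    E = fromℕ< t≤m
    eE : toℕ E ≡ t
    eE = Fin.toℕ-fromℕ< t≤m
    pE : Pos E
    pE = subst (n ≤_) (sym eE) n≤t'
    t≤' : t ≤ n + k
    t≤' = ℕ.≤-pred (subst (suc t ≤_) (ℕ.+-suc n k) t≤)
    p = flip w · E
    wp : w · p ≡ E
    wp = Perm.inverseʳ w
    fx⁺ : ∀ x → E Fin.< x → w · x ≡ x
    fx⁺ x l = fx x (subst (_< toℕ x) eE l)
    rec : ∀ w' → Special w' → ∀ s → n ≤ s → s ≤ toℕ E → (∀ x → s ≤ toℕ x → w' · x ≡ x) → Result s w'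
    rec w' sp' s n≤s s≤E = toDesc k w' sp' s n≤s (ℕ.≤-trans s≤t t≤') (ℕ.≤-trans s≤t (ℕ.<⇒≤ t≤m))
      where s≤t = subst (s ≤_) eE s≤E
    cases : Dec (p ≡ E) → Pos p ⊎ Neg p → Result (suc t) w
    cases (no ne) (inj₁ pp) = subst (λ z → Result (suc z) w) eE (pos-case w sp E pE fx⁺ p wp pp ne rec)
    cases (no ne) (inj₂ np) = subst (λ z → Result (suc z) w) eE (centre-case w sp E pE fx⁺ p wp np)
    cases (yes e) _ with rec w sp t n≤t' (ℕ.≤-reflexive (sym eE)) fx'
      where
      fx' : ∀ x → t ≤ toℕ x → w · x ≡ x
      fx' x l with ℕ.m≤n⇒m<n∨m≡n l
      ... | inj₁ l' = fx x l'
      ... | inj₂ e' = subst (λ z → w · z ≡ z) (Fin.toℕ-injective (trans eE e')) (trans (cong (w ·_) (sym e)) wp)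
    ... | S , dS , mx , ub , _ = S , dS , mx , All.map ℕ.m<n⇒m<1+n ub ,
      λ q eq → All.zipWith (λ (l , l') → ℕ.<⇒≤ (ℕ.<-trans l (subst (_ <_) (trans (sym eE) (cong toℕ (sym (q≡ q eq)))) l'))) (Desc-proper dS , ub)
      where
      q≡ : ∀ q → suc (toℕ (w · q)) ≡ suc t → q ≡ E
      q≡ q eq = trans (·-injective w (trans (Fin.toℕ-injective (trans (ℕ.suc-injective eq) (sym eE))) (sym wp))) e

  -- Signed patterns in terms of order

  label-neg : ∀ {x} → Neg x → label n x ≡ -[1+ n ℕ.∸ suc (toℕ x) ]
  label-neg {x} p with toℕ x ℕ.<? n
  ... | yes _ = refl
  ... | no ¬p = contradiction p ¬p

  label-pos : ∀ {x} → Pos x → label n x ≡ ℤ.+ suc (toℕ x ℕ.∸ n)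
  label-pos {x} p with toℕ x ℕ.<? n
  ... | yes q = contradiction p (Neg⇒¬Pos q)
  ... | no _ = refl

  ab : Fin m → ℕ
  ab x = ∣ label n x ∣

  sign-neg : ∀ {x} → Neg x → Sign.- ≡ sign (label n x)
  sign-neg p rewrite label-neg p = refl

  sign-pos : ∀ {x} → Pos x → Sign.+ ≡ sign (label n x)
  sign-pos p rewrite label-pos p = refl

  sign-neg⁻ : ∀ {x} → Sign.- ≡ sign (label n x) → Neg x
  sign-neg⁻ {x} e with pos? x
  ... | inj₂ ng = ng
  ... | inj₁ p with () ← trans e (sym (sign-pos p))

  sign-pos⁻ : ∀ {x} → Sign.+ ≡ sign (label n x) → Pos x
  sign-pos⁻ {x} e with pos? x
  ... | inj₁ p = p
  ... | inj₂ ng with () ← trans e (sym (sign-neg ng))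

  ab-neg-< : ∀ {x y} → Neg x → Neg y → x Fin.< y → ab y < ab x
  ab-neg-< p q l rewrite label-neg p | label-neg q = s≤s (ℕ.∸-monoʳ-< (s≤s l) q)

  ab-neg-≤ : ∀ {x y} → Neg x → Neg y → x Fin.≤ y → ab y ≤ ab x
  ab-neg-≤ p q l rewrite label-neg p | label-neg q = s≤s (ℕ.∸-monoʳ-≤ n (s≤s l))

  ab-neg-<⁻ : ∀ {x y} → Neg x → Neg y → ab y < ab x → x Fin.< y
  ab-neg-<⁻ p q l = ℕ.≰⇒> (λ k → ℕ.<⇒≱ l (ab-neg-≤ q p k))

  ab-pos-< : ∀ {x y} → Pos x → Pos y → x Fin.< y → ab x < ab y
  ab-pos-< p q l rewrite label-pos p | label-pos q = s≤s (ℕ.∸-monoˡ-< l p)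

  ab-pos-<⁻ : ∀ {x y} → Pos x → Pos y → ab x < ab y → x Fin.< y
  ab-pos-<⁻ {x} {y} p q l = ℕ.≰⇒> (λ k → ℕ.<⇒≱ l (le k))
    where
    le : y Fin.≤ x → ab y ≤ ab x
    le k rewrite label-pos p | label-pos q = s≤s (ℕ.∸-monoˡ-≤ n k)

  ab-bar : ∀ {x} → Pos x → ab (bar n x) ≡ ab x
  ab-bar {x} p rewrite label-pos p | label-neg (Pos-bar p) = cong suc (begin
    n ℕ.∸ suc b                 ≡⟨ cong (ℕ._∸ suc b) (sym b+k) ⟩
    (b + suc k) ℕ.∸ suc b       ≡⟨ cong (ℕ._∸ suc b) (ℕ.+-suc b k) ⟩
    (suc b + k) ℕ.∸ suc b       ≡⟨ ℕ.m+n∸m≡n (suc b) k ⟩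
    k                           ∎)
    where
    open ≡-Reasoning
    b = toℕ (bar n x)
    k = toℕ x ℕ.∸ n
    b+k : b + suc k ≡ n
    b+k = ℕ.+-cancelʳ-≡ n _ _ (begin
      b + suc k + n      ≡⟨ ℕ.+-assoc b (suc k) n ⟩
      b + suc (k + n)    ≡⟨ cong (λ z → b + suc z) (ℕ.m∸n+n≡m p) ⟩
      b + suc (toℕ x)    ≡⟨ bar-sum x ⟩
      n + n              ∎)

  -- Having smaller absolute value than a negative `x` means lying strictly between `x` and `x̄`.
  -- This translates the patterns of length two into `spec₁`.
  ab-window : ∀ {x y} → Neg x → ab y < ab x → x Fin.< y × y Fin.< bar n x
  ab-window {x} {y} ng l with pos? y
  ... | inj₂ ny = ab-neg-<⁻ ng ny l , Neg<Pos ny (Neg-bar ng)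
  ... | inj₁ py = Neg<Pos ng py , bar-<′ (ab-neg-<⁻ ng (Pos-bar py) (subst (_< ab x) (sym (ab-bar py)) l))

  ab-window⁻ : ∀ {x y} → Neg x → x Fin.< y → y Fin.< bar n x → ab y < ab x
  ab-window⁻ {x} {y} ng l l' with pos? y
  ... | inj₂ ny = ab-neg-< ng ny l
  ... | inj₁ py = subst (_< ab x) (ab-bar py) (ab-neg-< ng (Pos-bar py) (bar-<′ l'))

  shift : ∀ {p} → Pos p → ∃ λ i → n ↑ʳ i ≡ p
  shift {p} pp = fromℕ< {toℕ p ℕ.∸ n} lt , Fin.toℕ-injective (trans (Fin.toℕ-↑ʳ n _) (trans (cong (λ z → n + z) (Fin.toℕ-fromℕ< lt)) (ℕ.m+[n∸m]≡n pp)))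
    where
    lt : toℕ p ℕ.∸ n < n
    lt = ℕ.+-cancelʳ-< n _ _ (subst (_< n + n) (sym (ℕ.m∸n+n≡m pp)) (Fin.toℕ<n p))

  Pos-shift : ∀ i → Pos (n ↑ʳ i)
  Pos-shift i = subst (n ≤_) (sym (Fin.toℕ-↑ʳ n i)) (ℕ.m≤m+n n _)

  shift-< : ∀ {i j : Fin n} → i Fin.< j → (n ↑ʳ i) Fin.< (n ↑ʳ j)
  shift-< {i} {j} l = subst₂ _<_ (sym (Fin.toℕ-↑ʳ n i)) (sym (Fin.toℕ-↑ʳ n j)) (ℕ.+-monoʳ-< n l)

  shift-<⁻ : ∀ {i j : Fin n} → (n ↑ʳ i) Fin.< (n ↑ʳ j) → i Fin.< j
  shift-<⁻ {i} {j} l = ℕ.+-cancelˡ-< n _ _ (subst₂ _<_ (Fin.toℕ-↑ʳ n i) (Fin.toℕ-↑ʳ n j) l)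

  -- Distinct indices have distinct `f`, so trichotomy turns the forward implication into an
  -- equivalence.
  same-order : ∀ {k} (f g : Fin k → ℕ) → (∀ a b → f a < f b → g a < g b) → (∀ a b → f a ≡ f b → a ≡ b) →
    ∀ a b → (f a < f b) ⇔ (g a < g b)
  same-order f g mono inj a b = mk⇔ (mono a b) reflect
    where
    reflect : g a < g b → f a < f b
    reflect l with ℕ.<-cmp (f a) (f b)
    ... | tri< x _ _ = x
    ... | tri≈ _ e _ with refl ← inj a b e = contradiction l (ℕ.n≮n _)
    ... | tri> _ _ x = contradiction l (ℕ.<-asym (mono b a x))

  module _ (w : Pm m) where

    private
      W : Fin n → Fin m
      W i = w · (n ↑ʳ i)

    match₂ : ∀ (x y : ℤ) {i j} → i Fin.< j → sign x ≡ sign (label n (W i)) → sign y ≡ sign (label n (W j)) →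
      (∣ x ∣ < ∣ y ∣ × ab (W i) < ab (W j)) ⊎ (∣ y ∣ < ∣ x ∣ × ab (W j) < ab (W i)) →
      ∃ (MatchesAt n (w ·_) (x Vc.∷ y Vc.∷ Vc.[]))
    match₂ x y {i} {j} l sx sy o = ι , mono , sg , same-order f g (up o) (inj o)
      where
      ι : Fin 2 → Fin n
      ι zero = i
      ι (suc zero) = j
      mono : ∀ a b → a Fin.< b → ι a Fin.< ι b
      mono zero (suc zero) _ = l
      mono (suc zero) (suc zero) (s≤s ())
      sg : ∀ a → sign (Vc.lookup (x Vc.∷ y Vc.∷ Vc.[]) a) ≡ sign (word n (w ·_) (ι a))
      sg zero = sx
      sg (suc zero) = sy
      f g : Fin 2 → ℕ
      f a = ∣ Vc.lookup (x Vc.∷ y Vc.∷ Vc.[]) a ∣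
      g a = ab (W (ι a))
      O = (∣ x ∣ < ∣ y ∣ × ab (W i) < ab (W j)) ⊎ (∣ y ∣ < ∣ x ∣ × ab (W j) < ab (W i))
      up : O → ∀ a b → f a < f b → g a < g b
      up o zero zero q = contradiction q (ℕ.n≮n _)
      up o (suc zero) (suc zero) q = contradiction q (ℕ.n≮n _)
      up (inj₁ (_ , r)) zero (suc zero) q = r
      up (inj₂ (r , _)) zero (suc zero) q = contradiction q (ℕ.<-asym r)
      up (inj₁ (r , _)) (suc zero) zero q = contradiction q (ℕ.<-asym r)
      up (inj₂ (_ , r)) (suc zero) zero q = r
      inj : O → ∀ a b → f a ≡ f b → a ≡ b
      inj o zero zero q = refl
      inj o (suc zero) (suc zero) q = refl
      inj (inj₁ (r , _)) zero (suc zero) q = contradiction q (ℕ.<⇒≢ r)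
      inj (inj₂ (r , _)) zero (suc zero) q = contradiction (sym q) (ℕ.<⇒≢ r)
      inj (inj₁ (r , _)) (suc zero) zero q = contradiction (sym q) (ℕ.<⇒≢ r)
      inj (inj₂ (r , _)) (suc zero) zero q = contradiction q (ℕ.<⇒≢ r)

    match-312 : ∀ (x y z : ℤ) {i j k} → i Fin.< j → j Fin.< k →
      sign x ≡ sign (label n (W i)) → sign y ≡ sign (label n (W j)) → sign z ≡ sign (label n (W k)) →
      ∣ y ∣ < ∣ z ∣ → ∣ z ∣ < ∣ x ∣ → ab (W j) < ab (W k) → ab (W k) < ab (W i) →
      ∃ (MatchesAt n (w ·_) (x Vc.∷ y Vc.∷ z Vc.∷ Vc.[]))
    match-312 x y z {i} {j} {k} l l' sx sy sz y<z z<x j<k k<i = ι , mono , sg , same-order f g up inj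
      where
      ι : Fin 3 → Fin n
      ι zero = i
      ι (suc zero) = j
      ι (suc (suc zero)) = k
      mono : ∀ a b → a Fin.< b → ι a Fin.< ι b
      mono zero (suc zero) _ = l
      mono zero (suc (suc zero)) _ = ℕ.<-trans l l'
      mono (suc zero) (suc zero) (s≤s ())
      mono (suc zero) (suc (suc zero)) _ = l'
      mono (suc (suc zero)) (suc zero) (s≤s ())
      mono (suc (suc zero)) (suc (suc zero)) (s≤s (s≤s ()))
      sg : ∀ a → sign (Vc.lookup (x Vc.∷ y Vc.∷ z Vc.∷ Vc.[]) a) ≡ sign (word n (w ·_) (ι a))
      sg zero = sx
      sg (suc zero) = sy
      sg (suc (suc zero)) = sz
      f g : Fin 3 → ℕ
      f a = ∣ Vc.lookup (x Vc.∷ y Vc.∷ z Vc.∷ Vc.[]) a ∣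
      g a = ab (W (ι a))
      y<x = ℕ.<-trans y<z z<x
      up : ∀ a b → f a < f b → g a < g b
      up zero zero q = contradiction q (ℕ.n≮n _)
      up zero (suc zero) q = contradiction q (ℕ.<-asym y<x)
      up zero (suc (suc zero)) q = contradiction q (ℕ.<-asym z<x)
      up (suc zero) zero q = ℕ.<-trans j<k k<i
      up (suc zero) (suc zero) q = contradiction q (ℕ.n≮n _)
      up (suc zero) (suc (suc zero)) q = j<k
      up (suc (suc zero)) zero q = k<i
      up (suc (suc zero)) (suc zero) q = contradiction q (ℕ.<-asym y<z)
      up (suc (suc zero)) (suc (suc zero)) q = contradiction q (ℕ.n≮n _)
      inj : ∀ a b → f a ≡ f b → a ≡ b
      inj zero zero q = refl
      inj zero (suc zero) q = contradiction (sym q) (ℕ.<⇒≢ y<x)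
      inj zero (suc (suc zero)) q = contradiction (sym q) (ℕ.<⇒≢ z<x)
      inj (suc zero) zero q = contradiction q (ℕ.<⇒≢ y<x)
      inj (suc zero) (suc zero) q = refl
      inj (suc zero) (suc (suc zero)) q = contradiction q (ℕ.<⇒≢ y<z)
      inj (suc (suc zero)) zero q = contradiction q (ℕ.<⇒≢ z<x)
      inj (suc (suc zero)) (suc zero) q = contradiction (sym q) (ℕ.<⇒≢ y<z)
      inj (suc (suc zero)) (suc (suc zero)) q = refl

    Special⇒avoids : Special w → AvoidsAll5 n (w ·_)
    Special⇒avoids S = a₁ , a₂ , a₃ , a₄ , a₅
      where
      open Special S
      1<2 : 1 < 2
      1<2 = s≤s (s≤s z≤n)
      2<3 : 2 < 3
      2<3 = s≤s (s≤s (s≤s z≤n))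
      use₁ : ∀ i j → Neg (W i) → ab (W j) < ab (W i) → Neg (W j) × j Fin.< i
      use₁ i j ng l with ab-window ng l
      ... | a , b with spec₁ (Pos-shift i) (Pos-shift j) ng a b
      ...   | ng' , l' = ng' , shift-<⁻ l'
      a₁ : Avoids n (w ·_) p1
      a₁ (ι , mono , sg , ord) = Neg⇒¬Pos (proj₁ (use₁ (ι (suc zero)) (ι zero) (sign-neg⁻ (sg (suc zero)))
        (Equivalence.to (ord zero (suc zero)) 1<2))) (sign-pos⁻ (sg zero))
      a₂ : Avoids n (w ·_) p2
      a₂ (ι , mono , sg , ord) = Neg⇒¬Pos (proj₁ (use₁ (ι zero) (ι (suc zero)) (sign-neg⁻ (sg zero))
        (Equivalence.to (ord (suc zero) zero) 1<2))) (sign-pos⁻ (sg (suc zero)))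
      a₃ : Avoids n (w ·_) p3
      a₃ (ι , mono , sg , ord) = ℕ.<-asym (mono zero (suc zero) (s≤s z≤n)) (proj₂ (use₁ (ι zero) (ι (suc zero)) (sign-neg⁻ (sg zero))
        (Equivalence.to (ord (suc zero) zero) 1<2)))
      use₂ : ∀ (ι : Fin 3 → Fin n) → (∀ a b → a Fin.< b → ι a Fin.< ι b) → Pos (W (ι zero)) → Pos (W (ι (suc (suc zero)))) →
        W (ι (suc zero)) Fin.< W (ι (suc (suc zero))) → ab (W (ι (suc (suc zero)))) < ab (W (ι zero)) → ⊥
      use₂ ι mono p0 p2 l l' = spec₂ (Pos-shift _) (shift-< (mono zero (suc zero) (s≤s z≤n))) (shift-< (mono (suc zero) (suc (suc zero)) (s≤s (s≤s z≤n)))) p2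
        (ab-pos-<⁻ p2 p0 l') l
      a₄ : Avoids n (w ·_) p4
      a₄ (ι , mono , sg , ord) = use₂ ι mono (sign-pos⁻ (sg zero)) (sign-pos⁻ (sg (suc (suc zero))))
        (ab-pos-<⁻ (sign-pos⁻ (sg (suc zero))) (sign-pos⁻ (sg (suc (suc zero)))) (Equivalence.to (ord (suc zero) (suc (suc zero))) 1<2))
        (Equivalence.to (ord (suc (suc zero)) zero) 2<3)
      a₅ : Avoids n (w ·_) p5
      a₅ (ι , mono , sg , ord) = use₂ ι mono (sign-pos⁻ (sg zero)) (sign-pos⁻ (sg (suc (suc zero))))
        (Neg<Pos (sign-neg⁻ (sg (suc zero))) (sign-pos⁻ (sg (suc (suc zero)))))
        (Equivalence.to (ord (suc (suc zero)) zero) 2<3)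

    avoids⇒Special : (∀ x → w · bar n x ≡ bar n (w · x)) → AvoidsAll5 n (w ·_) → Special w
    avoids⇒Special sy (a₁ , a₂ , a₃ , a₄ , a₅) = record { symm = sy ; spec₁ = s₁ ; spec₂ = s₂ }
      where
      1<2 : 1 < 2
      1<2 = s≤s (s≤s z≤n)
      2<3 : 2 < 3
      2<3 = s≤s (s≤s (s≤s z≤n))
      s₁ : ∀ {p q} → Pos p → Pos q → Neg (w · p) → w · p Fin.< w · q → w · q Fin.< bar n (w · p) → Neg (w · q) × q Fin.< p
      s₁ {p} {q} pp pq ng l l' with shift pp | shift pq
      ... | i , refl | j , refl = go (ℕ.<-cmp (toℕ j) (toℕ i)) (pos? (W j))
        where
        lt : ab (W j) < ab (W i)
        lt = ab-window⁻ ng l l'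
        go : _ → Pos (W j) ⊎ Neg (W j) → Neg (W j) × (n ↑ʳ j) Fin.< (n ↑ʳ i)
        go (tri< j<i _ _) (inj₂ nj) = nj , shift-< j<i
        go (tri< j<i _ _) (inj₁ pj) = ⊥-elim (a₁ (match₂ (ℤ.+ 1) (ℤ.- (ℤ.+ 2)) j<i (sign-pos pj) (sign-neg ng) (inj₁ (1<2 , lt))))
        go (tri≈ _ e _) _ = contradiction (cong (λ z → ab (W z)) (Fin.toℕ-injective e)) (ℕ.<⇒≢ lt)
        go (tri> _ _ i<j) (inj₁ pj) = ⊥-elim (a₂ (match₂ (ℤ.- (ℤ.+ 2)) (ℤ.+ 1) i<j (sign-neg ng) (sign-pos pj) (inj₂ (1<2 , lt))))
        go (tri> _ _ i<j) (inj₂ nj) = ⊥-elim (a₃ (match₂ (ℤ.- (ℤ.+ 2)) (ℤ.- (ℤ.+ 1)) i<j (sign-neg ng) (sign-neg nj) (inj₂ (1<2 , lt))))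
      s₂ : ∀ {p q r} → Pos p → p Fin.< q → q Fin.< r → Pos (w · r) → w · r Fin.< w · p → w · q Fin.< w · r → ⊥
      s₂ {p} {q} {r} pp p<q q<r pr r<p q<r' with shift pp | shift (ℕ.≤-trans pp (ℕ.<⇒≤ p<q)) | shift (ℕ.≤-trans pp (ℕ.<⇒≤ (ℕ.<-trans p<q q<r)))
      ... | i , refl | j , refl | k , refl with pos? (W j)
      ...   | inj₁ pj = a₄ (match-312 (ℤ.+ 3) (ℤ.+ 1) (ℤ.+ 2) (shift-<⁻ p<q) (shift-<⁻ q<r) (sign-pos pi) (sign-pos pj) (sign-pos pr) 1<2 2<3
                (ab-pos-< pj pr q<r') (ab-pos-< pr pi r<p))
        where pi = ℕ.≤-trans pr (ℕ.<⇒≤ r<p)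
      ...   | inj₂ nj = a₅ (match-312 (ℤ.+ 3) (ℤ.- (ℤ.+ 1)) (ℤ.+ 2) (shift-<⁻ p<q) (shift-<⁻ q<r) (sign-pos pi) (sign-neg nj) (sign-pos pr) 1<2 2<3
                lt (ab-pos-< pr pi r<p))
        where
        pi = ℕ.≤-trans pr (ℕ.<⇒≤ r<p)
        lt : ab (W j) < ab (W k)
        -- For 3 1̄ 2 the negative entry must also be the smallest in absolute value. Were `W k`
        -- below `bar n (W j)`, `spec₁` at `j` would make it negative; were they equal, symmetry
        -- would put `n ↑ʳ k` at a negative position.
        lt with ℕ.<-cmp (toℕ (W k)) (toℕ (bar n (W j)))
        ... | tri< l _ _ = contradiction pr (Neg⇒¬Pos (proj₁ (s₁ (Pos-shift j) (Pos-shift k) nj q<r' l)))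
        ... | tri≈ _ e _ = contradiction (subst Neg (sym (·-injective w (trans (Fin.toℕ-injective e) (sym (sy (n ↑ʳ j)))))) (Pos-bar (Pos-shift j)))
                             (λ ng → Neg⇒¬Pos ng (Pos-shift k))
        ... | tri> _ _ l = subst (_< ab (W k)) (trans (sym (ab-bar (Neg-bar nj))) (cong ab (bar-involutive n (W j)))) (ab-pos-< (Neg-bar nj) pr l)

  -- Expanded descending lists as zig-zag lists

  Desc-pairs : ∀ {S} → Desc S → ∀ {a b} → (a ∷ b ∷ []) ⊆ S → proj₁ b Fin.< proj₁ a × proj₂ b Fin.< proj₂ a
  Desc-pairs nil ()
  Desc-pairs (centre _) (skip _ ())
  Desc-pairs (centre _) (refl ∷ ())
  Desc-pairs (pos _ _ _ S) (skip _ p) = Desc-pairs S p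
  Desc-pairs (pos _ _ a S) (refl ∷ p) = All.head (All-resp-⊆ p a)

  Desc-BC : ∀ {S} → Desc S → All (BCInterval n) S
  Desc-BC nil = []
  Desc-BC (centre p) = inj₂ (p , refl) ∷ []
  Desc-BC (pos pc l _ S) = inj₁ (pc , ℕ.<⇒≤ l) ∷ Desc-BC S

  Desc⇒DBC : ∀ {S} → Desc S → InDBC n (prodBC n S)
  Desc⇒DBC {S} dS = S , Desc-BC dS , fromNonNest nn , (λ i j l _ → proj₁ (Desc-pairs dS (lookup⇒⊆₂ S l))) , ≅-refl (prodBC n S)
    where
    nn : NonNest S
    nn p with Desc-pairs dS p
    ... | l , l' = (λ (_ , k) → ℕ.<⇒≱ l' k) , (λ (k , _) → ℕ.<⇒≱ l k)

  prodBC-Desc : ∀ {S} → Desc S → prodBC n S ≅ netOf (expand n S)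
  prodBC-Desc {S} dS = subst (λ X → prodBC n S ≅ netOf (expand n X)) (proper⇒nonSingle (Desc-proper dS)) (prodBC≅netOf n S)

  -- Positive intervals descend, their mirror images ascend, and opposite halves are disjoint. The
  -- central interval, always last, counts with either half, so `down` asks only for the right
  -- endpoint of `b` to be positive and `up` only for its left endpoint to be negative.
  data Later (a b : Interval m) : Set where
    down  : Pos (proj₁ a) → Pos (proj₂ b) → proj₁ b Fin.< proj₁ a → proj₂ b Fin.< proj₂ a → Later a b
    up    : Neg (proj₂ a) → Neg (proj₁ b) → proj₁ a Fin.< proj₁ b → proj₂ a Fin.< proj₂ b → Later a b
    cross : Pos (proj₁ a) → Neg (proj₂ b) → Later a b
    cross′ : Neg (proj₂ a) → Pos (proj₁ b) → Later a b

  later-all : ∀ {c d S} → Pos c → c Fin.< d → Desc S → All (λ K → proj₁ K Fin.< c × proj₂ K Fin.< d) S →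
    All (λ X → Later (c , d) X × Later (mirror (c , d)) X) (expand n S)
  later-all pc l nil a = []
  later-all {c} {d} pc l (centre {e} pe) ((k , k') ∷ _) = subst (All _) (sym expand-centre)
    ((down pc pe k k' , up (Pos-bar pc) (Pos-bar pe) (bar-< k') (Neg<Pos (Pos-bar pc) pe)) ∷ [])
  later-all {c} {d} pc l (pos {c'} {d'} {T} pc' l' b T') ((k , k') ∷ a) = subst (All _) (sym (expand-pos {S = T} pc' l'))
    ((down pc (ℕ.≤-trans pc' (ℕ.<⇒≤ l')) k k' , cross′ (Pos-bar pc) pc')
     ∷ (cross pc (Pos-bar pc') , up (Pos-bar pc) (Pos-bar (ℕ.≤-trans pc' (ℕ.<⇒≤ l'))) (bar-< k') (bar-< k))
     ∷ later-all pc l T' a)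

  expand-later : ∀ {S} → Desc S → ∀ {a b} → (a ∷ b ∷ []) ⊆ expand n S → Later a b
  expand-later nil ()
  expand-later (centre {e} pe) p = none (subst (_ ⊆_) expand-centre p)
    where
    none : ∀ {a b x} → (a ∷ b ∷ []) ⊆ (x ∷ []) → Later a b
    none (skip _ ())
    none (refl ∷ ())
  expand-later (pos {c} {d} {T} pc l b T') p = go (subst (_ ⊆_) (expand-pos {S = T} pc l) p)
    where
    go : ∀ {a b} → (a ∷ b ∷ []) ⊆ ((c , d) ∷ mirror (c , d) ∷ expand n T) → Later a b
    go (skip _ (skip _ p)) = expand-later T' p
    go (skip _ (refl ∷ p)) = proj₂ (All.head (All-resp-⊆ p (later-all pc l T' b)))
    go (refl ∷ skip _ p) = proj₁ (All.head (All-resp-⊆ p (later-all pc l T' b)))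
    go (refl ∷ refl ∷ p) = cross pc (Pos-bar pc)

  expand-proper : ∀ {S} → Desc S → All Proper (expand n S)
  expand-proper nil = []
  expand-proper (centre pe) = subst (All Proper) (sym expand-centre) (Neg<Pos (Pos-bar pe) pe ∷ [])
  expand-proper (pos {S = T} pc l _ T') = subst (All Proper) (sym (expand-pos {S = T} pc l)) (l ∷ bar-< l ∷ expand-proper T')

  expand-NonNest : ∀ {S} → Desc S → NonNest (expand n S)
  expand-NonNest dS {a} {b} p with expand-later dS p | All-resp-⊆ p (expand-proper dS)
  ... | down _ _ l l' | _ = (λ (_ , k) → ℕ.<⇒≱ l' k) , (λ (k , _) → ℕ.<⇒≱ l k)
  ... | up _ _ l l' | _ = (λ (k , _) → ℕ.<⇒≱ l k) , (λ (_ , k) → ℕ.<⇒≱ l' k)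
  ... | cross pa nb | la ∷ lb ∷ [] = (λ (_ , k) → ℕ.<⇒≱ nb (ℕ.≤-trans pa (ℕ.≤-trans (ℕ.<⇒≤ la) k))) , (λ (k , _) → ℕ.<⇒≱ nb (ℕ.≤-trans pa (ℕ.≤-trans k (ℕ.<⇒≤ lb))))
  ... | cross′ na pb | la ∷ lb ∷ [] = (λ (k , _) → ℕ.<⇒≱ na (ℕ.≤-trans pb (ℕ.≤-trans k (ℕ.<⇒≤ la)))) , (λ (_ , k) → ℕ.<⇒≱ na (ℕ.≤-trans pb (ℕ.≤-trans (ℕ.<⇒≤ lb) k)))

  Pos-Neg-apart : ∀ {a b : Interval m} → Pos (proj₁ a) → Neg (proj₂ b) → Meets a b → ⊥
  Pos-Neg-apart p ng (x , l , _ , _ , k) = ℕ.<⇒≱ ng (ℕ.≤-trans p (ℕ.≤-trans l k))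

  Neg-Pos-apart : ∀ {a b : Interval m} → Neg (proj₂ a) → Pos (proj₁ b) → Meets a b → ⊥
  Neg-Pos-apart ng p (x , _ , k , l , _) = ℕ.<⇒≱ ng (ℕ.≤-trans p (ℕ.≤-trans l k))

  -- Intervals that meet are in relation `down` or `up`. The two cannot follow one another, as they
  -- put opposite signs on an endpoint of the middle interval.
  expand-ZZ : ∀ {S} → Desc S → ZZ (expand n S)
  expand-ZZ {S} dS {a} {b} {c} p mab mbc with expand-later dS (⊆-trans first p) | expand-later dS (⊆-trans last p)
    where
    first : (a ∷ b ∷ []) ⊆ (a ∷ b ∷ c ∷ [])
    first = refl ∷ refl ∷ skip c []
    last : (b ∷ c ∷ []) ⊆ (a ∷ b ∷ c ∷ [])
    last = skip a (refl ∷ refl ∷ [])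
  ... | cross x y | _ = ⊥-elim (Pos-Neg-apart {a} {b} x y mab)
  ... | cross′ x y | _ = ⊥-elim (Neg-Pos-apart {a} {b} x y mab)
  ... | down _ pb l _ | down _ _ k _ = inj₂ (l , k)
  ... | down _ pb l _ | up nb _ _ _ = contradiction pb (Neg⇒¬Pos nb)
  ... | down _ pb l _ | cross x y = ⊥-elim (Pos-Neg-apart {b} {c} x y mbc)
  ... | down _ pb l _ | cross′ nb _ = contradiction pb (Neg⇒¬Pos nb)
  ... | up _ nb l _ | down pb _ _ _ = contradiction pb (Neg⇒¬Pos nb)
  ... | up _ nb l _ | up _ _ k _ = inj₁ (l , k)
  ... | up _ nb l _ | cross pb _ = contradiction pb (Neg⇒¬Pos nb)
  ... | up _ nb l _ | cross′ x y = ⊥-elim (Neg-Pos-apart {b} {c} x y mbc)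

  Desc⇒ZA : ∀ {S} (N : Network m) → Desc S → N ≅ netOf (expand n S) → InZA N
  Desc⇒ZA {S} N dS i = inj₂ (expand n S , All.map ℕ.<⇒≤ (expand-proper dS) , fromNonNest (expand-NonNest dS) , fromZZ (expand-ZZ dS) ,
    ≅-trans N (netOf (expand n S)) (prodA (expand n S)) i (≅-sym (prodA (expand n S)) (netOf (expand n S))
      (subst (λ X → prodA (expand n S) ≅ netOf X) (proper⇒nonSingle (expand-proper dS)) (prodA≅netOf (expand n S)))))

  -- Normalising a descending product

  DescP : List (Interval m) → Set
  DescP L = ∀ {a b} → (a ∷ b ∷ []) ⊆ L → Meets a b → proj₁ b Fin.< proj₁ a

  expand-++ : ∀ L₁ L₂ → expand n (L₁ ++ L₂) ≡ expand n L₁ ++ expand n L₂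
  expand-++ [] L₂ = refl
  expand-++ ((c , d) ∷ L₁) L₂ with c Fin.≟ bar n d
  ... | yes _ = cong ((c , d) ∷_) (expand-++ L₁ L₂)
  ... | no _ = cong (λ X → (c , d) ∷ mirror (c , d) ∷ X) (expand-++ L₁ L₂)

  ¬Meets⇒Disjoint : ∀ {I K : Interval m} → ¬ Meets K I → Disjoint I K
  ¬Meets⇒Disjoint n {x} (a , s≤s b) (c , s≤s d) = n (x , c , d , a , b)

  expand-disjoint : ∀ {c d} L → Pos c → All (BCInterval n) L → All (Disjoint (c , d)) L →
    All (λ X → Disjoint (c , d) X × Disjoint (mirror (c , d)) X) (expand n L)
  expand-disjoint [] pc [] [] = []
  expand-disjoint {c} {d} ((c' , d') ∷ L) pc (bc ∷ bcs) (dis ∷ diss) with c' Fin.≟ bar n d'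
  ... | yes refl = ((λ {_} → dis) , λ {x} p q → dis (∈-mirror⁻ p)
          (subst (λ z → bar n x ∈ᵢ (bar n d' , z)) (bar-involutive n d') (∈-mirror q))) ∷ expand-disjoint L pc bcs diss
  ... | no ne with bc
  ...   | inj₂ (_ , e) = contradiction e ne
  ...   | inj₁ (pc' , _) = ((λ {_} → dis) , (λ {x} p q → Pos⇒∉mirror pc (ℕ.≤-trans pc' (proj₁ q)) p))
            ∷ ((λ {x} p q → Pos⇒∉mirror pc' (ℕ.≤-trans pc (proj₁ p)) q) , (λ {x} p q → dis (∈-mirror⁻ p) (∈-mirror⁻ q)))
            ∷ expand-disjoint L pc bcs diss

  -- The interval with the largest left endpoint goes first: an earlier one meeting it would have to
  -- start further right, so the earlier ones are disjoint from it and, with their mirrors, commute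
  -- past it. A central interval is chosen only when alone, since positive intervals start further
  -- right and central ones nest.
  sort-BC : ∀ k L → List.length L ≤ k → All (BCInterval n) L → All NonSingle L → NonNest L → DescP L →
    ∃ λ S → Desc S × expand n L ~ expand n S × (∀ {P : Interval m → Set} → All P L → All P S)
  sort-BC k [] _ _ _ _ _ = [] , nil , ~-refl , λ a → a
  -- The complement `m ∸ _` makes the extraction of a least value find the largest left endpoint.
  sort-BC (suc k) (I₀ ∷ L₀) len≤′ bc′ ns′ nn′ de′ with extract-min (λ I → m ℕ.∸ toℕ (proj₁ I)) I₀ L₀
  ... | extract L₁ (c , d) L₂ e ub = subst (λ X → ∃ λ S → Desc S × expand n X ~ expand n S × (∀ {P : Interval m → Set} → All P X → All P S)) (sym e)
      (build (All.head (All.++⁻ʳ L₁ bc)))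
    where
    I = c , d
    L = L₁ ++ L₂
    len≤ = subst (λ X → List.length X ≤ suc k) e len≤′
    bc = subst (All (BCInterval n)) e bc′
    ns = subst (All NonSingle) e ns′
    nn : NonNest (L₁ ++ I ∷ L₂)
    nn = subst (λ X → NonNest X) e (λ {_} {_} → nn′)
    de : DescP (L₁ ++ I ∷ L₂)
    de = subst (λ X → DescP X) e (λ {_} {_} → de′)
    sub : L ⊆ (L₁ ++ I ∷ L₂)
    sub = drop-middle I L₁
    short : List.length L ≤ k
    short = ℕ.≤-pred (subst (_≤ suc k) (trans (List.length-++ L₁) (trans (ℕ.+-suc _ _) (cong suc (sym (List.length-++ L₁))))) len≤)
    starts : All (λ K → proj₁ K Fin.≤ c) L
    starts = All.map (λ {K} l → ℕ.∸-cancelʳ-≤ (ℕ.<⇒≤ (Fin.toℕ<n (proj₁ K))) l) ub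
    unnested : All (λ K → ¬ NestedIn I K × ¬ NestedIn K I) L
    unnested = All.++⁺ (All.tabulate (λ K∈ → let a , b = nn (before L₂ K∈) in b , a)) (All.tabulate (λ K∈ → nn (after L₁ K∈)))
    c≤ : NonSingle I
    c≤ = All.head (All.++⁻ʳ L₁ ns)
    build : BCInterval n I → ∃ λ S → Desc S × expand n (L₁ ++ I ∷ L₂) ~ expand n S × (∀ {P : Interval m → Set} → All P (L₁ ++ I ∷ L₂) → All P S)
    build (inj₂ (pd , refl)) = alone L₁ L₂ (All.zipWith (λ (a , b , n , _) → centre-only a b n) (All-resp-⊆ sub bc , All.zip (starts , unnested)))
      where
      centre-only : ∀ {K} → BCInterval n K → proj₁ K Fin.≤ bar n d → ¬ NestedIn I K → ⊥
      centre-only (inj₁ (pk , _)) l _ = ℕ.<⇒≱ (Pos-bar pd) (ℕ.≤-trans pk l)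
      centre-only {K} (inj₂ (_ , refl)) l ne = ne (l , subst₂ Fin._≤_ (bar-involutive n d) (bar-involutive n (proj₂ K)) (bar-≤ l))
      alone : ∀ L₁ L₂ → All (λ _ → ⊥) (L₁ ++ L₂) →
        ∃ λ S → Desc S × expand n (L₁ ++ I ∷ L₂) ~ expand n S × (∀ {P : Interval m → Set} → All P (L₁ ++ I ∷ L₂) → All P S)
      alone [] [] _ = I ∷ [] , centre pd , ~-refl , λ a → a
      alone [] (_ ∷ _) (() ∷ _)
      alone (_ ∷ _) _ (() ∷ _)
    build (inj₁ (pc , c≤d)) with sort-BC k L short (All-resp-⊆ sub bc) (All-resp-⊆ sub ns) (λ p → nn (⊆-trans p sub)) (λ p → de (⊆-trans p sub))
    ... | S , dS , r , transfer = I ∷ S , pos pc c<d (transfer smaller) dS , moved ,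
        λ a → All.head (All.++⁻ʳ L₁ a) ∷ transfer (All-resp-⊆ sub a)
      where
      c<d : c Fin.< d
      c<d = ℕ.≤∧≢⇒< c≤d (c≤ ∘ Fin.toℕ-injective)
      smaller : All (λ K → proj₁ K Fin.< c × proj₂ K Fin.< d) L
      smaller = All.zipWith (λ { (l , n₁ , n₂) → let d< = ℕ.≰⇒> (λ k → n₁ (l , k)) in ℕ.≤∧≢⇒< l (λ e → n₂ (ℕ.≤-reflexive (sym e) , ℕ.<⇒≤ d<)) , d< }) (starts , unnested)
      dis : All (Disjoint I) L₁
      dis = All.tabulate (λ {K} K∈ → ¬Meets⇒Disjoint {I} {K} (λ mt → ℕ.<⇒≱ (de (before L₂ K∈) mt) (All.lookup (All.++⁻ˡ L₁ starts) K∈)))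
      both = expand-disjoint L₁ pc (All.++⁻ˡ L₁ bc) dis
      E₁ = expand n L₁
      E₂ = expand n L₂
      moved : expand n (L₁ ++ I ∷ L₂) ~ expand n (I ∷ S)
      moved = subst₂ _~_ (sym (trans (expand-++ L₁ (I ∷ L₂)) (cong (E₁ ++_) (expand-pos {S = L₂} pc c<d)))) (sym (expand-pos {S = S} pc c<d))
        (~-trans (~-to-front E₁ {I} {mirror I ∷ E₂} (All.map (λ q → proj₁ q) both))
          (~-cons (~-trans (~-to-front E₁ {mirror I} {E₂} (All.map (λ q → proj₂ q) both))
            (~-cons (subst (_~ expand n S) (expand-++ L₁ L₂) r)))))

  DBC⇒Desc : ∀ N → InDBC n N → ∃ λ S → Desc S × N ≅ netOf (expand n S)
  DBC⇒Desc N (L , bc , nn , de , i) with sort-BC (List.length L⁰) L⁰ ℕ.≤-refl (All-resp-⊆ (filter-⊆ nonSingle? L) bc) (All.all-filter nonSingle? L)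
      (NonNest-⊆ (filter-⊆ nonSingle? L) (toNonNest nn)) de'
    where
    L⁰ = filter nonSingle? L
    de' : DescP L⁰
    de' p with ⊆⇒lookup₂ (⊆-trans p (filter-⊆ nonSingle? L))
    ... | i , j , l , refl , refl = de i j l
  ... | S , dS , r , _ = S , dS , ≅-trans N (prodBC n L) (netOf (expand n S)) i
    (≅-trans (prodBC n L) (netOf (expand n (filter nonSingle? L))) (netOf (expand n S)) (prodBC≅netOf n L) (~⇒≅ r))

  -- The correspondence

  avoiding⇒Desc : ∀ f (b : IsBn n f) → AvoidsAll5 n f → ∃ λ S → Desc S × IsMax (expand n S) (toPerm f (proj₁ b))
  avoiding⇒Desc f (p , sy) av with toDesc n (toPerm f p) (avoids⇒Special (toPerm f p) sy av) m (ℕ.m≤m+n n n) ℕ.≤-refl ℕ.≤-refl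
      (λ x l → contradiction l (ℕ.<⇒≱ (Fin.toℕ<n x)))
  ... | S , dS , mx , _ = S , dS , mx

  code-unique : ∀ {L₁ L₂ : List (Interval m)} {s₁ s₂} (w : Pm m) → Code L₁ s₁ → Code L₂ s₂ →
    IsWOf (netOf L₁) (w ·_) → IsWOf (netOf L₂) (w ·_) → L₁ ~ L₂
  code-unique w C₁ C₂ h₁ h₂ = code-injective w C₁ C₂ (max C₁ h₁) (max C₂ h₂)
    where
    max : ∀ {L s} → Code L s → IsWOf (netOf L) (w ·_) → IsMax L w
    max {L} C h with code-max C
    ... | w' , mx = IsMax-cong w' w (IsWOf-unique (netOf L) (w' ·_) (w ·_) (IsMax⇒IsWOf L w' mx) h) mx

theorem5p19 : (n : ℕ) →
    (∀ (N : Network (n + n)) →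
    InDBC n N ⇔ (InZA N × ∃ λ w → IsBn n w × AvoidsAll5 n w × IsWOf N w))
    ×
    (∀ (w : Fin (n + n) → Fin (n + n)) → IsBn n w → AvoidsAll5 n w →
    ∃ λ (N : Network (n + n)) → InZA N × IsWOf N w)
theorem5p19 n = (λ N → mk⇔ (to N) (from N)) , exists
  where
  open BC n
  to : ∀ N → InDBC n N → InZA N × ∃ λ w → IsBn n w × AvoidsAll5 n w × IsWOf N w
  to N h with DBC⇒Desc N h
  ... | S , dS , i with Desc-max dS
  ...   | w , mx , sp = Desc⇒ZA N dS i , (w ·_) , (·-injective w , Special.symm sp) , Special⇒avoids w sp ,
          IsWOf-≅ (netOf (expand n S)) N (w ·_) (≅-sym N (netOf (expand n S)) i) (IsMax⇒IsWOf (expand n S) w mx)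
  from : ∀ N → (InZA N × ∃ λ w → IsBn n w × AvoidsAll5 n w × IsWOf N w) → InDBC n N
  from N (za , f , bn , av , h) with InZA⇒Code N za | avoiding⇒Desc f bn av
  ... | L₁ , _ , C₁ , i₁ | S , dS , mx with toCode (List.length (expand n S)) (expand n S) ℕ.≤-refl (expand-proper dS) (expand-NonNest dS) (expand-ZZ dS)
  ...   | L₂ , _ , C₂ , r = let S' , bc , nn , de , i = Desc⇒DBC dS in S' , bc , nn , de , ≅-trans N (prodBC n S) (prodBC n S') iso i
    where
    w = toPerm f (proj₁ bn)
    E = expand n S
    -- One code comes from `N`, the other from the descending product made for `w`, whose expansion
    -- is a zig-zag list. Both have `w` as longest type, so `N` and that product agree up to
    -- commutations.
    L₁~L₂ : L₁ ~ L₂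
    L₁~L₂ = code-unique w C₁ C₂ (IsWOf-≅ N (netOf L₁) f i₁ h)
      (IsWOf-≅ (netOf E) (netOf L₂) f (~⇒≅ r) (IsMax⇒IsWOf E w mx))
    iso : N ≅ prodBC n S
    iso = ≅-trans N (netOf L₁) (prodBC n S) i₁ (≅-trans (netOf L₁) (netOf E) (prodBC n S) (~⇒≅ (~-trans L₁~L₂ (~-sym r)))
      (≅-sym (prodBC n S) (netOf E) (prodBC-Desc dS)))
  exists : ∀ w → IsBn n w → AvoidsAll5 n w → ∃ λ (N : Network (n + n)) → InZA N × IsWOf N w
  exists f bn av with avoiding⇒Desc f bn av
  ... | S , dS , mx = netOf (expand n S) , Desc⇒ZA (netOf (expand n S)) dS (≅-refl (netOf (expand n S))) ,
    IsMax⇒IsWOf (expand n S) (toPerm f (proj₁ bn)) mx
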